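{- Let $p$ be an odd prime, $k\ge2$ and $s>k+2$. Put $S=\sum_{j=0}^{k-1}p^j$, $A_s=2(s-1)p^{k+1}-2(s-k)+3$ and $c_s=\frac{p^{s-2-k}(p-1)}{2}$. For $0\le l<p^k$, the $p^k$-Fibonacci number of $V_{s,l}$ is as follows. (a) If $l=0$: $\mathcal M_{V_{s,l}}=c_sA_s$. (b) If $0\le i\le k-2$, $1\le t\le p-1$ and $(t-1)\sum_{\iota=i}^{k-1}p^\iota+p^i\le l\le (t-1)\sum_{\iota=i+1}^{k-1}p^\iota+p^{i+1}-1$: $\mathcal M_{V_{s,l}}=c_s\big(A_s+2tS-2\sum_{\mu=0}^{k-i-2}p^\mu\big)$ if $1\le t\le\frac{p-1}{2}$, and $\mathcal M_{V_{s,l}}=c_s\big(A_s+(2t-2p)S-2\sum_{\mu=0}^{k-i-2}p^\mu\big)$ if $\frac{p+1}{2}\le t\le p-1$. (c) If $1\le t\le p-1$, $t\ne\frac{p-1}{2}$, and $tp^{k-1}\le l\le tS$: $\mathcal M_{V_{s,l}}=c_s(A_s+2tS)$ if $1\le t\le\frac{p-3}{2}$, and $\mathcal M_{V_{s,l}}=c_s(A_s+(2t-2p)S)$ if $\frac{p+1}{2}\le t\le p-1$. (d) If $1\le i'\le k-1$ and $\frac{p-1}{2}\sum_{\iota=i'}^{k-1}p^\iota\le l\le\frac{p-1}{2}\sum_{\iota=i'-1}^{k-1}p^\iota-1$: $\mathcal M_{V_{s,l}}=c_s\Big(A_s-p^k-2\sum_{\theta=1}^{k-1}p^\theta+2\sum_{\mu=k-i'+1}^{k}p^\mu-1\Big)$.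 (e) If $l=\frac{p-1}{2}S$: $\mathcal M_{V_{s,l}}=c_s\Big(A_s-p^k-2\sum_{\theta=1}^{k-1}p^\theta-1\Big)$.
   Context: Fix an odd prime $p$ and an integer $k\ge 0$. For integers $0\le i<n$ write $\lambda(n,i)=(n-i,1^i)$ for the hook partition of $n$ with $n-i$ boxes in its first row and $i$ further boxes in its first column. If $\mu=\lambda(n',i')$ is obtained from $\lambda(n,i)$ by appending $m=(n'-i')-(n-i)\ge 0$ boxes to the first row and $n''=i'-i\ge 0$ boxes to the first column, we say $\mu$ is obtained by adding the block $B_{m,n''}$ ($m$ horizontal nodes, $n''$ vertical nodes). Put $x_s=p^k(sp-(s+1))$. The relevant part ("column $k$") of the $p$-Bratteli diagram is the graded directed graph with vertices: on floor $2k+1$, $S_i=\lambda(p^k(p-1),i)$ for $0\le i<p^k(p-1)$; on floor $2(k+s)$ ($s\ge1$), $V_{s,l}=\lambda\big(p^k(2sp-(2s+1)),\,x_s+l\big)$ for $0\le l<p^k$; on floor $2(k+s)-1$ ($s\ge2$), $W_{s,l'}=\lambda\big(p^k((2s-1)p-2s),\,x_{s-1}+l'\big)$ for $0\le l'<p^{k+1}$; and edges, each labelled by the block added: (E1) $S_i\to V_{1,l}$ exactly when $i=p^kt+l$ with $0\le t\le p-2$, block $B_{p^kt,\,p^k(p-2-t)}$; (E2) for $s\ge2$, $0\le l<p^k$, $0\le\beta\le p-1$: $V_{s-1,l}\to W_{s,pl+\beta}$, block $B_{p^k(p-1)-((p-1)l+\beta),\,(p-1)l+\beta}$; (E3) for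 $s\ge 2$, $0\le l'<p^{k+1}$ and $t=\lfloor l'/p^k\rfloor$: $W_{s,l'}\to V_{s,l'-p^kt}$, block $B_{p^kt,\,p^k(p-1-t)}$. A path ending at a vertex $v$ is a sequence of edges starting at some $S_i$ and going up one floor at a time to $v$ ($S_i\to V_{1,\cdot}\to W_{2,\cdot}\to V_{2,\cdot}\to W_{3,\cdot}\to\cdots\to v$); $\mathcal P(v)$ is the set of all paths ending at $v$. The blocks of a path are numbered $B^2,B^3,\dots,B^N$: $B^2$ is the block of the edge leaving $S_i$, and for $j\ge2$, $B^{2j-1}$ is the block of the edge into $W_{j,\cdot}$ and $B^{2j}$ the block of the edge into $V_{j,\cdot}$. Write $B^j=B_{m_j,n_j}$. Descents: $1\in\mathrm{Des}(P)$ iff $m_2=p^kt$ with $0\le t<\frac{p-1}{2}$; $2\notin\mathrm{Des}(P)$; for $3\le j<N$, $j\in\mathrm{Des}(P)$ iff $m_j>m_{j+1}$ and $n_j<n_{j+1}$. $\mathrm{des}(P)=|\mathrm{Des}(P)|$. The $p^k$-Fibonacci number of a vertex $v$ is $\mathcal M_v=\sum_{P\in\mathcal P(v)}\mathrm{des}(P)$. -}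

module Defs where

open import Data.Empty using (⊥; ⊥-elim; ⊥-elim-irr)
open import Data.Fin using (Fin; toℕ)
open import Data.Fin.Properties using (toℕ<n; toℕ≤pred[n])
open import Data.List using (List; []; _∷_; _∷ʳ_; [_]; map; concat; filter; length; upTo; applyUpTo; allFin)
open import Data.List.Membership.Propositional using (_∈_)
open import Data.List.Membership.Propositional.Properties using (∈-map⁺; ∈-map⁻; ∈-concat⁺′; ∈-allFin)
open import Data.List.Properties using (length-++)
open import Data.List.Relation.Unary.All as All using ([]; _∷_)
import Data.List.Relation.Unary.All.Properties as All
import Data.List.Relation.Unary.AllPairs as AllPairs
import Data.List.Relation.Unary.AllPairs.Properties as AllPairs
open import Data.List.Relation.Unary.AllPairs using ([]; _∷_)
open import Data.List.Relation.Unary.Any using (here)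
open import Data.List.Relation.Unary.Unique.Propositional using (Unique)
import Data.List.Relation.Unary.Unique.Propositional.Properties as Unique
open import Data.Nat
open import Data.Nat.Base using (nonTrivial⇒n>1)
open import Data.Nat.Divisibility using (_∤_; ∣-refl)
open import Data.Nat.ListAction using (sum)
open import Data.Nat.DivMod using (_/_; m<n*o⇒m/o<n; m/n*n≤m)
open import Data.Nat.Primality using (Prime; prime⇒nonZero; prime⇒nonTrivial)
open import Data.Nat.Properties
open import Data.Nat.Tactic.RingSolver using (solve-∀)
open import Data.Product using (Σ; ∃; _×_; _,_; proj₁; proj₂)
open import Relation.Binary.PropositionalEquality using (_≡_; _≢_; refl; sym; trans; cong; cong₂; subst; module ≡-Reasoning)
open import Relation.Nullary using (Dec; yes; no; Irrelevant; recompute; _×-dec_)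

-- A listing of a type without omission or repetition: sums over it are the
-- sums over the finite set of all elements of the type.
record Enumeration (A : Set) : Set where
  field
    elements : List A
    complete : ∀ a → a ∈ elements
    unique   : Unique elements

open Enumeration public

sumOver : {A : Set} → Enumeration A → (A → ℕ) → ℕ
sumOver E f = sum (map f (elements E))

enumFin : ∀ n → Enumeration (Fin n)
enumFin n = record { elements = allFin n ; complete = ∈-allFin ; unique = Unique.allFin⁺ n }

enumSingleton : {A : Set} (a : A) → (∀ b → b ≡ a) → Enumeration A
enumSingleton a all = record
  { elements = [ a ] ; complete = λ b → here (all b) ; unique = [] ∷ [] }

enumDec : {P : Set} → Dec P → Irrelevant P → Enumeration P
enumDec (yes p) irr = enumSingleton p (λ q → irr q p)
enumDec (no ¬p) irr = record { elements = [] ; complete = λ p → ⊥-elim (¬p p) ; unique = [] }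

enumΣ : {A : Set} {B : A → Set} → Enumeration A → (∀ a → Enumeration (B a)) → Enumeration (Σ A B)
enumΣ {A} {B} E F = record
  { elements = concat (map fibre (elements E))
  ; complete = λ where
      (a , b) → ∈-concat⁺′ (∈-map⁺ (a ,_) (complete (F a) b)) (∈-map⁺ fibre (complete E a))
  ; unique = Unique.concat⁺
      (All.map⁺ (All.universal (λ a → Unique.map⁺ (λ { refl → refl }) (unique (F a))) (elements E)))
      (AllPairs.map⁺ (AllPairs.map disjoint (unique E)))
  }
  where
  fibre : A → List (Σ A B)
  fibre a = map (a ,_) (elements (F a))

  disjoint : ∀ {a a′} → a ≢ a′ → ∀ {v} → v ∈ fibre a × v ∈ fibre a′ → ⊥
  disjoint {a} {a′} a≢a′ (v∈ , v∈′) =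
    a≢a′ (trans (sym (cong proj₁ (proj₂ (proj₂ (∈-map⁻ (a ,_) v∈)))))
                (cong proj₁ (proj₂ (proj₂ (∈-map⁻ (a′ ,_) v∈′)))))

enumImage : {A B : Set} (f : A → B) → (∀ {x y} → f x ≡ f y → x ≡ y) →
            (∀ b → ∃ λ a → f a ≡ b) → Enumeration A → Enumeration B
enumImage f inj surj E = record
  { elements = map f (elements E)
  ; complete = λ b → subst (_∈ map f (elements E)) (proj₂ (surj b)) (∈-map⁺ f (complete E (proj₁ (surj b))))
  ; unique   = Unique.map⁺ inj (unique E)
  }

-- The hook partition λ(n, i) = (n - i, 1^i) with n = size and i = leg.
record Hook : Set where
  constructor hook
  field
    size      : ℕ
    leg       : ℕ
    .leg<size : leg < size

  firstRow : ℕ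
  firstRow = size ∸ leg

-- B m n stands for B_{m,n}: m horizontal nodes and n vertical nodes.
record Block : Set where
  constructor B
  field
    horizontal : ℕ
    vertical   : ℕ

open Block public

nthBlock : List Block → ℕ → Block
nthBlock []       _       = B 0 0
nthBlock (b ∷ _)  zero    = b
nthBlock (_ ∷ bs) (suc n) = nthBlock bs n

AddsBlock : Hook → Hook → Block → Set
AddsBlock ν μ b = (Hook.firstRow μ ≡ Hook.firstRow ν + horizontal b)
                × (Hook.leg μ ≡ Hook.leg ν + vertical b)

private
  addsBlock : ∀ {ν μ} b → Hook.size μ ≡ Hook.size ν + (horizontal b + vertical b) →
              Hook.leg μ ≡ Hook.leg ν + vertical b → AddsBlock ν μ b
  addsBlock {hook N i i<N} {μ} (B m n) refl refl = row , refl
    where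
    i≤N : i ≤ N
    i≤N = <⇒≤ (recompute (i <? N) i<N)
    open ≡-Reasoning
    row : N + (m + n) ∸ (i + n) ≡ N ∸ i + m
    row = begin
      N + (m + n) ∸ (i + n)   ≡⟨ cong₂ _∸_ (trans (sym (+-assoc N m n)) (+-comm (N + m) n)) (+-comm i n) ⟩
      n + (N + m) ∸ (n + i)   ≡⟨ [m+n]∸[m+o]≡n∸o n (N + m) i ⟩
      N + m ∸ i               ≡⟨ cong (_∸ i) (+-comm N m) ⟩
      m + N ∸ i               ≡⟨ +-∸-assoc m i≤N ⟩
      m + (N ∸ i)             ≡⟨ +-comm m (N ∸ i) ⟩
      N ∸ i + m               ∎

  -- Every size and leg length below has the form p^k * d n with d n = np - (n + 1).
  d-+ : ∀ p a b → 2 ≤ p → 1 ≤ a →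
        (a + b) * p ∸ (a + b + 1) ≡ (a * p ∸ (a + 1)) + b * (p ∸ 1)
  d-+ (suc r@(suc _)) a@(suc _) b (s≤s _) _ = begin
    (a + b) * suc r ∸ (a + b + 1)   ≡⟨ reduce (a + b) ⟩
    (a + b) * r ∸ 1                 ≡⟨ cong (_∸ 1) (*-distribʳ-+ r a b) ⟩
    (a * r + b * r) ∸ 1             ≡⟨ +-∸-comm (b * r) (s≤s z≤n) ⟩
    (a * r ∸ 1) + b * r             ≡⟨ cong (_+ b * r) (sym (reduce a)) ⟩
    (a * suc r ∸ (a + 1)) + b * r   ∎
    where
    open ≡-Reasoning
    reduce : ∀ n → n * suc r ∸ (n + 1) ≡ n * r ∸ 1
    reduce n = trans (cong (_∸ (n + 1)) (*-suc n r)) ([m+n]∸[m+o]≡n∸o n (n * r) 1)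

  q*d-+ : ∀ q p a b → 2 ≤ p → 1 ≤ a →
          q * ((a + b) * p ∸ (a + b + 1)) ≡ q * (a * p ∸ (a + 1)) + q * (b * (p ∸ 1))
  q*d-+ q p a b 2≤p 1≤a = trans (cong (q *_) (d-+ p a b 2≤p 1≤a)) (*-distribˡ-+ q _ (b * (p ∸ 1)))

  double : ∀ s → 2 * s ≡ s + s
  double = solve-∀

  double-suc : ∀ s → 2 * suc s ≡ 2 * s + 1 + 1
  double-suc = solve-∀

  double-suc-pred : ∀ s → 2 * suc s ∸ 1 ≡ 2 * s + 1
  double-suc-pred s = trans (cong (_∸ 1) (double-suc s)) (m+n∸n≡m (2 * s + 1) 1)

  split-suc : ∀ s → s + suc s ≡ 2 * s + 1
  split-suc = solve-∀

module Column (p k : ℕ) (p-prime : Prime p) (p-odd : 2 ∤ p) where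

  3≤p : 3 ≤ p
  3≤p = ≤∧≢⇒< (nonTrivial⇒n>1 p) (λ { refl → p-odd ∣-refl })
    where instance _ = prime⇒nonTrivial p-prime

  instance
    p≢0 : NonZero p
    p≢0 = prime⇒nonZero p-prime

    p^k≢0 : NonZero (p ^ k)
    p^k≢0 = m^n≢0 p k

  x : ℕ → ℕ
  x s = p ^ k * (s * p ∸ (s + 1))

  data Vertex : Set where
    S : (i : Fin (p ^ k * (p ∸ 1))) → Vertex
    V : (s : ℕ) → .(1 ≤ s) → (l : Fin (p ^ k)) → Vertex
    W : (s : ℕ) → .(2 ≤ s) → (l′ : Fin (p ^ suc k)) → Vertex

  floor : Vertex → ℕ
  floor (S i)     = 2 * k + 1
  floor (V s _ l) = 2 * (k + s)
  floor (W s _ l) = 2 * (k + s) ∸ 1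

  private
    2≤p : 2 ≤ p
    2≤p = ≤-trans (s≤s (s≤s z≤n)) 3≤p

    1≤p∸1 : 1 ≤ p ∸ 1
    1≤p∸1 = ∸-monoˡ-≤ 1 2≤p

    V-size : ∀ s → 1 ≤ s → p ^ k * (2 * s * p ∸ (2 * s + 1)) ≡ x s + p ^ k * (s * (p ∸ 1))
    V-size s 1≤s = trans (cong (λ n → p ^ k * (n * p ∸ (n + 1))) (double s)) (q*d-+ (p ^ k) p s s 2≤p 1≤s)

    V-leg<size : ∀ s → 1 ≤ s → (l : Fin (p ^ k)) → x s + toℕ l < p ^ k * (2 * s * p ∸ (2 * s + 1))
    V-leg<size s 1≤s l = subst (x s + toℕ l <_) (sym (V-size s 1≤s))
      (+-monoʳ-< (x s) (<-≤-trans (toℕ<n l)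
        (≤-trans (≤-reflexive (sym (*-identityʳ (p ^ k)))) (*-monoʳ-≤ (p ^ k) (*-mono-≤ 1≤s 1≤p∸1)))))

    -- W_{s+1} has size p^k * d(2s + 1).
    W-size′ : ∀ s → p ^ k * ((2 * suc s ∸ 1) * p ∸ 2 * suc s) ≡ p ^ k * ((2 * s + 1) * p ∸ (2 * s + 1 + 1))
    W-size′ s = cong₂ (λ n m → p ^ k * (n * p ∸ m)) (double-suc-pred s) (double-suc s)

    W-size : ∀ s → 1 ≤ s → p ^ k * ((2 * suc s ∸ 1) * p ∸ 2 * suc s) ≡ x s + p ^ k * (suc s * (p ∸ 1))
    W-size s 1≤s = trans (W-size′ s)
      (trans (cong (λ n → p ^ k * (n * p ∸ (n + 1))) (sym (split-suc s))) (q*d-+ (p ^ k) p s (suc s) 2≤p 1≤s))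

    p≤2[p∸1] : p ≤ 2 * (p ∸ 1)
    p≤2[p∸1] = ≤-trans (≤-reflexive (sym (m+[n∸m]≡n (≤-trans (s≤s z≤n) 2≤p))))
      (≤-trans (+-monoˡ-≤ (p ∸ 1) 1≤p∸1) (≤-reflexive (sym (double (p ∸ 1)))))

    W-leg<size : ∀ s → 2 ≤ s → (l′ : Fin (p ^ suc k)) →
                 x (s ∸ 1) + toℕ l′ < p ^ k * ((2 * s ∸ 1) * p ∸ 2 * s)
    W-leg<size (suc s) (s≤s 1≤s) l′ = subst (x s + toℕ l′ <_) (sym (W-size s 1≤s))
      (+-monoʳ-< (x s) (<-≤-trans (toℕ<n l′)
        (≤-trans (≤-reflexive (*-comm p (p ^ k)))
          (*-monoʳ-≤ (p ^ k) (≤-trans p≤2[p∸1] (*-monoˡ-≤ (p ∸ 1) (s≤s 1≤s)))))))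

  shape : Vertex → Hook
  shape (S i)        = hook (p ^ k * (p ∸ 1)) (toℕ i) (toℕ<n i)
  shape (V s 1≤s l)  = hook (p ^ k * (2 * s * p ∸ (2 * s + 1))) (x s + toℕ l) (V-leg<size s 1≤s l)
  shape (W s 2≤s l′) = hook (p ^ k * ((2 * s ∸ 1) * p ∸ 2 * s)) (x (s ∸ 1) + toℕ l′) (W-leg<size s 2≤s l′)

  data Edge : Vertex → Vertex → Set where
    E1 : ∀ {i l} (t : Fin (p ∸ 1)) → toℕ i ≡ p ^ k * toℕ t + toℕ l →
         Edge (S i) (V 1 (s≤s z≤n) l)
    E2 : ∀ {s} .{1≤s : 1 ≤ s} {l l′} (β : Fin p) → toℕ l′ ≡ p * toℕ l + toℕ β →
         Edge (V s 1≤s l) (W (suc s) (s≤s 1≤s) l′)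
    E3 : ∀ {s} .{2≤s : 2 ≤ s} {l l′} → toℕ l ≡ toℕ l′ ∸ p ^ k * (toℕ l′ / p ^ k) →
         Edge (W s 2≤s l′) (V s (<⇒≤ 2≤s) l)

  block : ∀ {u v} → Edge u v → Block
  block (E1 t _)         = B (p ^ k * toℕ t) (p ^ k * (p ∸ 2 ∸ toℕ t))
  block (E2 {l = l} β _) = B (p ^ k * (p ∸ 1) ∸ ((p ∸ 1) * toℕ l + toℕ β)) ((p ∸ 1) * toℕ l + toℕ β)
  block (E3 {l′ = l′} _) = B (p ^ k * (toℕ l′ / p ^ k)) (p ^ k * (p ∸ 1 ∸ toℕ l′ / p ^ k))

  data Path : Vertex → Set where
    start : ∀ i → Path (S i)
    _▷_   : ∀ {u v} → Path u → Edge u v → Path v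

  infixl 5 _▷_

  -- The blocks B^2, B^3, …, B^N of a path, in this order.
  blocks : ∀ {v} → Path v → List Block
  blocks (start i) = []
  blocks (P ▷ e)   = blocks P ∷ʳ block e

  lastIndex : ∀ {v} → Path v → ℕ
  lastIndex P = suc (length (blocks P))

  -- B^j for 2 ≤ j ≤ N; the value outside this range is never used.
  blockAt : ∀ {v} → Path v → ℕ → Block
  blockAt P j = nthBlock (blocks P) (j ∸ 2)

  m n : ∀ {v} → Path v → ℕ → ℕ
  m P j = horizontal (blockAt P j)
  n P j = vertical (blockAt P j)

  -- The condition for j ∈ Des(P), for 1 ≤ j < N.
  IsDescent : ∀ {v} → Path v → ℕ → Set
  IsDescent P 0 = ⊥
  IsDescent P 1 = ∃ λ t → t < (p ∸ 1) / 2 × m P 2 ≡ p ^ k * t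
  IsDescent P 2 = ⊥
  IsDescent P j@(suc (suc (suc _))) = m P j > m P (suc j) × n P j < n P (suc j)

  isDescent? : ∀ {v} (P : Path v) j → Dec (IsDescent P j)
  isDescent? P 0 = no λ ()
  isDescent? P 1 = anyUpTo? (λ t → m P 2 ≟ p ^ k * t) ((p ∸ 1) / 2)
  isDescent? P 2 = no λ ()
  isDescent? P j@(suc (suc (suc _))) = (m P (suc j) <? m P j) ×-dec (n P j <? n P (suc j))

  Des : ∀ {v} → Path v → List ℕ
  Des P = filter (isDescent? P) (upTo (lastIndex P))

  des : ∀ {v} → Path v → ℕ
  des P = length (Des P)

  step₁ : ∀ {l} → (Σ (Fin (p ^ k * (p ∸ 1))) λ i → Σ (Fin (p ∸ 1)) λ t → toℕ i ≡ p ^ k * toℕ t + toℕ l) →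
          Path (V 1 (s≤s z≤n) l)
  step₁ (i , t , eq) = start i ▷ E1 t eq

  step₁-surj : ∀ {l} (P : Path (V 1 (s≤s z≤n) l)) → ∃ λ a → step₁ a ≡ P
  step₁-surj (start i ▷ E1 t eq)     = (i , t , eq) , refl
  step₁-surj (_ ▷ E3 {2≤s = 2≤1} _)  = ⊥-elim-irr (<-irrefl refl 2≤1)

  step₂ : ∀ {s} .{1≤s : 1 ≤ s} {l′} →
          (Σ (Fin (p ^ k)) λ l → Σ (Fin p) λ β → Σ (toℕ l′ ≡ p * toℕ l + toℕ β) λ _ → Path (V s 1≤s l)) →
          Path (W (suc s) (s≤s 1≤s) l′)
  step₂ (l , β , eq , P) = P ▷ E2 β eq

  step₂-surj : ∀ {s} .{1≤s : 1 ≤ s} {l′} (P : Path (W (suc s) (s≤s 1≤s) l′)) →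
               ∃ λ a → step₂ {1≤s = 1≤s} a ≡ P
  step₂-surj (P ▷ E2 {l = l} β eq) = (l , β , eq , P) , refl

  step₃ : ∀ {s} .{2≤s : 2 ≤ suc (suc s)} {l} →
          (Σ (Fin (p ^ suc k)) λ l′ → Σ (toℕ l ≡ toℕ l′ ∸ p ^ k * (toℕ l′ / p ^ k)) λ _ →
            Path (W (suc (suc s)) 2≤s l′)) →
          Path (V (suc (suc s)) (<⇒≤ 2≤s) l)
  step₃ (l′ , eq , P) = P ▷ E3 eq

  step₃-surj : ∀ {s} .{2≤s : 2 ≤ suc (suc s)} {l} (P : Path (V (suc (suc s)) (<⇒≤ 2≤s) l)) →
               ∃ λ a → step₃ {2≤s = 2≤s} a ≡ P
  step₃-surj (P ▷ E3 {l′ = l′} eq) = (l′ , eq , P) , refl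

  𝒫V : ∀ s .(1≤s : 1 ≤ s) (l : Fin (p ^ k)) → Enumeration (Path (V s 1≤s l))
  𝒫W : ∀ s .(2≤s : 2 ≤ s) (l′ : Fin (p ^ suc k)) → Enumeration (Path (W s 2≤s l′))

  𝒫V zero          1≤0 l = ⊥-elim-irr (<-irrefl refl 1≤0)
  𝒫V (suc zero)    _   l = enumImage step₁ (λ { refl → refl }) step₁-surj
    (enumΣ (enumFin _) λ i → enumΣ (enumFin _) λ t →
      enumDec (toℕ i ≟ p ^ k * toℕ t + toℕ l) ≡-irrelevant)
  𝒫V (suc (suc s)) _   l = enumImage step₃ (λ { refl → refl }) step₃-surj
    (enumΣ (enumFin _) λ l′ →
      enumΣ (enumDec (toℕ l ≟ toℕ l′ ∸ p ^ k * (toℕ l′ / p ^ k)) ≡-irrelevant) λ _ →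
        𝒫W (suc (suc s)) (s≤s (s≤s z≤n)) l′)

  𝒫W zero    2≤0 l′ = ⊥-elim-irr (n≮0 2≤0)
  𝒫W (suc s) 2≤s l′ = enumImage step₂ (λ { refl → refl }) step₂-surj
    (enumΣ (enumFin _) λ l → enumΣ (enumFin p) λ β →
      enumΣ (enumDec (toℕ l′ ≟ p * toℕ l + toℕ β) ≡-irrelevant) λ _ → 𝒫V s (s≤s⁻¹ 2≤s) l)

  𝒫 : ∀ v → Enumeration (Path v)
  𝒫 (S i)        = enumSingleton (start i) (λ { (start i) → refl })
  𝒫 (V s 1≤s l)  = 𝒫V s 1≤s l
  𝒫 (W s 2≤s l′) = 𝒫W s 2≤s l′

  𝓜 : Vertex → ℕ
  𝓜 v = sumOver (𝒫 v) des

  -- The given blocks are the ones that have to be added to the hook of the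
  -- source to obtain the hook of the target.
  edge-addsBlock : ∀ {u v} (e : Edge u v) → AddsBlock (shape u) (shape v) (block e)
  edge-addsBlock e@(E1 {i} {l} t eq) = addsBlock {shape (S i)} {shape (V 1 (s≤s z≤n) l)} (block e) size leg
    where
    open ≡-Reasoning
    t≤ : toℕ t ≤ p ∸ 2
    t≤ = subst (toℕ t ≤_) (trans (pred[m∸n]≡m∸[1+n] p 1) refl) (toℕ≤pred[n] t)
    total : p ^ k * toℕ t + p ^ k * (p ∸ 2 ∸ toℕ t) ≡ p ^ k * (p ∸ 2)
    total = trans (sym (*-distribˡ-+ (p ^ k) (toℕ t) _)) (cong (p ^ k *_) (m+[n∸m]≡n t≤))
    x1 : x 1 ≡ p ^ k * (p ∸ 2)
    x1 = cong (λ r → p ^ k * (r ∸ 2)) (*-identityˡ p)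
    size : p ^ k * (2 * p ∸ 3) ≡ p ^ k * (p ∸ 1) + (p ^ k * toℕ t + p ^ k * (p ∸ 2 ∸ toℕ t))
    size = begin
      p ^ k * (2 * p ∸ 3)                ≡⟨ V-size 1 (s≤s z≤n) ⟩
      x 1 + p ^ k * (1 * (p ∸ 1))        ≡⟨ cong₂ _+_ x1 (cong (p ^ k *_) (*-identityˡ (p ∸ 1))) ⟩
      p ^ k * (p ∸ 2) + p ^ k * (p ∸ 1)  ≡⟨ +-comm (p ^ k * (p ∸ 2)) _ ⟩
      p ^ k * (p ∸ 1) + p ^ k * (p ∸ 2)  ≡⟨ cong (λ z → p ^ k * (p ∸ 1) + z) (sym total) ⟩
      p ^ k * (p ∸ 1) + (p ^ k * toℕ t + p ^ k * (p ∸ 2 ∸ toℕ t)) ∎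
    rearrange : ∀ a b c → a + b + c ≡ a + c + b
    rearrange = solve-∀
    leg : x 1 + toℕ l ≡ toℕ i + p ^ k * (p ∸ 2 ∸ toℕ t)
    leg = begin
      x 1 + toℕ l                                                ≡⟨ cong (_+ toℕ l) (trans x1 (sym total)) ⟩
      p ^ k * toℕ t + p ^ k * (p ∸ 2 ∸ toℕ t) + toℕ l  ≡⟨ rearrange (p ^ k * toℕ t) _ (toℕ l) ⟩
      p ^ k * toℕ t + toℕ l + p ^ k * (p ∸ 2 ∸ toℕ t)  ≡⟨ cong (λ z → z + p ^ k * (p ∸ 2 ∸ toℕ t)) (sym eq) ⟩
      toℕ i + p ^ k * (p ∸ 2 ∸ toℕ t)                  ∎
  edge-addsBlock e@(E2 {s} {1≤s} {l} {l′} β eq) =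
    addsBlock {shape (V s 1≤s l)} {shape (W (suc s) (s≤s 1≤s) l′)} (block e) size leg
    where
    open ≡-Reasoning
    1≤s′ : 1 ≤ s
    1≤s′ = recompute (1 ≤? s) 1≤s
    N = (p ∸ 1) * toℕ l + toℕ β
    N≤ : N ≤ p ^ k * (p ∸ 1)
    N≤ = ≤-trans (+-monoʳ-≤ ((p ∸ 1) * toℕ l) (≤-trans (toℕ≤pred[n] β) (≤-reflexive (sym (*-identityʳ (p ∸ 1))))))
      (≤-trans (≤-reflexive (trans (sym (*-distribˡ-+ (p ∸ 1) (toℕ l) 1)) (cong ((p ∸ 1) *_) (+-comm (toℕ l) 1))))
        (≤-trans (*-monoʳ-≤ (p ∸ 1) (toℕ<n l)) (≤-reflexive (*-comm (p ∸ 1) (p ^ k)))))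
    size : p ^ k * ((2 * suc s ∸ 1) * p ∸ 2 * suc s) ≡
           p ^ k * (2 * s * p ∸ (2 * s + 1)) + (p ^ k * (p ∸ 1) ∸ N + N)
    size = begin
      p ^ k * ((2 * suc s ∸ 1) * p ∸ 2 * suc s)        ≡⟨ W-size′ s ⟩
      p ^ k * ((2 * s + 1) * p ∸ (2 * s + 1 + 1))      ≡⟨ q*d-+ (p ^ k) p (2 * s) 1 2≤p (≤-trans 1≤s′ (m≤n*m s 2)) ⟩
      p ^ k * (2 * s * p ∸ (2 * s + 1)) + p ^ k * (1 * (p ∸ 1))
        ≡⟨ cong (λ z → p ^ k * (2 * s * p ∸ (2 * s + 1)) + z) (trans (cong (p ^ k *_) (*-identityˡ (p ∸ 1))) (sym (m∸n+n≡m N≤))) ⟩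
      p ^ k * (2 * s * p ∸ (2 * s + 1)) + (p ^ k * (p ∸ 1) ∸ N + N) ∎
    rearrange : ∀ X r a b → X + ((1 + r) * a + b) ≡ X + a + (r * a + b)
    rearrange = solve-∀
    leg : x s + toℕ l′ ≡ x s + toℕ l + N
    leg = begin
      x s + toℕ l′                              ≡⟨ cong (x s +_) eq ⟩
      x s + (p * toℕ l + toℕ β)                 ≡⟨ cong (λ r → x s + (r * toℕ l + toℕ β)) (sym (m+[n∸m]≡n (≤-trans (s≤s z≤n) 2≤p))) ⟩
      x s + ((1 + (p ∸ 1)) * toℕ l + toℕ β)     ≡⟨ rearrange (x s) (p ∸ 1) (toℕ l) (toℕ β) ⟩
      x s + toℕ l + N                           ∎
  edge-addsBlock e@(E3 {zero} {2≤s} _) = ⊥-elim-irr (n≮0 2≤s)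
  edge-addsBlock e@(E3 {suc s} {2≤s} {l} {l′} eq) =
    addsBlock {shape (W (suc s) 2≤s l′)} {shape (V (suc s) (<⇒≤ 2≤s) l)} (block e) size leg
    where
    open ≡-Reasoning
    1≤s : 1 ≤ s
    1≤s = recompute (1 ≤? s) (s≤s⁻¹ 2≤s)
    t = toℕ l′ / p ^ k
    t≤ : t ≤ p ∸ 1
    t≤ = ∸-monoˡ-≤ 1 (m<n*o⇒m/o<n {n = p} {o = p ^ k} (toℕ<n l′))
    total : p ^ k * t + p ^ k * (p ∸ 1 ∸ t) ≡ p ^ k * (1 * (p ∸ 1))
    total = trans (sym (*-distribˡ-+ (p ^ k) t _))
      (cong (p ^ k *_) (trans (m+[n∸m]≡n t≤) (sym (*-identityˡ (p ∸ 1)))))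
    size : p ^ k * (2 * suc s * p ∸ (2 * suc s + 1)) ≡
           p ^ k * ((2 * suc s ∸ 1) * p ∸ 2 * suc s) + (p ^ k * t + p ^ k * (p ∸ 1 ∸ t))
    size = begin
      p ^ k * (2 * suc s * p ∸ (2 * suc s + 1))
        ≡⟨ cong (λ n → p ^ k * (n * p ∸ (n + 1))) (double-suc s) ⟩
      p ^ k * ((2 * s + 1 + 1) * p ∸ (2 * s + 1 + 1 + 1))
        ≡⟨ q*d-+ (p ^ k) p (2 * s + 1) 1 2≤p (m≤n+m 1 (2 * s)) ⟩
      p ^ k * ((2 * s + 1) * p ∸ (2 * s + 1 + 1)) + p ^ k * (1 * (p ∸ 1))
        ≡⟨ cong₂ _+_ (sym (W-size′ s)) (sym total) ⟩
      p ^ k * ((2 * suc s ∸ 1) * p ∸ 2 * suc s) + (p ^ k * t + p ^ k * (p ∸ 1 ∸ t)) ∎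
    rearrange : ∀ X a b c → X + (a + b) + c ≡ X + (c + a) + b
    rearrange = solve-∀
    leg : x (suc s) + toℕ l ≡ x s + toℕ l′ + p ^ k * (p ∸ 1 ∸ t)
    leg = begin
      x (suc s) + toℕ l
        ≡⟨ cong₂ _+_ (trans (cong x (+-comm 1 s)) (q*d-+ (p ^ k) p s 1 2≤p 1≤s)) eq ⟩
      x s + p ^ k * (1 * (p ∸ 1)) + (toℕ l′ ∸ p ^ k * t)
        ≡⟨ cong (λ z → x s + z + (toℕ l′ ∸ p ^ k * t)) (sym total) ⟩
      x s + (p ^ k * t + p ^ k * (p ∸ 1 ∸ t)) + (toℕ l′ ∸ p ^ k * t)
        ≡⟨ rearrange (x s) (p ^ k * t) _ _ ⟩
      x s + (toℕ l′ ∸ p ^ k * t + p ^ k * t) + p ^ k * (p ∸ 1 ∸ t)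
        ≡⟨ cong (λ z → x s + z + p ^ k * (p ∸ 1 ∸ t))
             (m∸n+n≡m (≤-trans (≤-reflexive (*-comm (p ^ k) t)) (m/n*n≤m (toℕ l′) (p ^ k)))) ⟩
      x s + toℕ l′ + p ^ k * (p ∸ 1 ∸ t) ∎

  edge-floor : ∀ {u v} → Edge u v → floor v ≡ suc (floor u)
  edge-floor (E1 _ _) = up k
    where
    up : ∀ k → 2 * (k + 1) ≡ suc (2 * k + 1)
    up = solve-∀
  edge-floor (E2 {s} _ _) = trans (cong (λ n → 2 * n ∸ 1) (+-suc k s)) (double-suc-pred′ (k + s))
    where
    double-suc-pred′ : ∀ n → 2 * suc n ∸ 1 ≡ suc (2 * n)
    double-suc-pred′ n = trans (double-suc-pred n) (+-comm (2 * n) 1)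
  edge-floor (E3 {zero} {2≤s} _) = ⊥-elim-irr (n≮0 2≤s)
  edge-floor (E3 {suc s} _) = subst (λ n → 2 * n ≡ suc (2 * n ∸ 1)) (sym (+-suc k s)) refl

  -- The numbering of the blocks: N = 2s for a path ending at V_s, N = 2s - 1 at W_s.
  lastIndex-floor : ∀ {v} (P : Path v) → 2 * k + lastIndex P ≡ floor v
  lastIndex-floor (start i) = refl
  lastIndex-floor (P ▷ e) = trans
    (cong (λ n → 2 * k + suc n) (trans (length-++ (blocks P)) (+-comm (length (blocks P)) 1)))
    (trans (+-suc (2 * k) (lastIndex P))
      (trans (cong suc (lastIndex-floor P)) (sym (edge-floor e))))

-- Σ_{ι=a}^{b} p^ι
powerSum : ℕ → ℕ → ℕ → ℕ
powerSum p a b = sum (applyUpTo (λ j → p ^ (a + j)) (suc b ∸ a))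

open import Data.Integer as ℤ using (ℤ; +_)

A[_,_,_] : ℕ → ℕ → ℕ → ℤ
A[ p , k , s ] =
  + 2 ℤ.* (+ s ℤ.- + 1) ℤ.* + (p ^ (k + 1)) ℤ.- + 2 ℤ.* (+ s ℤ.- + k) ℤ.+ + 3

-- The division is exact for odd p.
c[_,_,_] : ℕ → ℕ → ℕ → ℤ
c[ p , k , s ] = + ((p ^ (s ∸ 2 ∸ k) * (p ∸ 1)) / 2)

{-# OPTIONS --safe #-}

-- Write p = 2h + 1, q′ = p^(k-1), σ n = 1 + p + ... + p^(n-1), and T f (l) = Σ_{t<p} f (q′ t + ⌊l/p⌋).
-- The predecessors of V_{s,l} two floors below are the V_{s-1,q′t+⌊l/p⌋}, so the Fibonacci numbers of the V_s
-- arise from those of the V_{s-1} by T plus the number of new descents. That number is a constant plus a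
-- multiple of E 0 l, where E 0 is a combination of indicators of thresholds l < h σ k and τ σ k < l.
-- T maps the indicator of a threshold to a constant plus the indicator of another threshold, hence
-- T (E j) = E (j + 1) + const for an explicit E j, and E k = 0. Consequently the Fibonacci numbers are affine
-- in the Horner sum Φ k = Σ_{j<k} p^(k-1-j) E j as soon as s ≥ k + 2, and the cases (a)-(e) are the intervals
-- of l between consecutive thresholds.

module Submission where

open import Defs
open import Data.Empty using (⊥-elim)
open import Data.Fin using (Fin; toℕ; fromℕ<)
open import Data.Fin.Properties using (toℕ<n; toℕ-fromℕ<; toℕ-injective)
open import Data.List using (List; []; _∷_; _++_; _∷ʳ_; [_]; map; concat; filter; length; upTo; applyUpTo; tabulate)
open import Data.List.Membership.Propositional.Properties.WithK using (unique∧set⇒bag)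
open import Data.List.Properties using (map-cong; map-∘; map-++; map-tabulate; filter-++; length-++; upTo-∷ʳ)
open import Data.List.Relation.Binary.BagAndSetEquality using (∼bag⇒↭)
open import Data.List.Relation.Binary.Permutation.Propositional.Properties using () renaming (map⁺ to ↭-map⁺)
open import Data.Nat
open import Data.Nat.Divisibility using (_∤_; m∣m*n; m%n≡0⇒n∣m)
open import Data.Nat.DivMod
open import Data.Nat.ListAction using (sum)
open import Data.Nat.ListAction.Properties using (sum-++; sum-↭)
open import Data.Nat.Primality using (Prime)
open import Data.Nat.Properties
open import Data.Nat.Tactic.RingSolver using (solve-∀)
open import Data.Product using (Σ; _×_; _,_; proj₁; proj₂)
open import Data.Sum using (inj₁; inj₂)
open import Function using (_∘_; mk⇔)
open import Relation.Binary.Definitions using (tri<; tri≈; tri>)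
open import Relation.Binary.PropositionalEquality using (_≡_; _≢_; refl; sym; trans; cong; cong₂; subst; subst₂; module ≡-Reasoning)
open import Relation.Nullary using (¬_; Dec; yes; no; _×-dec_)


-- Sums over initial segments of ℕ and indicators

-- Every block of an `E2` or `E3` edge has `p ^ k * (p ∸ 1)` boxes. So the two inequalities in the
-- definition of a descent between such blocks are equivalent, and a descent is a single linear
-- inequality in the parameters `t` of the edges. A unit change of one parameter outweighs the whole
-- variation of the term that depends on `l`. Hence a sum over a parameter has only one undecided
-- index, and this index supplies the indicator of a threshold for `l`. The smaller `E1` block is
-- compared with no other block, since 2 is never a descent; therefore the first two floors of
-- vertices V are base cases of the recursion. The weights of the Horner sum are numbers of paths: a
-- contribution `E 0` enters with a power of `p` and passes through `T` once for every later floor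
-- of vertices V. After `k` passages it is constant, so from s = k + 2 on the dependence on `l` is
-- only rescaled by `p` from one such floor to the next. The closed forms contain negative
-- constants. Up to the passage to integers these stand on the other side of the equations, which
-- keeps the recursion in ℕ.

∑ : ℕ → (ℕ → ℕ) → ℕ
∑ zero    f = 0
∑ (suc n) f = ∑ n f + f n

∑-cong : ∀ n {f g} → (∀ i → i < n → f i ≡ g i) → ∑ n f ≡ ∑ n g
∑-cong zero    eq = refl
∑-cong (suc n) eq = cong₂ _+_ (∑-cong n λ i i<n → eq i (m<n⇒m<1+n i<n)) (eq n ≤-refl)

+-interchange : ∀ a b c d → a + b + (c + d) ≡ a + c + (b + d)
+-interchange = solve-∀

∑-+ : ∀ n f g → ∑ n (λ i → f i + g i) ≡ ∑ n f + ∑ n g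
∑-+ zero    f g = refl
∑-+ (suc n) f g = trans (cong (_+ (f n + g n)) (∑-+ n f g)) (+-interchange (∑ n f) (∑ n g) (f n) (g n))

∑-* : ∀ n c f → ∑ n (λ i → c * f i) ≡ c * ∑ n f
∑-* zero    c f = sym (*-zeroʳ c)
∑-* (suc n) c f = trans (cong (_+ c * f n) (∑-* n c f)) (sym (*-distribˡ-+ c (∑ n f) (f n)))

∑-const : ∀ n c → ∑ n (λ _ → c) ≡ n * c
∑-const zero    c = refl
∑-const (suc n) c = trans (cong (_+ c) (∑-const n c)) (+-comm (n * c) c)

∑-swap : ∀ m n (f : ℕ → ℕ → ℕ) → ∑ m (λ i → ∑ n (f i)) ≡ ∑ n (λ j → ∑ m (λ i → f i j))
∑-swap m zero    f = trans (∑-const m 0) (*-zeroʳ m)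
∑-swap m (suc n) f = trans (∑-+ m (λ i → ∑ n (f i)) (λ i → f i n))
  (cong (_+ ∑ m (λ i → f i n)) (∑-swap m n f))

∑-++ : ∀ m n f → ∑ (m + n) f ≡ ∑ m f + ∑ n (λ i → f (m + i))
∑-++ m zero    f = trans (cong (λ z → ∑ z f) (+-identityʳ m)) (sym (+-identityʳ _))
∑-++ m (suc n) f = begin
  ∑ (m + suc n) f                                ≡⟨ cong (λ z → ∑ z f) (+-suc m n) ⟩
  ∑ (m + n) f + f (m + n)                        ≡⟨ cong (_+ f (m + n)) (∑-++ m n f) ⟩
  ∑ m f + ∑ n (λ i → f (m + i)) + f (m + n)      ≡⟨ +-assoc (∑ m f) _ _ ⟩
  ∑ m f + ∑ (suc n) (λ i → f (m + i))            ∎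
  where open ≡-Reasoning

∑-id : ∀ n → 2 * ∑ (suc n) (λ i → i) ≡ n * suc n
∑-id zero    = refl
∑-id (suc n) = trans (*-distribˡ-+ 2 (∑ (suc n) (λ i → i)) (suc n))
  (trans (cong (_+ 2 * suc n) (∑-id n)) (rearrange n))
  where
  rearrange : ∀ n → n * suc n + 2 * suc n ≡ suc n * suc (suc n)
  rearrange = solve-∀

∑-initial : ∀ n c f → c ≤ n → (∀ i → i < c → f i ≡ 1) → (∀ i → c ≤ i → i < n → f i ≡ 0) → ∑ n f ≡ c
∑-initial n c f c≤n one nil = begin
  ∑ n f                                   ≡⟨ cong (λ z → ∑ z f) (sym (m+[n∸m]≡n c≤n)) ⟩
  ∑ (c + (n ∸ c)) f                       ≡⟨ ∑-++ c (n ∸ c) f ⟩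
  ∑ c f + ∑ (n ∸ c) (λ i → f (c + i))     ≡⟨ cong₂ _+_ (∑-cong c one) (∑-cong (n ∸ c) below) ⟩
  ∑ c (λ _ → 1) + ∑ (n ∸ c) (λ _ → 0)     ≡⟨ cong₂ _+_ (∑-const c 1) (∑-const (n ∸ c) 0) ⟩
  c * 1 + (n ∸ c) * 0                     ≡⟨ cong₂ _+_ (*-identityʳ c) (*-zeroʳ (n ∸ c)) ⟩
  c + 0                                   ≡⟨ +-identityʳ c ⟩
  c                                       ∎
  where
  open ≡-Reasoning
  below : ∀ i → i < n ∸ c → f (c + i) ≡ 0
  below i i<n∸c = nil (c + i) (m≤m+n c i) (<-≤-trans (+-monoʳ-< c i<n∸c) (≤-reflexive (m+[n∸m]≡n c≤n)))

-- Made for sums of indicators that switch at `c`: the value at `c` itself is left open, because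
-- only this term depends on `l` in the counts below.
∑-below : ∀ n c f → c < n → (∀ i → i < c → f i ≡ 1) → (∀ i → c < i → i < n → f i ≡ 0) → ∑ n f ≡ c + f c
∑-below n c f c<n one nil = begin
  ∑ n f                                            ≡⟨ cong (λ z → ∑ z f) (sym (m+[n∸m]≡n c<n)) ⟩
  ∑ (suc c + (n ∸ suc c)) f                        ≡⟨ ∑-++ (suc c) (n ∸ suc c) f ⟩
  ∑ c f + f c + ∑ (n ∸ suc c) (λ i → f (suc c + i)) ≡⟨ cong₂ _+_ (cong (_+ f c) (∑-initial c c f ≤-refl one
                                                          λ i c≤i i<c → ⊥-elim (<⇒≱ i<c c≤i)))
                                                        (trans (∑-cong (n ∸ suc c) above) (trans (∑-const (n ∸ suc c) 0) (*-zeroʳ (n ∸ suc c)))) ⟩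
  c + f c + 0                                      ≡⟨ +-identityʳ _ ⟩
  c + f c                                          ∎
  where
  open ≡-Reasoning
  above : ∀ i → i < n ∸ suc c → f (suc c + i) ≡ 0
  above i i< = nil (suc c + i) (m≤m+n (suc c) i) (<-≤-trans (+-monoʳ-< (suc c) i<) (≤-reflexive (m+[n∸m]≡n c<n)))

-- The mirror image of `∑-below`. The summand `suc c` counts the indices up to `c` and avoids a
-- truncated subtraction on the right.
∑-above : ∀ n c f → c < n → (∀ i → i < c → f i ≡ 0) → (∀ i → c < i → i < n → f i ≡ 1) →
          suc c + ∑ n f ≡ n + f c
∑-above n c f c<n nil one = begin
  suc c + ∑ n f                                              ≡⟨ cong (λ z → suc c + ∑ z f) (sym (m+[n∸m]≡n c<n)) ⟩
  suc c + ∑ (suc c + (n ∸ suc c)) f                          ≡⟨ cong (suc c +_) (∑-++ (suc c) (n ∸ suc c) f) ⟩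
  suc c + (∑ c f + f c + ∑ (n ∸ suc c) (λ i → f (suc c + i)))
    ≡⟨ cong (suc c +_) (cong₂ _+_ (cong (_+ f c) (trans (∑-cong c nil) (trans (∑-const c 0) (*-zeroʳ c))))
                                  (trans (∑-cong (n ∸ suc c) above) (trans (∑-const (n ∸ suc c) 1) (*-identityʳ _)))) ⟩
  suc c + (f c + (n ∸ suc c))                                ≡⟨ cong (suc c +_) (+-comm (f c) _) ⟩
  suc c + ((n ∸ suc c) + f c)                                ≡⟨ sym (+-assoc (suc c) (n ∸ suc c) (f c)) ⟩
  suc c + (n ∸ suc c) + f c                                  ≡⟨ cong (_+ f c) (m+[n∸m]≡n c<n) ⟩
  n + f c                                                    ∎
  where
  open ≡-Reasoning
  above : ∀ i → i < n ∸ suc c → f (suc c + i) ≡ 1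
  above i i< = one (suc c + i) (m≤m+n (suc c) i) (<-≤-trans (+-monoʳ-< (suc c) i<) (≤-reflexive (m+[n∸m]≡n c<n)))

ind : {P : Set} → Dec P → ℕ
ind (yes _) = 1
ind (no _)  = 0

ind-cong : {P Q : Set} {P? : Dec P} {Q? : Dec Q} → (P → Q) → (Q → P) → ind P? ≡ ind Q?
ind-cong {P? = yes p} {yes q} to from = refl
ind-cong {P? = yes p} {no ¬q} to from = ⊥-elim (¬q (to p))
ind-cong {P? = no ¬p} {yes q} to from = ⊥-elim (¬p (from q))
ind-cong {P? = no ¬p} {no ¬q} to from = refl

ind-true : {P : Set} {P? : Dec P} → P → ind P? ≡ 1
ind-true {P? = yes _} p = refl
ind-true {P? = no ¬p} p = ⊥-elim (¬p p)

ind-false : {P : Set} {P? : Dec P} → ¬ P → ind P? ≡ 0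
ind-false {P? = yes p} ¬p = ⊥-elim (¬p p)
ind-false {P? = no _}  ¬p = refl

length-filter-upTo : ∀ {P : ℕ → Set} (P? : ∀ j → Dec (P j)) n →
                     length (filter P? (upTo n)) ≡ ∑ n (λ j → ind (P? j))
length-filter-upTo P? zero    = refl
length-filter-upTo P? (suc n) = begin
  length (filter P? (upTo (suc n)))                          ≡⟨ cong (length ∘ filter P?) (sym (upTo-∷ʳ n)) ⟩
  length (filter P? (upTo n ++ [ n ]))                       ≡⟨ cong length (filter-++ P? (upTo n) [ n ]) ⟩
  length (filter P? (upTo n) ++ filter P? [ n ])             ≡⟨ length-++ (filter P? (upTo n)) ⟩
  length (filter P? (upTo n)) + length (filter P? [ n ])     ≡⟨ cong₂ _+_ (length-filter-upTo P? n) last ⟩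
  ∑ n (λ j → ind (P? j)) + ind (P? n)                        ∎
  where
  open ≡-Reasoning
  last : length (filter P? [ n ]) ≡ ind (P? n)
  last with P? n
  ... | yes _ = refl
  ... | no  _ = refl

-- Sums over enumerations

-- Two complete listings without repetition are permutations of each other. Hence the nested
-- enumerations of paths may be replaced by any convenient parametrisation.
sumOver-unique : {A : Set} (E F : Enumeration A) (f : A → ℕ) → sumOver E f ≡ sumOver F f
sumOver-unique E F f = sum-↭ (↭-map⁺ f (∼bag⇒↭ (unique∧set⇒bag (unique E) (unique F)
  (mk⇔ (λ _ → complete F _) (λ _ → complete E _)))))

sumOver-cong : {A : Set} (E : Enumeration A) {f g : A → ℕ} → (∀ a → f a ≡ g a) → sumOver E f ≡ sumOver E g
sumOver-cong E eq = cong sum (map-cong eq (elements E))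

sumOver-+ : {A : Set} (E : Enumeration A) (f g : A → ℕ) →
            sumOver E (λ a → f a + g a) ≡ sumOver E f + sumOver E g
sumOver-+ E f g = go (elements E)
  where
  go : ∀ xs → sum (map (λ a → f a + g a) xs) ≡ sum (map f xs) + sum (map g xs)
  go []       = refl
  go (x ∷ xs) = trans (cong (f x + g x +_) (go xs)) (+-interchange (f x) (g x) _ _)

sumOver-map : {A B : Set} (g : A → B) (E : Enumeration A) (f : B → ℕ) →
              sum (map f (map g (elements E))) ≡ sumOver E (f ∘ g)
sumOver-map g E f = cong sum (sym (map-∘ (elements E)))

sumOver-Σ : {A : Set} {B : A → Set} (E : Enumeration A) (F : ∀ a → Enumeration (B a)) (f : Σ A B → ℕ) →
            sumOver (enumΣ E F) f ≡ sumOver E (λ a → sumOver (F a) (λ b → f (a , b)))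
sumOver-Σ E F f = go (elements E)
  where
  fibre = λ a → map (a ,_) (elements (F a))
  go : ∀ xs → sum (map f (concat (map fibre xs))) ≡ sum (map (λ a → sumOver (F a) (λ b → f (a , b))) xs)
  go []       = refl
  go (a ∷ xs) = begin
    sum (map f (fibre a ++ concat (map fibre xs)))                 ≡⟨ cong sum (map-++ f (fibre a) _) ⟩
    sum (map f (fibre a) ++ map f (concat (map fibre xs)))         ≡⟨ sum-++ (map f (fibre a)) _ ⟩
    sum (map f (fibre a)) + sum (map f (concat (map fibre xs)))    ≡⟨ cong₂ _+_ (cong sum (sym (map-∘ (elements (F a))))) (go xs) ⟩
    sumOver (F a) (λ b → f (a , b)) + sum (map (λ a → sumOver (F a) (λ b → f (a , b))) xs) ∎
    where open ≡-Reasoning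

sumOver-singleton : {A : Set} (E : Enumeration A) (a : A) → (∀ b → b ≡ a) → (f : A → ℕ) → sumOver E f ≡ f a
sumOver-singleton E a all f = trans (sumOver-unique E (enumSingleton a all) f) (+-identityʳ (f a))

sumOver-reindex : {A B : Set} (E : Enumeration B) (F : Enumeration A) (g : A → B) →
                  (∀ {x y} → g x ≡ g y → x ≡ y) → (∀ b → Σ A λ a → g a ≡ b) → (f : B → ℕ) →
                  sumOver E f ≡ sumOver F (f ∘ g)
sumOver-reindex E F g inj surj f =
  trans (sumOver-unique E (enumImage g inj surj F) f) (sumOver-map g F f)

∑-suc : ∀ n f → ∑ (suc n) f ≡ f 0 + ∑ n (f ∘ suc)
∑-suc n f = ∑-++ 1 n f

sumOver-Fin : ∀ n (g : Fin n → ℕ) (f : ℕ → ℕ) → (∀ i → g i ≡ f (toℕ i)) → sumOver (enumFin n) g ≡ ∑ n f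
sumOver-Fin n g f eq = trans (cong sum (map-tabulate (λ i → i) g)) (go n g f eq)
  where
  go : ∀ n (g : Fin n → ℕ) (f : ℕ → ℕ) → (∀ i → g i ≡ f (toℕ i)) → sum (tabulate g) ≡ ∑ n f
  go zero    g f eq = refl
  go (suc n) g f eq = trans (cong₂ _+_ (eq Fin.zero) (go n (g ∘ Fin.suc) (f ∘ suc) (eq ∘ Fin.suc))) (sym (∑-suc n f))

-- Division with remainder

*+-/ : ∀ d a b .{{_ : NonZero d}} → b < d → (d * a + b) / d ≡ a
*+-/ d a b b<d = begin
  (d * a + b) / d       ≡⟨ +-distrib-/-∣ˡ {d * a} b (m∣m*n a) ⟩
  d * a / d + b / d     ≡⟨ cong₂ _+_ (trans (cong (_/ d) (*-comm d a)) (m*n/n≡m a d)) (m<n⇒m/n≡0 b<d) ⟩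
  a + 0                 ≡⟨ +-identityʳ a ⟩
  a                     ∎
  where open ≡-Reasoning

*+-< : ∀ {d c a b} → a < c → b < d → d * a + b < c * d
*+-< {d} {c} {a} {b} a<c b<d = <-≤-trans (+-monoʳ-< (d * a) b<d)
  (≤-trans (≤-reflexive (trans (+-comm (d * a) d) (trans (sym (*-suc d a)) (*-comm d (suc a)))))
           (*-monoˡ-≤ d a<c))

divMod-≡ : ∀ m d .{{_ : NonZero d}} → m ≡ d * (m / d) + m % d
divMod-≡ m d = trans (m≡m%n+[m/n]*n m d) (trans (+-comm (m % d) _) (cong (_+ m % d) (*-comm (m / d) d)))

-- Descents created by appending one edge to a path

Descends : Block → Block → Set
Descends b b′ = horizontal b > horizontal b′ × vertical b < vertical b′

descends? : ∀ b b′ → Dec (Descends b b′)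
descends? b b′ = (horizontal b′ <? horizontal b) ×-dec (vertical b <? vertical b′)

nthBlock-∷ʳ : ∀ bs b i → i < length bs → nthBlock (bs ∷ʳ b) i ≡ nthBlock bs i
nthBlock-∷ʳ (_ ∷ bs) b zero    _         = refl
nthBlock-∷ʳ (_ ∷ bs) b (suc i) (s≤s i<n) = nthBlock-∷ʳ bs b i i<n

nthBlock-last : ∀ bs b → nthBlock (bs ∷ʳ b) (length bs) ≡ b
nthBlock-last []       b = refl
nthBlock-last (_ ∷ bs) b = nthBlock-last bs b

length-∷ʳ : {A : Set} (xs : List A) (x : A) → length (xs ∷ʳ x) ≡ suc (length xs)
length-∷ʳ xs x = trans (length-++ xs) (+-comm (length xs) 1)

module Paths (p k′ : ℕ) (p-prime : Prime p) (p-odd : 2 ∤ p) where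

  k q′ q : ℕ
  k  = suc k′
  q′ = p ^ k′
  q  = p ^ k

  open Column p k p-prime p-odd public hiding (m; n; x)

  -- The value at `start` is a dummy: `des-▷-long` demands at least two blocks.
  lastBlock : ∀ {v} → Path v → Block
  lastBlock (start _) = B 0 0
  lastBlock (_ ▷ e)   = block e

  -- For `j` below the old last index the condition reads no block beyond the old last one, and
  -- appending leaves these blocks in place. So the only new candidate for a descent is the old last
  -- index.
  isDescent-▷ : ∀ {u v} (P : Path u) (e : Edge u v) j → j < lastIndex P →
                ind (isDescent? (P ▷ e) j) ≡ ind (isDescent? P j)
  isDescent-▷ P e 0 _ = refl
  isDescent-▷ P e 1 (s≤s 1≤n) rewrite nthBlock-∷ʳ (blocks P) (block e) 0 1≤n = refl
  isDescent-▷ P e 2 _ = refl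
  isDescent-▷ P e (suc (suc (suc i))) (s≤s i<n)
    rewrite nthBlock-∷ʳ (blocks P) (block e) (suc i) (<⇒≤ i<n)
          | nthBlock-∷ʳ (blocks P) (block e) (suc (suc i)) i<n = refl

  des-∑ : ∀ {v} (P : Path v) → des P ≡ ∑ (lastIndex P) (λ j → ind (isDescent? P j))
  des-∑ P = length-filter-upTo (isDescent? P) (lastIndex P)

  des-▷ : ∀ {u v} (P : Path u) (e : Edge u v) →
          des (P ▷ e) ≡ des P + ind (isDescent? (P ▷ e) (lastIndex P))
  des-▷ P e = begin
    des (P ▷ e)                                                      ≡⟨ des-∑ (P ▷ e) ⟩
    ∑ (lastIndex (P ▷ e)) (λ j → ind (isDescent? (P ▷ e) j))
      ≡⟨ cong (λ n → ∑ (suc n) (λ j → ind (isDescent? (P ▷ e) j))) (length-∷ʳ (blocks P) (block e)) ⟩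
    ∑ (lastIndex P) (λ j → ind (isDescent? (P ▷ e) j)) + new
      ≡⟨ cong (_+ new) (∑-cong (lastIndex P) (isDescent-▷ P e)) ⟩
    ∑ (lastIndex P) (λ j → ind (isDescent? P j)) + new               ≡⟨ cong (_+ new) (sym (des-∑ P)) ⟩
    des P + new                                                      ∎
    where
    open ≡-Reasoning
    new = ind (isDescent? (P ▷ e) (lastIndex P))

  isDescent?-suc : ∀ {v} (P : Path v) j → 3 ≤ j →
    ind (isDescent? P j) ≡ ind (descends? (nthBlock (blocks P) (j ∸ 2)) (nthBlock (blocks P) (suc j ∸ 2)))
  isDescent?-suc P (suc zero)          (s≤s ())
  isDescent?-suc P (suc (suc zero))    (s≤s (s≤s ()))
  isDescent?-suc P (suc (suc (suc _))) _ = refl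

  des-▷-long : ∀ {u v} (P : Path u) (e : Edge u v) → 3 ≤ lastIndex P →
               des (P ▷ e) ≡ des P + ind (descends? (lastBlock P) (block e))
  des-▷-long (start _) e (s≤s ())
  des-▷-long P@(P′ ▷ e′) e 3≤ = trans (des-▷ P e) (cong (des P +_)
    (trans (isDescent?-suc (P ▷ e) (lastIndex P) 3≤) (cong₂ (λ b b′ → ind (descends? b b′)) second-last last)))
    where
    len : length (blocks P) ≡ suc (length (blocks P′))
    len = length-∷ʳ (blocks P′) (block e′)
    last : nthBlock (blocks P ∷ʳ block e) (length (blocks P)) ≡ block e
    last = nthBlock-last (blocks P) (block e)
    second-last : nthBlock (blocks P ∷ʳ block e) (length (blocks P) ∸ 1) ≡ block e′
    second-last = trans (cong (λ n → nthBlock (blocks P ∷ʳ block e) (n ∸ 1)) len)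
      (trans (nthBlock-∷ʳ (blocks P) (block e) (length (blocks P′)) (≤-reflexive (sym len)))
             (nthBlock-last (blocks P′) (block e′)))

  lastIndex-V : ∀ {s} .{1≤s : 1 ≤ s} {l} (P : Path (V s 1≤s l)) → lastIndex P ≡ 2 * s
  lastIndex-V {s} P = +-cancelˡ-≡ (2 * k) _ _ (trans (lastIndex-floor P) (*-distribˡ-+ 2 k s))

  lastIndex-▷ : ∀ {u v} (P : Path u) (e : Edge u v) → lastIndex (P ▷ e) ≡ suc (lastIndex P)
  lastIndex-▷ P e = cong suc (length-∷ʳ (blocks P) (block e))

  -- The only new candidate is the index 2, which is excluded by definition.
  des-▷-first : ∀ {l l′} (P : Path (V 1 (s≤s z≤n) l)) (e : Edge (V 1 (s≤s z≤n) l) (W 2 (s≤s (s≤s z≤n)) l′)) →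
                des (P ▷ e) ≡ des P
  des-▷-first P e = trans (des-▷ P e)
    (trans (cong (λ j → des P + ind (isDescent? (P ▷ e) j)) (lastIndex-V P)) (+-identityʳ (des P)))

  des-start : ∀ {i l} (t : Fin (p ∸ 1)) (eq : toℕ i ≡ q * toℕ t + toℕ l) →
              des (start i ▷ E1 {l = l} t eq) ≡ ind (toℕ t <? (p ∸ 1) / 2)
  des-start {i} t eq = trans (des-▷ (start i) (E1 t eq)) (ind-cong
    (λ (t′ , t′< , eq′) → subst (_< (p ∸ 1) / 2) (sym (*-cancelˡ-≡ (toℕ t) t′ q eq′)) t′<)
    (λ t< → toℕ t , t< , refl))

  -- Sums over the paths to a vertex, by the last edges

  -- A vertex W has one incoming edge: the equation for `l′` is division by `p` with quotient `l`
  -- and remainder `β`.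
  W-step : ∀ s .{1≤s : 1 ≤ s} {l l′} (β : Fin p) (eq : toℕ l′ ≡ p * toℕ l + toℕ β) (f : Path (W (suc s) (s≤s 1≤s) l′) → ℕ) →
           sumOver (𝒫W (suc s) (s≤s 1≤s) l′) f ≡ sumOver (𝒫V s 1≤s l) (λ P → f (P ▷ E2 β eq))
  W-step s {1≤s} {l} {l′} β eq f = begin
    sumOver (𝒫W (suc s) (s≤s 1≤s) l′) f
      ≡⟨ sumOver-map (step₂ {1≤s = 1≤s}) (enumΣ (enumFin q) overβ) f ⟩
    sumOver (enumΣ (enumFin q) overβ) (f ∘ step₂)
      ≡⟨ sumOver-Σ (enumFin q) overβ (f ∘ step₂) ⟩
    sumOver (enumFin q) (λ l → sumOver (overβ l) (λ b → f (step₂ (l , b))))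
      ≡⟨ sumOver-cong (enumFin q) (λ l → trans (sumOver-Σ (enumFin p) (over≡ l) (λ b → f (step₂ (l , b))))
           (sumOver-cong (enumFin p) λ β → sumOver-Σ (dec l β) (λ _ → 𝒫V s 1≤s l) (λ b → f (step₂ (l , β , b))))) ⟩
    sumOver (enumFin q) (λ l → sumOver (enumFin p) λ β → sumOver (dec l β) λ eq → G (l , β , eq))
      -- From here on the sum over paths is hidden in `G`, and the data of the edge are regrouped
      -- into the one-element type `Index`.
      ≡⟨ sumOver-cong (enumFin q) (λ l → sym (sumOver-Σ (enumFin p) (dec l) (λ b → G (l , b)))) ⟩
    sumOver (enumFin q) (λ l → sumOver (enumΣ (enumFin p) (dec l)) λ b → G (l , b))
      ≡⟨ sym (sumOver-Σ (enumFin q) (λ l → enumΣ (enumFin p) (dec l)) G) ⟩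
    sumOver (enumΣ (enumFin q) (λ l → enumΣ (enumFin p) (dec l))) G
      ≡⟨ sumOver-singleton (enumΣ (enumFin q) (λ l → enumΣ (enumFin p) (dec l))) (l , β , eq) only G ⟩
    G (l , β , eq) ∎
    where
    open ≡-Reasoning
    dec : ∀ (l : Fin q) (β : Fin p) → Enumeration (toℕ l′ ≡ p * toℕ l + toℕ β)
    dec l β = enumDec (toℕ l′ ≟ p * toℕ l + toℕ β) ≡-irrelevant
    over≡ : ∀ (l : Fin q) (β : Fin p) → Enumeration (Σ (toℕ l′ ≡ p * toℕ l + toℕ β) λ _ → Path (V s 1≤s l))
    over≡ l β = enumΣ (dec l β) λ _ → 𝒫V s 1≤s l
    overβ : ∀ l → Enumeration (Σ (Fin p) λ β → Σ (toℕ l′ ≡ p * toℕ l + toℕ β) λ _ → Path (V s 1≤s l))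
    overβ l = enumΣ (enumFin p) (over≡ l)
    Index = Σ (Fin q) λ l → Σ (Fin p) λ β → toℕ l′ ≡ p * toℕ l + toℕ β
    G : Index → ℕ
    G (l , β , eq) = sumOver (𝒫V s 1≤s l) (λ P → f (P ▷ E2 β eq))
    same : ∀ {l₁ l₂ : Fin q} {β₁ β₂ : Fin p} {e₁ : toℕ l′ ≡ p * toℕ l₁ + toℕ β₁} {e₂ : toℕ l′ ≡ p * toℕ l₂ + toℕ β₂} →
           l₁ ≡ l₂ → β₁ ≡ β₂ → _≡_ {A = Index} (l₁ , β₁ , e₁) (l₂ , β₂ , e₂)
    same {e₁ = e₁} {e₂} refl refl with refl ← ≡-irrelevant e₁ e₂ = refl
    only : ∀ (b : Index) → b ≡ (l , β , eq)
    only (l₁ , β₁ , eq₁) = same (toℕ-injective l≡) (toℕ-injective (+-cancelˡ-≡ (p * toℕ l₁) _ _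
      (trans (sym eq₁) (trans eq (cong (λ z → p * z + toℕ β) (sym l≡))))))
      where
      l≡ : toℕ l₁ ≡ toℕ l
      l≡ = trans (sym (*+-/ p (toℕ l₁) (toℕ β₁) (toℕ<n β₁)))
             (trans (cong (_/ p) (trans (sym eq₁) eq)) (*+-/ p (toℕ l) (toℕ β) (toℕ<n β)))

  -- The t-th way back from V_{s+1,l} to floor V_s: through W_{s+1,mid l t} to V_{s,below l t}.
  mid : Fin q → Fin p → Fin (p ^ suc k)
  mid l t = fromℕ< {q * toℕ t + toℕ l} (*+-< {q} {p} (toℕ<n t) (toℕ<n l))

  toℕ-mid : ∀ l t → toℕ (mid l t) ≡ q * toℕ t + toℕ l
  toℕ-mid l t = toℕ-fromℕ< _

  l/p< : ∀ (l : Fin q) → toℕ l / p < q′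
  l/p< l = m<n*o⇒m/o<n (<-≤-trans (toℕ<n l) (≤-reflexive (*-comm p q′)))

  below : Fin q → Fin p → Fin q
  below l t = fromℕ< {q′ * toℕ t + toℕ l / p} (*+-< {q′} {p} (toℕ<n t) (l/p< l))

  toℕ-below : ∀ l t → toℕ (below l t) ≡ q′ * toℕ t + toℕ l / p
  toℕ-below l t = toℕ-fromℕ< _

  digit : Fin q → Fin p
  digit l = fromℕ< (m%n<n (toℕ l) p)

  toℕ-digit : ∀ l → toℕ (digit l) ≡ toℕ l % p
  toℕ-digit l = toℕ-fromℕ< _

  -- Since `q` is `p * q′`, adding `q * t` to `l` leaves its last digit in base `p` alone and adds
  -- `q′ * t` to the quotient. So the digit of the `E2` edge is the same for all `t`.
  mid-below : ∀ l t → toℕ (mid l t) ≡ p * toℕ (below l t) + toℕ (digit l)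
  mid-below l t = begin
    toℕ (mid l t)                                            ≡⟨ toℕ-mid l t ⟩
    p * q′ * toℕ t + toℕ l                                   ≡⟨ cong (p * q′ * toℕ t +_) (divMod-≡ (toℕ l) p) ⟩
    p * q′ * toℕ t + (p * (toℕ l / p) + toℕ l % p)           ≡⟨ rearrange p q′ (toℕ t) (toℕ l / p) (toℕ l % p) ⟩
    p * (q′ * toℕ t + toℕ l / p) + toℕ l % p                 ≡⟨ cong₂ (λ a b → p * a + b) (sym (toℕ-below l t)) (sym (toℕ-digit l)) ⟩
    p * toℕ (below l t) + toℕ (digit l)                      ∎
    where
    open ≡-Reasoning
    rearrange : ∀ p q t y b → p * q * t + (p * y + b) ≡ p * (q * t + y) + b
    rearrange = solve-∀

  mid-/ : ∀ l t → toℕ (mid l t) / q ≡ toℕ t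
  mid-/ l t = trans (cong (_/ q) (toℕ-mid l t)) (*+-/ q (toℕ t) (toℕ l) (toℕ<n l))

  mid-∸ : ∀ l t → toℕ l ≡ toℕ (mid l t) ∸ q * (toℕ (mid l t) / q)
  mid-∸ l t = sym (trans (cong₂ (λ a b → a ∸ q * b) (toℕ-mid l t) (mid-/ l t)) (m+n∸m≡n (q * toℕ t) (toℕ l)))

  -- An `E3` edge into `l` fixes the residue of `l′` modulo `q`, so the quotient `t` parametrises
  -- these edges; each source W is then resolved by `W-step`.
  V-step : ∀ s (l : Fin q) (f : Path (V (suc (suc s)) (s≤s z≤n) l) → ℕ) →
           sumOver (𝒫V (suc (suc s)) (s≤s z≤n) l) f ≡
           sumOver (enumFin p) (λ t → sumOver (𝒫V (suc s) (s≤s z≤n) (below l t))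
             (λ P → f (P ▷ E2 (digit l) (mid-below l t) ▷ E3 (mid-∸ l t))))
  V-step s l f = begin
    sumOver (𝒫V (suc (suc s)) (s≤s z≤n) l) f
      ≡⟨ sumOver-map (step₃ {2≤s = s≤s (s≤s z≤n)}) (enumΣ (enumFin (p ^ suc k)) over≡) f ⟩
    sumOver (enumΣ (enumFin (p ^ suc k)) over≡) (f ∘ step₃)
      ≡⟨ sumOver-Σ (enumFin (p ^ suc k)) over≡ (f ∘ step₃) ⟩
    sumOver (enumFin (p ^ suc k)) (λ l′ → sumOver (over≡ l′) (λ b → f (step₃ (l′ , b))))
      ≡⟨ sumOver-cong (enumFin (p ^ suc k)) (λ l′ → sumOver-Σ (dec l′) (λ _ → 𝒫W (suc (suc s)) (s≤s (s≤s z≤n)) l′) (λ b → f (step₃ (l′ , b)))) ⟩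
    sumOver (enumFin (p ^ suc k)) (λ l′ → sumOver (dec l′) λ eq → G (l′ , eq))
      ≡⟨ sym (sumOver-Σ (enumFin (p ^ suc k)) dec G) ⟩
    sumOver (enumΣ (enumFin (p ^ suc k)) dec) G
      ≡⟨ sumOver-reindex (enumΣ (enumFin (p ^ suc k)) dec) (enumFin p) (λ t → mid l t , mid-∸ l t) inj surj G ⟩
    sumOver (enumFin p) (λ t → G (mid l t , mid-∸ l t))
      ≡⟨ sumOver-cong (enumFin p) (λ t → W-step (suc s) (digit l) (mid-below l t) (λ P → f (P ▷ E3 (mid-∸ l t)))) ⟩
    sumOver (enumFin p) (λ t → sumOver (𝒫V (suc s) (s≤s z≤n) (below l t))
      (λ P → f (P ▷ E2 (digit l) (mid-below l t) ▷ E3 (mid-∸ l t)))) ∎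
    where
    open ≡-Reasoning
    Index = Σ (Fin (p ^ suc k)) λ l′ → toℕ l ≡ toℕ l′ ∸ q * (toℕ l′ / q)
    dec : (l′ : Fin (p ^ suc k)) → Enumeration (toℕ l ≡ toℕ l′ ∸ q * (toℕ l′ / q))
    dec l′ = enumDec (toℕ l ≟ toℕ l′ ∸ q * (toℕ l′ / q)) ≡-irrelevant
    over≡ : ∀ l′ → Enumeration (Σ (toℕ l ≡ toℕ l′ ∸ q * (toℕ l′ / q)) λ _ → Path (W (suc (suc s)) (s≤s (s≤s z≤n)) l′))
    over≡ l′ = enumΣ (dec l′) λ _ → 𝒫W (suc (suc s)) (s≤s (s≤s z≤n)) l′
    G : Index → ℕ
    G (l′ , eq) = sumOver (𝒫W (suc (suc s)) (s≤s (s≤s z≤n)) l′) (λ P → f (P ▷ E3 eq))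
    inj : ∀ {t t′} → _≡_ {A = Index} (mid l t , mid-∸ l t) (mid l t′ , mid-∸ l t′) → t ≡ t′
    inj {t} {t′} eq = toℕ-injective (trans (sym (mid-/ l t))
      (trans (cong (λ i → toℕ (proj₁ i) / q) eq) (mid-/ l t′)))
    same : ∀ {l₁ l₂ : Fin (p ^ suc k)} {e₁ : toℕ l ≡ toℕ l₁ ∸ q * (toℕ l₁ / q)} {e₂ : toℕ l ≡ toℕ l₂ ∸ q * (toℕ l₂ / q)} →
           l₁ ≡ l₂ → _≡_ {A = Index} (l₁ , e₁) (l₂ , e₂)
    same {e₁ = e₁} {e₂} refl with refl ← ≡-irrelevant e₁ e₂ = refl
    surj : ∀ (b : Index) → Σ (Fin p) λ t → (mid l t , mid-∸ l t) ≡ b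
    surj (l′ , eq) = t , same (toℕ-injective (trans (toℕ-mid l t)
      (trans (cong₂ (λ a b → q * a + b) (toℕ-fromℕ< _) eq)
             (m+[n∸m]≡n (≤-trans (≤-reflexive (*-comm q _)) (m/n*n≤m (toℕ l′) q))))))
      where
      t : Fin p
      t = fromℕ< (m<n*o⇒m/o<n {n = p} {o = q} (toℕ<n l′))

  source : Fin q → Fin (p ∸ 1) → Fin (q * (p ∸ 1))
  source l t = fromℕ< {q * toℕ t + toℕ l} (<-≤-trans (*+-< {q} {p ∸ 1} (toℕ<n t) (toℕ<n l)) (≤-reflexive (*-comm (p ∸ 1) q)))

  toℕ-source : ∀ l t → toℕ (source l t) ≡ q * toℕ t + toℕ l
  toℕ-source l t = toℕ-fromℕ< _

  V₁-step : ∀ (l : Fin q) (f : Path (V 1 (s≤s z≤n) l) → ℕ) →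
            sumOver (𝒫V 1 (s≤s z≤n) l) f ≡
            sumOver (enumFin (p ∸ 1)) (λ t → f (start (source l t) ▷ E1 t (toℕ-source l t)))
  V₁-step l f = trans (sumOver-map step₁ E f)
    (sumOver-reindex E (enumFin (p ∸ 1)) (λ t → source l t , t , toℕ-source l t)
      (cong (λ i → proj₁ (proj₂ i)))
      (λ (i , t , eq) → t , same (toℕ-injective (trans (toℕ-source l t) (sym eq))))
      (f ∘ step₁))
    where
    Index = Σ (Fin (q * (p ∸ 1))) λ i → Σ (Fin (p ∸ 1)) λ t → toℕ i ≡ q * toℕ t + toℕ l
    E : Enumeration Index
    E = enumΣ (enumFin (q * (p ∸ 1))) λ i → enumΣ (enumFin (p ∸ 1)) λ t →
      enumDec (toℕ i ≟ q * toℕ t + toℕ l) ≡-irrelevant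
    same : ∀ {i₁ i₂ : Fin (q * (p ∸ 1))} {t : Fin (p ∸ 1)} {e₁ : toℕ i₁ ≡ q * toℕ t + toℕ l} {e₂ : toℕ i₂ ≡ q * toℕ t + toℕ l} →
           i₁ ≡ i₂ → _≡_ {A = Index} (i₁ , t , e₁) (i₂ , t , e₂)
    same {e₁ = e₁} {e₂} refl with refl ← ≡-irrelevant e₁ e₂ = refl

-- Comparisons of blocks

-- Both blocks have `q * r` boxes, so having more horizontal nodes is the same as having fewer
-- vertical ones. Moving the subtracted terms across gives one inequality for the pair.
descends-E2-E3 : ∀ q r N t → N ≤ q * r → t ≤ r →
  ind (descends? (B (q * r ∸ N) N) (B (q * t) (q * (r ∸ t)))) ≡ ind (N + q * t <? q * r)
descends-E2-E3 q r N t N≤ t≤ = ind-cong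
  (λ (_ , N<) → m≤o∸n⇒m+n≤o (suc N) (*-monoʳ-≤ q t≤) (subst (N <_) (*-distribˡ-∸ q r t) N<))
  (λ lt → m+n≤o⇒m≤o∸n (suc (q * t)) (≤-trans (≤-reflexive (cong suc (+-comm (q * t) N))) lt)
        , subst (N <_) (sym (*-distribˡ-∸ q r t)) (m+n≤o⇒m≤o∸n (suc N) lt))

descends-E3-E2 : ∀ q r N t → N ≤ q * r → t ≤ r →
  ind (descends? (B (q * t) (q * (r ∸ t))) (B (q * r ∸ N) N)) ≡ ind (q * r <? N + q * t)
descends-E3-E2 q r N t N≤ t≤ = ind-cong
  (λ (_ , <N) → subst (_< N + q * t) back (+-monoˡ-< (q * t) <N))
  (λ lt → +-cancelʳ-< N _ _ (subst₂ _<_ (sym (m∸n+n≡m N≤)) (+-comm N (q * t)) lt)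
        , +-cancelʳ-< (q * t) _ _ (subst (_< N + q * t) (sym back) lt))
  where
  back : q * (r ∸ t) + q * t ≡ q * r
  back = trans (sym (*-distribˡ-+ q (r ∸ t) t)) (cong (q *_) (m∸n+n≡m t≤))

-- In the following, p = 2h + 1, q stands for p^(k-1) and u for l - ⌊l/p⌋.

down-true : ∀ {p} h q t u → p ≡ suc (2 * h) → 0 < q → u ≤ 2 * h * q → t < h →
            2 * h * (q * t) + u + p * q * t < p * q * (2 * h)
down-true h q t u refl 0<q u≤ t<h = begin-strict
  2 * h * (q * t) + u + suc (2 * h) * q * t           ≤⟨ +-monoˡ-≤ _ (+-monoʳ-≤ (2 * h * (q * t)) u≤) ⟩
  2 * h * (q * t) + 2 * h * q + suc (2 * h) * q * t   ≡⟨ e₁ h q t ⟩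
  (4 * h + 1) * q * t + 2 * h * q + 0                 <⟨ +-monoʳ-< ((4 * h + 1) * q * t + 2 * h * q) (<-≤-trans 0<q (m≤m+n q (3 * h * q))) ⟩
  (4 * h + 1) * q * t + 2 * h * q + (q + 3 * h * q)   ≡⟨ e₂ h q t ⟩
  (4 * h + 1) * q * suc t + h * q                     ≤⟨ +-monoˡ-≤ (h * q) (*-monoʳ-≤ ((4 * h + 1) * q) t<h) ⟩
  (4 * h + 1) * q * h + h * q                         ≡⟨ e₃ h q ⟩
  suc (2 * h) * q * (2 * h)                           ∎
  where
  open ≤-Reasoning
  e₁ : ∀ h q t → 2 * h * (q * t) + 2 * h * q + suc (2 * h) * q * t ≡ (4 * h + 1) * q * t + 2 * h * q + 0
  e₁ = solve-∀
  e₂ : ∀ h q t → (4 * h + 1) * q * t + 2 * h * q + (q + 3 * h * q) ≡ (4 * h + 1) * q * suc t + h * q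
  e₂ = solve-∀
  e₃ : ∀ h q → (4 * h + 1) * q * h + h * q ≡ suc (2 * h) * q * (2 * h)
  e₃ = solve-∀

down-false : ∀ {p} h q t u → p ≡ suc (2 * h) → h < t → p * q * (2 * h) ≤ 2 * h * (q * t) + u + p * q * t
down-false h q t u refl h<t = begin
  suc (2 * h) * q * (2 * h)                                    ≤⟨ m≤m+n _ (3 * h * q + q) ⟩
  suc (2 * h) * q * (2 * h) + (3 * h * q + q)                  ≡⟨ e₁ h q ⟩
  (4 * h + 1) * q * suc h                                      ≤⟨ *-monoʳ-≤ ((4 * h + 1) * q) h<t ⟩
  (4 * h + 1) * q * t                                          ≤⟨ m≤m+n _ u ⟩
  (4 * h + 1) * q * t + u                                      ≡⟨ e₂ h q t u ⟩
  2 * h * (q * t) + u + suc (2 * h) * q * t                    ∎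
  where
  open ≤-Reasoning
  e₁ : ∀ h q → suc (2 * h) * q * (2 * h) + (3 * h * q + q) ≡ (4 * h + 1) * q * suc h
  e₁ = solve-∀
  e₂ : ∀ h q t u → (4 * h + 1) * q * t + u ≡ 2 * h * (q * t) + u + suc (2 * h) * q * t
  e₂ = solve-∀

-- With `p` equal to 2h + 1, the general comparison is (4h + 1)qt + u < (4h + 1)qh + hq. A unit step
-- in `t` exceeds the range 2hq of `u`, so `t` = `h` is the only undecided index, and there `u` < hq
-- remains.
down-middle : ∀ {p} h q u → p ≡ suc (2 * h) →
  ind (2 * h * (q * h) + u + p * q * h <? p * q * (2 * h)) ≡ ind (u <? h * q)
down-middle h q u refl = ind-cong
  (λ lt → +-cancelˡ-< A _ _ (subst₂ _<_ (e₁ h q u) (e₂ h q) lt))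
  (λ lt → subst₂ _<_ (sym (e₁ h q u)) (sym (e₂ h q)) (+-monoʳ-< A lt))
  where
  A = (4 * h + 1) * q * h
  e₁ : ∀ h q u → 2 * h * (q * h) + u + suc (2 * h) * q * h ≡ (4 * h + 1) * q * h + u
  e₁ = solve-∀
  e₂ : ∀ h q → suc (2 * h) * q * (2 * h) ≡ (4 * h + 1) * q * h + h * q
  e₂ = solve-∀

-- Adding `q * t` completes 2h to `p` in the coefficient of `t`, so only the sum `t + t₁` matters.
-- The critical value of this sum is 2h, where `q * t < u` remains to be decided.
up-shift : ∀ {p} h q t t₁ u → p ≡ suc (2 * h) →
           2 * h * (q * t) + u + p * q * t₁ + q * t ≡ p * q * (t + t₁) + u
up-shift h q t t₁ u refl = e h q t t₁ u
  where
  e : ∀ h q t t₁ u → 2 * h * (q * t) + u + suc (2 * h) * q * t₁ + q * t ≡ suc (2 * h) * q * (t + t₁) + u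
  e = solve-∀

up-false : ∀ {p} h q t t₁ u → p ≡ suc (2 * h) → u ≤ 2 * h * q → suc (t + t₁) ≤ 2 * h →
           2 * h * (q * t) + u + p * q * t₁ ≤ p * q * (2 * h)
up-false h q t t₁ u refl u≤ le = begin
  2 * h * (q * t) + u + suc (2 * h) * q * t₁                 ≤⟨ +-monoˡ-≤ _ (+-monoʳ-≤ (2 * h * (q * t)) u≤) ⟩
  2 * h * (q * t) + 2 * h * q + suc (2 * h) * q * t₁         ≤⟨ m≤m+n _ (q * t + q) ⟩
  2 * h * (q * t) + 2 * h * q + suc (2 * h) * q * t₁ + (q * t + q) ≡⟨ e h q t t₁ ⟩
  suc (2 * h) * q * suc (t + t₁)                             ≤⟨ *-monoʳ-≤ (suc (2 * h) * q) le ⟩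
  suc (2 * h) * q * (2 * h)                                  ∎
  where
  open ≤-Reasoning
  e : ∀ h q t t₁ → 2 * h * (q * t) + 2 * h * q + suc (2 * h) * q * t₁ + (q * t + q) ≡ suc (2 * h) * q * suc (t + t₁)
  e = solve-∀

up-true : ∀ {p} h q t t₁ u → p ≡ suc (2 * h) → 0 < q → t < p → 2 * h < t + t₁ →
          p * q * (2 * h) < 2 * h * (q * t) + u + p * q * t₁
up-true {p} h q t t₁ u eq 0<q t<p lt = +-cancelʳ-< (q * t) _ _ (begin-strict
  p * q * (2 * h) + q * t                       <⟨ +-monoʳ-< (p * q * (2 * h)) qt<pq ⟩
  p * q * (2 * h) + p * q                       ≡⟨ trans (+-comm _ (p * q)) (sym (*-suc (p * q) (2 * h))) ⟩
  p * q * suc (2 * h)                           ≤⟨ *-monoʳ-≤ (p * q) lt ⟩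
  p * q * (t + t₁)                              ≤⟨ m≤m+n _ u ⟩
  p * q * (t + t₁) + u                          ≡⟨ sym (up-shift h q t t₁ u eq) ⟩
  2 * h * (q * t) + u + p * q * t₁ + q * t      ∎)
  where
  open ≤-Reasoning
  instance _ = >-nonZero 0<q
  qt<pq : q * t < p * q
  qt<pq = subst (q * t <_) (*-comm q p) (*-monoʳ-< q t<p)

up-middle : ∀ {p} h q t t₁ u → p ≡ suc (2 * h) → t + t₁ ≡ 2 * h →
  ind (p * q * (2 * h) <? 2 * h * (q * t) + u + p * q * t₁) ≡ ind (q * t <? u)
up-middle {p} h q t t₁ u eq t+t₁ = ind-cong
  (λ lt → +-cancelˡ-< Q _ _ (subst (Q + q * t <_) shifted (+-monoˡ-< (q * t) lt)))
  (λ lt → +-cancelʳ-< (q * t) _ _ (subst (Q + q * t <_) (sym shifted) (+-monoʳ-< Q lt)))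
  where
  Q = p * q * (2 * h)
  shifted : 2 * h * (q * t) + u + p * q * t₁ + q * t ≡ Q + u
  shifted = trans (up-shift h q t t₁ u eq) (cong (λ z → p * q * z + u) t+t₁)

-- Both comparisons are the lexicographic comparison of (y , b) with (a , c).
compare-< : ∀ r y a b c → b ≤ r → 0 < c → c ≤ r → ind (r * y + b <? r * a + c) ≡ ind (suc r * y + b <? suc r * a + c)
compare-< r y a b c b≤r 0<c c≤r with <-cmp y a
... | tri< y<a _ _ = trans (ind-true (<-≤-trans left (+-monoʳ-≤ (r * a) 0<c)))
                           (sym (ind-true (<-≤-trans (+-monoʳ-< (suc r * y) (s≤s b≤r)) (≤-trans (block-≤ (suc r) y<a) (m≤m+n _ c)))))
  where
  block-≤ : ∀ d {y a} → y < a → d * y + d ≤ d * a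
  block-≤ d {y} y<a = ≤-trans (≤-reflexive (trans (+-comm (d * y) d) (sym (*-suc d y)))) (*-monoʳ-≤ d y<a)
  left : r * y + b < r * a + 1
  left = ≤-trans (s≤s (≤-trans (+-monoʳ-≤ (r * y) b≤r) (block-≤ r y<a))) (≤-reflexive (+-comm 1 (r * a)))
... | tri≈ _ refl _ = ind-cong (λ lt → +-monoʳ-< (suc r * y) (+-cancelˡ-< (r * y) _ _ lt))
                               (λ lt → +-monoʳ-< (r * y) (+-cancelˡ-< (suc r * y) _ _ lt))
... | tri> _ _ a<y = trans (ind-false (≤⇒≯ (high r c≤r)))
                           (sym (ind-false (≤⇒≯ (high (suc r) (m≤n⇒m≤1+n c≤r)))))
  where
  high : ∀ d → c ≤ d → d * a + c ≤ d * y + b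
  high d c≤d = ≤-trans (≤-trans (+-monoʳ-≤ (d * a) c≤d)
    (≤-trans (≤-reflexive (trans (+-comm (d * a) d) (sym (*-suc d a)))) (*-monoʳ-≤ d a<y))) (m≤m+n (d * y) b)

compare-> : ∀ r y a b c → b ≤ r → c < r → ind (r * a + c <? r * y + b) ≡ ind (suc r * a + c <? suc r * y + b)
compare-> r y a b c b≤r c<r with <-cmp a y
... | tri< a<y _ _ = trans (ind-true (low r c<r)) (sym (ind-true (low (suc r) (m<n⇒m<1+n c<r))))
  where
  low : ∀ d → c < d → d * a + c < d * y + b
  low d c<d = <-≤-trans (+-monoʳ-< (d * a) c<d)
    (≤-trans (≤-reflexive (trans (+-comm (d * a) d) (sym (*-suc d a)))) (≤-trans (*-monoʳ-≤ d a<y) (m≤m+n (d * y) b)))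
... | tri≈ _ refl _ = ind-cong (λ lt → +-monoʳ-< (suc r * a) (+-cancelˡ-< (r * a) _ _ lt))
                               (λ lt → +-monoʳ-< (r * a) (+-cancelˡ-< (suc r * a) _ _ lt))
... | tri> _ _ y<a = trans (ind-false (≤⇒≯ (high r b≤r))) (sym (ind-false (≤⇒≯ (high (suc r) (m≤n⇒m≤1+n b≤r)))))
  where
  high : ∀ d → b ≤ d → d * y + b ≤ d * a + c
  high d b≤d = ≤-trans (≤-trans (+-monoʳ-≤ (d * y) b≤d)
    (≤-trans (≤-reflexive (trans (+-comm (d * y) d) (sym (*-suc d y)))) (*-monoʳ-≤ d y<a))) (m≤m+n (d * a) c)

-- The recursion for the Fibonacci numbers from one floor of vertices V to the next

module Recursion (h p k′ : ℕ) (p≡ : p ≡ suc (2 * h)) (p-prime : Prime p) (p-odd : 2 ∤ p) where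

  open Paths p k′ p-prime p-odd public

  p∸1 : p ∸ 1 ≡ 2 * h
  p∸1 = cong (_∸ 1) p≡

  [p∸1]/2 : (p ∸ 1) / 2 ≡ h
  [p∸1]/2 = trans (cong (_/ 2) (trans p∸1 (*-comm 2 h))) (m*n/n≡m h 2)

  0<h : 0 < h
  0<h = n≢0⇒n>0 λ { refl → <⇒≱ (≤-trans (n≤1+n 2) (subst (3 ≤_) p≡ 3≤p)) ≤-refl }

  <p⇒≤2h : ∀ {t} → t < p → t ≤ 2 * h
  <p⇒≤2h t<p = s≤s⁻¹ (subst (_ <_) p≡ t<p)

  2h<p : 2 * h < p
  2h<p = ≤-reflexive (sym p≡)

  h<p : h < p
  h<p = ≤-<-trans (m≤n*m h 2) 2h<p

  σ : ℕ → ℕ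
  σ n = ∑ n (p ^_)

  p^≡ : ∀ n → p ^ n ≡ suc (2 * h * σ n)
  p^≡ zero    = cong suc (sym (*-zeroʳ (2 * h)))
  p^≡ (suc n) = begin
    p * p ^ n                         ≡⟨ cong (_* p ^ n) p≡ ⟩
    p ^ n + 2 * h * p ^ n             ≡⟨ cong (_+ 2 * h * p ^ n) (p^≡ n) ⟩
    suc (2 * h * σ n + 2 * h * p ^ n) ≡⟨ cong suc (sym (*-distribˡ-+ (2 * h) (σ n) (p ^ n))) ⟩
    suc (2 * h * σ (suc n))           ∎
    where open ≡-Reasoning

  σ-suc : ∀ n → σ (suc n) ≡ suc (p * σ n)
  σ-suc zero    = cong suc (sym (*-zeroʳ p))
  σ-suc (suc n) = trans (cong (_+ p * p ^ n) (σ-suc n)) (cong suc (sym (*-distribˡ-+ p (σ n) (p ^ n))))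

  0<q′ : 0 < q′
  0<q′ = subst (0 <_) (sym (p^≡ k′)) (s≤s z≤n)

  -- u l = l - ⌊l/p⌋
  u : ℕ → ℕ
  u l = 2 * h * (l / p) + l % p

  l/p<q′ : ∀ {l} → l < q → l / p < q′
  l/p<q′ l<q = m<n*o⇒m/o<n (<-≤-trans l<q (≤-reflexive (*-comm p q′)))

  l%p≤ : ∀ l → l % p ≤ 2 * h
  l%p≤ l = <p⇒≤2h (m%n<n l p)

  u≤ : ∀ {l} → l < q → u l ≤ 2 * h * q′
  u≤ {l} l<q = ≤-trans (+-monoʳ-≤ (2 * h * (l / p)) (l%p≤ l))
    (≤-trans (≤-reflexive (trans (+-comm _ (2 * h)) (sym (*-suc (2 * h) (l / p))))) (*-monoʳ-≤ (2 * h) (l/p<q′ l<q)))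

  -- The numbers `u l` and `l` have the same coefficients `l / p` and `l % p` with respect to the
  -- radices 2h and `p`; so have the thresholds `h * q′` and `h * σ k`, with coefficients `h * σ k′`
  -- and `h`. The digit `l % p` may equal 2h, one more than radix 2h allows; `compare-<` permits
  -- this.
  u<h : ∀ l → ind (u l <? h * q′) ≡ ind (l <? h * σ k)
  u<h l = begin
    ind (u l <? h * q′)                        ≡⟨ cong (λ z → ind (u l <? z)) e₁ ⟩
    ind (u l <? 2 * h * (h * σ k′) + h)        ≡⟨ compare-< (2 * h) (l / p) (h * σ k′) (l % p) h (l%p≤ l) 0<h (m≤n*m h 2) ⟩
    ind (suc (2 * h) * (l / p) + l % p <? suc (2 * h) * (h * σ k′) + h)
      ≡⟨ cong₂ (λ a b → ind (a <? b)) e₂ e₃ ⟩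
    ind (l <? h * σ k)                         ∎
    where
    open ≡-Reasoning
    rearrange : ∀ h s → h * suc (2 * h * s) ≡ 2 * h * (h * s) + h
    rearrange = solve-∀
    rearrange′ : ∀ p h s → p * (h * s) + h ≡ h * suc (p * s)
    rearrange′ = solve-∀
    e₁ : h * q′ ≡ 2 * h * (h * σ k′) + h
    e₁ = trans (cong (h *_) (p^≡ k′)) (rearrange h (σ k′))
    e₂ : suc (2 * h) * (l / p) + l % p ≡ l
    e₂ = trans (cong (λ z → z * (l / p) + l % p) (sym p≡)) (sym (divMod-≡ l p))
    e₃ : suc (2 * h) * (h * σ k′) + h ≡ h * σ k
    e₃ = trans (cong (λ z → z * (h * σ k′) + h) (sym p≡)) (trans (rearrange′ p h (σ k′)) (cong (h *_) (sym (σ-suc k′))))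

  2hσk≮ : ∀ {l} → l < q → ¬ (2 * h * σ k < l)
  2hσk≮ l<q lt = <⇒≱ l<q (≤-trans (≤-reflexive (p^≡ k)) lt)

  -- The same change of radix as in `u<h`, with coefficients `t * σ k′` and `t`. The value `t` = 2h
  -- is not below the radix and is treated apart; both indicators vanish there.
  <u : ∀ {l} t → l < q → t < p → ind (q′ * t <? u l) ≡ ind (t * σ k <? l)
  <u {l} t l<q t<p with m≤n⇒m<n∨m≡n (<p⇒≤2h t<p)
  ... | inj₂ refl = trans (ind-false λ lt → <⇒≱ lt (≤-trans (u≤ l<q) (≤-reflexive (*-comm (2 * h) q′))))
                              (sym (ind-false (2hσk≮ l<q)))
  ... | inj₁ t<2h = begin
    ind (q′ * t <? u l)                        ≡⟨ cong (λ z → ind (z <? u l)) e₁ ⟩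
    ind (2 * h * (t * σ k′) + t <? u l)        ≡⟨ compare-> (2 * h) (l / p) (t * σ k′) (l % p) t (l%p≤ l) t<2h ⟩
    ind (suc (2 * h) * (t * σ k′) + t <? suc (2 * h) * (l / p) + l % p)
      ≡⟨ cong₂ (λ a b → ind (a <? b)) e₃ e₂ ⟩
    ind (t * σ k <? l)                         ∎
    where
    open ≡-Reasoning
    rearrange : ∀ r t s → suc (r * s) * t ≡ r * (t * s) + t
    rearrange = solve-∀
    rearrange′ : ∀ p t s → p * (t * s) + t ≡ t * suc (p * s)
    rearrange′ = solve-∀
    e₁ : q′ * t ≡ 2 * h * (t * σ k′) + t
    e₁ = trans (cong (_* t) (p^≡ k′)) (rearrange (2 * h) t (σ k′))
    e₂ : suc (2 * h) * (l / p) + l % p ≡ l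
    e₂ = trans (cong (λ z → z * (l / p) + l % p) (sym p≡)) (sym (divMod-≡ l p))
    e₃ : suc (2 * h) * (t * σ k′) + t ≡ t * σ k
    e₃ = trans (cong (λ z → z * (t * σ k′) + t) (sym p≡)) (trans (rearrange′ p t (σ k′)) (cong (t *_) (sym (σ-suc k′))))

  -- The number of vertical nodes of the `E2` block on the `t`-th way back from `l`, as `block-E2`
  -- confirms.
  N : ℕ → ℕ → ℕ
  N l t = 2 * h * (q′ * t) + u l

  -- Both counters refer to the `t`-th way back from `l`: `down` detects the descent from its `E2`
  -- block to the following `E3` block, `up` the descent to its `E2` block from a preceding `E3`
  -- block with parameter `t₁`.
  down : ℕ → ℕ → ℕ
  down l t = ind (N l t + q * t <? q * (2 * h))

  up : ℕ → ℕ → ℕ → ℕ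
  up l t t₁ = ind (q * (2 * h) <? N l t + q * t₁)

  ∑-down : ∀ {l} → l < q → ∑ p (down l) ≡ h + ind (l <? h * σ k)
  ∑-down {l} l<q = trans
    (∑-below p h (down l) h<p
      (λ t t<h → ind-true (down-true h q′ t (u l) p≡ 0<q′ (u≤ l<q) t<h))
      (λ t h<t _ → ind-false (≤⇒≯ (down-false h q′ t (u l) p≡ h<t))))
    (cong (h +_) (trans (down-middle h q′ (u l) p≡) (u<h l)))

  -- The undecided index is 2h - t. The `t` larger indices all give descents, the smaller ones none.
  ∑-up : ∀ {l} t → l < q → t < p → ∑ p (up l t) ≡ t + ind (t * σ k <? l)
  ∑-up {l} t l<q t<p = +-cancelˡ-≡ (suc c) _ _ (begin
    suc c + ∑ p (up l t)                 ≡⟨ ∑-above p c (up l t) (≤-<-trans (m∸n≤m (2 * h) t) 2h<p) low high ⟩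
    p + up l t c                         ≡⟨ cong₂ _+_ (trans p≡ (cong suc (sym (m∸n+n≡m t≤)))) (trans (up-middle h q′ t c (u l) p≡ t+c) (<u t l<q t<p)) ⟩
    suc c + t + ind (t * σ k <? l)       ≡⟨ +-assoc (suc c) t _ ⟩
    suc c + (t + ind (t * σ k <? l))     ∎)
    where
    open ≡-Reasoning
    c = 2 * h ∸ t
    t≤ = <p⇒≤2h t<p
    t+c : t + c ≡ 2 * h
    t+c = m+[n∸m]≡n t≤
    low : ∀ t₁ → t₁ < c → up l t t₁ ≡ 0
    low t₁ t₁<c = ind-false (≤⇒≯ (up-false h q′ t t₁ (u l) p≡ (u≤ l<q)
      (≤-trans (≤-reflexive (sym (+-suc t t₁))) (≤-trans (+-monoʳ-≤ t t₁<c) (≤-reflexive t+c)))))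
    high : ∀ t₁ → c < t₁ → t₁ < p → up l t t₁ ≡ 1
    high t₁ c<t₁ _ = ind-true (up-true h q′ t t₁ (u l) p≡ 0<q′ t<p (subst (_< t + t₁) t+c (+-monoʳ-< t c<t₁)))

  triangle : ∑ p (λ t → t) ≡ h * p
  triangle = *-cancelˡ-≡ _ _ 2 (trans (cong (λ z → 2 * ∑ z (λ t → t)) p≡)
    (trans (∑-id (2 * h)) (trans (cong (2 * h *_) (sym p≡)) (*-assoc 2 h p))))

  ∑-∑-up : ∀ {l} → l < q → ∑ p (λ t → ∑ p (up l t)) ≡ h * p + ∑ (2 * h) (λ t → ind (t * σ k <? l))
  ∑-∑-up {l} l<q = begin
    ∑ p (λ t → ∑ p (up l t))                                  ≡⟨ ∑-cong p (λ t → ∑-up t l<q) ⟩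
    ∑ p (λ t → t + ind (t * σ k <? l))                        ≡⟨ ∑-+ p (λ t → t) _ ⟩
    ∑ p (λ t → t) + ∑ p (λ t → ind (t * σ k <? l))            ≡⟨ cong₂ _+_ triangle last ⟩
    h * p + ∑ (2 * h) (λ t → ind (t * σ k <? l))              ∎
    where
    open ≡-Reasoning
    -- The term for `t` = 2h drops out, because 2h times `σ k` is `q` - 1, which `l` does not
    -- exceed.
    last : ∑ p (λ t → ind (t * σ k <? l)) ≡ ∑ (2 * h) (λ t → ind (t * σ k <? l))
    last = trans (cong (λ z → ∑ z (λ t → ind (t * σ k <? l))) p≡)
      (trans (cong (∑ (2 * h) (λ t → ind (t * σ k <? l)) +_) (ind-false (2hσk≮ l<q))) (+-identityʳ _))

  N≤ : ∀ (l : Fin q) (t : Fin p) → N (toℕ l) (toℕ t) ≤ q * (2 * h)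
  N≤ l t = ≤-trans (+-monoʳ-≤ (2 * h * (q′ * toℕ t)) (u≤ (toℕ<n l)))
    (≤-trans (≤-reflexive (e h q′ (toℕ t))) (≤-trans (*-monoʳ-≤ (2 * h * q′) (toℕ<n t)) (≤-reflexive (e′ h q′ p))))
    where
    e : ∀ h q t → 2 * h * (q * t) + 2 * h * q ≡ 2 * h * q * suc t
    e = solve-∀
    e′ : ∀ h q p → 2 * h * q * p ≡ p * q * (2 * h)
    e′ = solve-∀

  block-E2 : ∀ {s} .{1≤s : 1 ≤ s} (l : Fin q) (t : Fin p) → let N = N (toℕ l) (toℕ t) in
             block (E2 {s} {1≤s} (digit l) (mid-below l t)) ≡ B (q * (2 * h) ∸ N) N
  block-E2 l t = cong₂ (λ r N → B (q * r ∸ N) N) p∸1 (begin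
    (p ∸ 1) * toℕ (below l t) + toℕ (digit l)            ≡⟨ cong₂ _+_ (cong₂ _*_ p∸1 (toℕ-below l t)) (toℕ-digit l) ⟩
    2 * h * (q′ * toℕ t + toℕ l / p) + toℕ l % p         ≡⟨ e (2 * h) (q′ * toℕ t) (toℕ l / p) (toℕ l % p) ⟩
    N (toℕ l) (toℕ t)                                    ∎)
    where
    open ≡-Reasoning
    e : ∀ r a y b → r * (a + y) + b ≡ r * a + (r * y + b)
    e = solve-∀

  block-E3 : ∀ {s} .{2≤s : 2 ≤ s} (l : Fin q) (t : Fin p) →
             block (E3 {s} {2≤s} (mid-∸ l t)) ≡ B (q * toℕ t) (q * (2 * h ∸ toℕ t))
  block-E3 l t = cong₂ (λ r t → B (q * t) (q * (r ∸ t))) p∸1 (mid-/ l t)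

  module _ {s : ℕ} (l : Fin q) (t : Fin p) where

    edge₂ : Edge (V (suc s) (s≤s z≤n) (below l t)) (W (suc (suc s)) (s≤s (s≤s z≤n)) (mid l t))
    edge₂ = E2 (digit l) (mid-below l t)

    edge₃ : Edge (W (suc (suc s)) (s≤s (s≤s z≤n)) (mid l t)) (V (suc (suc s)) (s≤s z≤n) l)
    edge₃ = E3 (mid-∸ l t)

    t≤2h : toℕ t ≤ 2 * h
    t≤2h = <p⇒≤2h (toℕ<n t)

    des-down : (P : Path (V (suc s) (s≤s z≤n) (below l t))) → des (P ▷ edge₂ ▷ edge₃) ≡ des (P ▷ edge₂) + down (toℕ l) (toℕ t)
    des-down P = trans (des-▷-long (P ▷ edge₂) edge₃ 3≤) (cong (des (P ▷ edge₂) +_)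
      (trans (cong₂ (λ b b′ → ind (descends? b b′)) (block-E2 {suc s} {s≤s z≤n} l t) (block-E3 {suc (suc s)} {s≤s (s≤s z≤n)} l t))
             (descends-E2-E3 q (2 * h) (N (toℕ l) (toℕ t)) (toℕ t) (N≤ l t) t≤2h)))
      where
      3≤ : 3 ≤ lastIndex (P ▷ edge₂)
      3≤ = ≤-trans (s≤s (*-monoʳ-≤ 2 (s≤s (z≤n {s})))) (≤-reflexive (sym (trans (lastIndex-▷ P edge₂) (cong suc (lastIndex-V P)))))

  -- There are `p ∸ 1` choices for the `E1` edge and `p` ways up for each further floor of vertices
  -- V. The index is shifted: `s` belongs to V_{s+1}, here and in `𝓜V`.
  number : ∀ s (l : Fin q) c → sumOver (𝒫V (suc s) (s≤s z≤n) l) (λ _ → c) ≡ 2 * h * p ^ s * c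
  number zero l c = begin
    sumOver (𝒫V 1 (s≤s z≤n) l) (λ _ → c)         ≡⟨ V₁-step l (λ _ → c) ⟩
    sumOver (enumFin (p ∸ 1)) (λ _ → c)          ≡⟨ sumOver-Fin (p ∸ 1) (λ _ → c) (λ _ → c) (λ _ → refl) ⟩
    ∑ (p ∸ 1) (λ _ → c)                          ≡⟨ ∑-const (p ∸ 1) c ⟩
    (p ∸ 1) * c                                  ≡⟨ cong (_* c) (trans p∸1 (sym (*-identityʳ (2 * h)))) ⟩
    2 * h * 1 * c                                ∎
    where open ≡-Reasoning
  number (suc s) l c = begin
    sumOver (𝒫V (suc (suc s)) (s≤s z≤n) l) (λ _ → c)     ≡⟨ V-step s l (λ _ → c) ⟩
    sumOver (enumFin p) (λ t → sumOver (𝒫V (suc s) (s≤s z≤n) (below l t)) (λ _ → c))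
      ≡⟨ sumOver-Fin p _ (λ _ → 2 * h * p ^ s * c) (λ t → number s (below l t) c) ⟩
    ∑ p (λ _ → 2 * h * p ^ s * c)                        ≡⟨ ∑-const p _ ⟩
    p * (2 * h * p ^ s * c)                              ≡⟨ e p h (p ^ s) c ⟩
    2 * h * (p * p ^ s) * c                              ∎
    where
    open ≡-Reasoning
    e : ∀ p h a c → p * (2 * h * a * c) ≡ 2 * h * (p * a) * c
    e = solve-∀

  𝓜V : ∀ s → Fin q → ℕ
  𝓜V s l = sumOver (𝒫V (suc s) (s≤s z≤n) l) des

  𝓜V₁ : ∀ l → 𝓜V 0 l ≡ h
  𝓜V₁ l = begin
    𝓜V 0 l                                              ≡⟨ V₁-step l des ⟩
    sumOver (enumFin (p ∸ 1)) (λ t → des (start (source l t) ▷ E1 t (toℕ-source l t)))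
      ≡⟨ sumOver-Fin (p ∸ 1) _ (λ t → ind (t <? (p ∸ 1) / 2)) (λ t → des-start t (toℕ-source l t)) ⟩
    ∑ (p ∸ 1) (λ t → ind (t <? (p ∸ 1) / 2))            ≡⟨ cong₂ (λ a b → ∑ a (λ t → ind (t <? b))) p∸1 [p∸1]/2 ⟩
    ∑ (2 * h) (λ t → ind (t <? h))                      ≡⟨ ∑-initial (2 * h) h _ (m≤n*m h 2)
                                                             (λ t t<h → ind-true t<h) (λ t h≤t _ → ind-false (≤⇒≯ h≤t)) ⟩
    h                                                   ∎
    where open ≡-Reasoning

  𝓜V-step : ∀ s (l : Fin q) → 𝓜V (suc s) l ≡ sumOver (enumFin p) (λ t →
    sumOver (𝒫V (suc s) (s≤s z≤n) (below l t)) (λ P → des (P ▷ edge₂ l t)) + 2 * h * p ^ s * down (toℕ l) (toℕ t))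
  𝓜V-step s l = trans (V-step s l des) (sumOver-cong (enumFin p) λ t →
    trans (sumOver-cong (𝒫V (suc s) (s≤s z≤n) (below l t)) (des-down l t))
      (trans (sumOver-+ (𝒫V (suc s) (s≤s z≤n) (below l t)) _ _)
        (cong (sumOver (𝒫V (suc s) (s≤s z≤n) (below l t)) (λ P → des (P ▷ edge₂ l t)) +_) (number s (below l t) _))))

  -- Only the indices 1 and 3 can be descents here. As 2 is excluded, no `up` term occurs, unlike on
  -- all later floors.
  𝓜V₂ : ∀ l → 𝓜V 1 l ≡ h * (p + 2 * h + 2 * ind (toℕ l <? h * σ k))
  𝓜V₂ l = begin
    𝓜V 1 l                                              ≡⟨ 𝓜V-step 0 l ⟩
    sumOver (enumFin p) _                               ≡⟨ sumOver-Fin p _ (λ t → h + 2 * h * 1 * down (toℕ l) t) (λ t → cong (_+ 2 * h * 1 * down (toℕ l) (toℕ t))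
                                                             (trans (sumOver-cong (𝒫V 1 (s≤s z≤n) (below l t)) (λ P → des-▷-first P (edge₂ l t))) (𝓜V₁ (below l t)))) ⟩
    ∑ p (λ t → h + 2 * h * 1 * down (toℕ l) t)          ≡⟨ ∑-+ p (λ _ → h) _ ⟩
    ∑ p (λ _ → h) + ∑ p (λ t → 2 * h * 1 * down (toℕ l) t) ≡⟨ cong₂ _+_ (∑-const p h) (trans (∑-* p (2 * h * 1) (down (toℕ l))) (cong (2 * h * 1 *_) (∑-down (toℕ<n l)))) ⟩
    p * h + 2 * h * 1 * (h + ind (toℕ l <? h * σ k))    ≡⟨ e p h (ind (toℕ l <? h * σ k)) ⟩
    h * (p + 2 * h + 2 * ind (toℕ l <? h * σ k))        ∎
    where
    open ≡-Reasoning
    e : ∀ p h i → p * h + 2 * h * 1 * (h + i) ≡ h * (p + 2 * h + 2 * i)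
    e = solve-∀

  -- The last block of a path depends on its last edge `E3`, so the sum has to go back one floor
  -- further; there the summand is constant in the remaining path and `number` applies.
  ∑-lastBlock : ∀ s (l : Fin q) (t : Fin p) →
    sumOver (𝒫V (suc (suc s)) (s≤s z≤n) (below l t)) (λ P → ind (descends? (lastBlock P) (block (edge₂ {suc s} l t)))) ≡
    2 * h * p ^ s * ∑ p (up (toℕ l) (toℕ t))
  ∑-lastBlock s l t = begin
    sumOver (𝒫V (suc (suc s)) (s≤s z≤n) (below l t)) (λ P → ind (descends? (lastBlock P) b))
      ≡⟨ V-step s (below l t) (λ P → ind (descends? (lastBlock P) b)) ⟩
    sumOver (enumFin p) (λ t₁ → sumOver (𝒫V (suc s) (s≤s z≤n) (below (below l t) t₁)) (λ _ → ind (descends? (block (edge₃ {s} (below l t) t₁)) b)))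
      ≡⟨ sumOver-Fin p _ (λ t₁ → 2 * h * p ^ s * up (toℕ l) (toℕ t) t₁) (λ t₁ →
           trans (number s (below (below l t) t₁) _) (cong (2 * h * p ^ s *_)
             (trans (cong₂ (λ b b′ → ind (descends? b b′)) (block-E3 {suc (suc s)} {s≤s (s≤s z≤n)} (below l t) t₁) (block-E2 {suc (suc s)} {s≤s z≤n} l t))
                    (descends-E3-E2 q (2 * h) (N (toℕ l) (toℕ t)) (toℕ t₁) (N≤ l t) (<p⇒≤2h (toℕ<n t₁)))))) ⟩
    ∑ p (λ t₁ → 2 * h * p ^ s * up (toℕ l) (toℕ t) t₁)
      ≡⟨ ∑-* p (2 * h * p ^ s) (up (toℕ l) (toℕ t)) ⟩
    2 * h * p ^ s * ∑ p (up (toℕ l) (toℕ t)) ∎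
    where
    open ≡-Reasoning
    b = block (edge₂ {suc s} l t)

  ∑-des-▷ : ∀ s (l : Fin q) (t : Fin p) →
    sumOver (𝒫V (suc (suc s)) (s≤s z≤n) (below l t)) (λ P → des (P ▷ edge₂ l t)) ≡
    𝓜V (suc s) (below l t) + 2 * h * p ^ s * ∑ p (up (toℕ l) (toℕ t))
  ∑-des-▷ s l t = trans
    (sumOver-cong (𝒫V (suc (suc s)) (s≤s z≤n) (below l t)) (λ P → des-▷-long P (edge₂ l t)
      (≤-trans (≤-trans (n≤1+n 3) (*-monoʳ-≤ 2 (s≤s (s≤s (z≤n {s}))))) (≤-reflexive (sym (lastIndex-V P))))))
    (trans (sumOver-+ (𝒫V (suc (suc s)) (s≤s z≤n) (below l t)) des _)
           (cong (𝓜V (suc s) (below l t) +_) (∑-lastBlock s l t)))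

  -- The Fibonacci number of V_{e+2}, divided by `h`. Of the constant 4h p^(e+1), one half stems
  -- from `∑-down` and one half from `∑-∑-up`.
  X : ℕ → ℕ → ℕ
  X zero    l = p + 2 * h + 2 * ind (l <? h * σ k)
  X (suc e) l = ∑ p (λ t → X e (q′ * t + l / p)) + 4 * h * p ^ suc e
              + 2 * p ^ e * (p * ind (l <? h * σ k) + ∑ (2 * h) (λ t → ind (t * σ k <? l)))

  𝓜V≡X : ∀ e l → 𝓜V (suc e) l ≡ h * X e (toℕ l)
  𝓜V≡X zero    l = 𝓜V₂ l
  𝓜V≡X (suc e) l = begin
    𝓜V (suc (suc e)) l                                  ≡⟨ 𝓜V-step (suc e) l ⟩
    sumOver (enumFin p) _                               ≡⟨ sumOver-Fin p _ (λ t → h * X e (q′ * t + y) + c * ∑ p (up λ₀ t) + c′ * down λ₀ t)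
                                                             (λ t → cong (_+ c′ * down λ₀ (toℕ t)) (trans (∑-des-▷ e l t)
                                                               (cong (_+ c * ∑ p (up λ₀ (toℕ t))) (trans (𝓜V≡X e (below l t)) (cong (λ z → h * X e z) (toℕ-below l t)))))) ⟩
    ∑ p (λ t → h * X e (q′ * t + y) + c * ∑ p (up λ₀ t) + c′ * down λ₀ t)
      ≡⟨ trans (∑-+ p _ _) (cong (_+ ∑ p (λ t → c′ * down λ₀ t)) (∑-+ p _ _)) ⟩
    ∑ p (λ t → h * X e (q′ * t + y)) + ∑ p (λ t → c * ∑ p (up λ₀ t)) + ∑ p (λ t → c′ * down λ₀ t)
      ≡⟨ cong₂ _+_ (cong₂ _+_ (∑-* p h _) (trans (∑-* p c _) (cong (c *_) (∑-∑-up (toℕ<n l)))))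
                   (trans (∑-* p c′ _) (cong (c′ *_) (∑-down (toℕ<n l)))) ⟩
    h * ∑ p (λ t → X e (q′ * t + y)) + c * (h * p + ∑ (2 * h) (λ t → ind (t * σ k <? λ₀))) + c′ * (h + ind (λ₀ <? h * σ k))
      ≡⟨ rearrange h p (p ^ e) (∑ p (λ t → X e (q′ * t + y))) (∑ (2 * h) (λ t → ind (t * σ k <? λ₀))) (ind (λ₀ <? h * σ k)) ⟩
    h * X (suc e) λ₀ ∎
    where
    open ≡-Reasoning
    λ₀ = toℕ l
    y  = λ₀ / p
    c  = 2 * h * p ^ e
    c′ = 2 * h * p ^ suc e
    rearrange : ∀ h p a X n i → h * X + 2 * h * a * (h * p + n) + 2 * h * (p * a) * (h + i) ≡
                h * (X + 4 * h * (p * a) + 2 * a * (p * i + n))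
    rearrange = solve-∀

-- The operator `T` on thresholds and the closed form of the recursion

module ClosedForm (h p k′ : ℕ) (p≡ : p ≡ suc (2 * h)) (p-prime : Prime p) (p-odd : 2 ∤ p) where

  open Recursion h p k′ p≡ p-prime p-odd public

  0<p^ : ∀ j → 0 < p ^ j
  0<p^ j = subst (0 <_) (sym (p^≡ j)) (s≤s z≤n)

  T : (ℕ → ℕ) → ℕ → ℕ
  T f l = ∑ p (λ t → f (q′ * t + l / p))

  T-below-q : ∀ {l t} → l < q → t < p → q′ * t + l / p < q
  T-below-q l<q t<p = *+-< {q′} {p} t<p (l/p<q′ l<q)

  T-cong : ∀ {f g} l → l < q → (∀ m → m < q → f m ≡ g m) → T f l ≡ T g l
  T-cong l l<q eq = ∑-cong p λ t t<p → eq _ (T-below-q l<q t<p)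

  T-+ : ∀ f g l → T (λ m → f m + g m) l ≡ T f l + T g l
  T-+ f g l = ∑-+ p _ _

  T-* : ∀ c f l → T (λ m → c * f m) l ≡ c * T f l
  T-* c f l = ∑-* p c _

  private
    *-below : ∀ {t τ y} → y < q′ → t < τ → q′ * t + y < q′ * τ
    *-below {t} {τ} y< t<τ = <-≤-trans (*+-< {q′} {τ} t<τ y<) (≤-reflexive (*-comm τ q′))

    *-above : ∀ {t τ b} → b ≤ q′ → t < τ → q′ * t + b ≤ q′ * τ
    *-above {t} {τ} b≤ t<τ = ≤-trans (+-monoʳ-≤ (q′ * t) b≤)
      (≤-trans (≤-reflexive (trans (+-comm (q′ * t) q′) (sym (*-suc q′ t)))) (*-monoʳ-≤ q′ t<τ))

    /-<⇒ : ∀ {l b} → l / p < b → l < p * b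
    /-<⇒ {l} {b} lt = subst₂ _<_ (sym (divMod-≡ l p)) (*-comm b p) (*+-< {p} {b} lt (m%n<n l p))

    /-<⇐ : ∀ {l b} → l < p * b → l / p < b
    /-<⇐ {l} {b} lt = m<n*o⇒m/o<n (<-≤-trans lt (≤-reflexive (*-comm p b)))

  -- The threshold is split into a leading coefficient `τ` and a lower part `b`. The leading
  -- coefficient `t` of the argument decides unless `t` = `τ`, and then `l / p` is compared with
  -- `b`, hence `l` with `p * b`.
  T-< : ∀ {l} τ b → l < q → τ < p → b ≤ q′ → T (λ m → ind (m <? q′ * τ + b)) l ≡ τ + ind (l <? p * b)
  T-< {l} τ b l<q τ<p b≤ = trans
    (∑-below p τ _ τ<p
      (λ t t<τ → ind-true (<-≤-trans (*-below (l/p<q′ l<q) t<τ) (m≤m+n _ b)))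
      (λ t τ<t _ → ind-false (≤⇒≯ (≤-trans (*-above b≤ τ<t) (m≤m+n _ (l / p))))))
    (cong (τ +_) (ind-cong (λ lt → /-<⇒ (+-cancelˡ-< (q′ * τ) _ _ lt)) (λ lt → +-monoʳ-< (q′ * τ) (/-<⇐ lt))))

  T-≥ : ∀ {l} τ b → l < q → τ < p → b ≤ q′ → suc τ + T (λ m → ind (q′ * τ + b ≤? m)) l ≡ p + ind (p * b ≤? l)
  T-≥ {l} τ b l<q τ<p b≤ = trans
    (∑-above p τ _ τ<p
      (λ t t<τ → ind-false (<⇒≱ (<-≤-trans (*-below (l/p<q′ l<q) t<τ) (m≤m+n _ b))))
      (λ t τ<t _ → ind-true (≤-trans (*-above b≤ τ<t) (m≤m+n _ (l / p)))))
    (cong (p +_) (ind-cong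
      (λ le → ≮⇒≥ λ lt → <⇒≱ (+-monoʳ-< (q′ * τ) (/-<⇐ lt)) le)
      (λ le → +-monoʳ-≤ (q′ * τ) (≮⇒≥ λ lt → <⇒≱ (/-<⇒ lt) le))))

  -- Θ j = p^j + ... + p^(k-1)
  Θ : ℕ → ℕ
  Θ j = p ^ j * σ (k ∸ j)

  -- For `j` = 0 this is `τ * σ k` + 1, so the strict thresholds of `∑-∑-up` become weak ones. The
  -- summand 1 is multiplied by `p` under each `T`, whence p^j.
  θ : ℕ → ℕ → ℕ
  θ j τ = τ * Θ j + p ^ j

  crossed : ℕ → ℕ → ℕ
  crossed j l = ∑ (2 * h) (λ τ → ind (θ j τ ≤? l))

  -- E j = T^j (E 0) up to an additive constant, and E 0 is the part of the number of new descents
  -- that depends on l.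
  E : ℕ → ℕ → ℕ
  E j l = p * ind (l <? h * Θ j) + crossed j l

  k∸ : ∀ {j} → j ≤ k′ → k ∸ j ≡ suc (k′ ∸ j)
  k∸ j≤ = +-∸-assoc 1 j≤

  p^*p^ : ∀ {j} → j ≤ k′ → p ^ j * p ^ (k′ ∸ j) ≡ q′
  p^*p^ {j} j≤ = trans (sym (^-distribˡ-+-* p j (k′ ∸ j))) (cong (p ^_) (m+[n∸m]≡n j≤))

  -- Splitting off the top power `q′` exhibits the leading coefficient that `T` consumes; the rest
  -- times `p` is `Θ (suc j)` by `Θ-p`. So `T` moves the thresholds from `j` to `j + 1`.
  Θ-q′ : ∀ {j} → j ≤ k′ → Θ j ≡ p ^ j * σ (k′ ∸ j) + q′
  Θ-q′ {j} j≤ = trans (cong (λ z → p ^ j * σ z) (k∸ j≤))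
    (trans (*-distribˡ-+ (p ^ j) (σ (k′ ∸ j)) _) (cong (p ^ j * σ (k′ ∸ j) +_) (p^*p^ j≤)))

  Θ-p : ∀ {j} → p * (p ^ j * σ (k′ ∸ j)) ≡ Θ (suc j)
  Θ-p {j} = sym (*-assoc p (p ^ j) (σ (k′ ∸ j)))

  θ-low≤q′ : ∀ {j τ} → j ≤ k′ → τ ≤ 2 * h → τ * (p ^ j * σ (k′ ∸ j)) + p ^ j ≤ q′
  θ-low≤q′ {j} {τ} j≤ τ≤ = begin
    τ * (p ^ j * σ n) + p ^ j      ≤⟨ +-monoˡ-≤ (p ^ j) (*-monoˡ-≤ (p ^ j * σ n) τ≤) ⟩
    2 * h * (p ^ j * σ n) + p ^ j  ≡⟨ e (2 * h) (p ^ j) (σ n) ⟩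
    p ^ j * suc (2 * h * σ n)      ≡⟨ cong (p ^ j *_) (sym (p^≡ n)) ⟩
    p ^ j * p ^ n                  ≡⟨ p^*p^ j≤ ⟩
    q′                             ∎
    where
    open ≤-Reasoning
    n = k′ ∸ j
    e : ∀ r a s → r * (a * s) + a ≡ a * suc (r * s)
    e = solve-∀

  T-ind : ∀ {j l} → j ≤ k′ → l < q → T (λ m → ind (m <? h * Θ j)) l ≡ h + ind (l <? h * Θ (suc j))
  T-ind {j} {l} j≤ l<q = begin
    T (λ m → ind (m <? h * Θ j)) l      ≡⟨ cong (λ z → T (λ m → ind (m <? z)) l) e₁ ⟩
    T (λ m → ind (m <? q′ * h + b)) l   ≡⟨ T-< h b l<q h<p (≤-trans (m≤m+n b (p ^ j)) (θ-low≤q′ j≤ (m≤n*m h 2))) ⟩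
    h + ind (l <? p * b)                ≡⟨ cong (λ z → h + ind (l <? z)) e₂ ⟩
    h + ind (l <? h * Θ (suc j))        ∎
    where
    open ≡-Reasoning
    b = h * (p ^ j * σ (k′ ∸ j))
    rearrange : ∀ h a q → h * (a + q) ≡ q * h + h * a
    rearrange = solve-∀
    rearrange′ : ∀ p h a → p * (h * a) ≡ h * (p * a)
    rearrange′ = solve-∀
    e₁ : h * Θ j ≡ q′ * h + b
    e₁ = trans (cong (h *_) (Θ-q′ j≤)) (rearrange h (p ^ j * σ (k′ ∸ j)) q′)
    e₂ : p * b ≡ h * Θ (suc j)
    e₂ = trans (rearrange′ p h _) (cong (h *_) (Θ-p {j}))

  T-θ : ∀ {j l} τ → j ≤ k′ → l < q → τ < 2 * h → suc τ + T (λ m → ind (θ j τ ≤? m)) l ≡ p + ind (θ (suc j) τ ≤? l)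
  T-θ {j} {l} τ j≤ l<q τ< = begin
    suc τ + T (λ m → ind (θ j τ ≤? m)) l         ≡⟨ cong (λ z → suc τ + T (λ m → ind (z ≤? m)) l) e₁ ⟩
    suc τ + T (λ m → ind (q′ * τ + b ≤? m)) l    ≡⟨ T-≥ τ b l<q (<-trans τ< 2h<p) (θ-low≤q′ j≤ (<⇒≤ τ<)) ⟩
    p + ind (p * b ≤? l)                         ≡⟨ cong (λ z → p + ind (z ≤? l)) e₂ ⟩
    p + ind (θ (suc j) τ ≤? l)                   ∎
    where
    open ≡-Reasoning
    b = τ * (p ^ j * σ (k′ ∸ j)) + p ^ j
    rearrange : ∀ τ a q c → τ * (a + q) + c ≡ q * τ + (τ * a + c)
    rearrange = solve-∀
    rearrange′ : ∀ p τ a c → p * (τ * a + c) ≡ τ * (p * a) + p * c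
    rearrange′ = solve-∀
    e₁ : θ j τ ≡ q′ * τ + b
    e₁ = trans (cong (λ z → τ * z + p ^ j) (Θ-q′ j≤)) (rearrange τ (p ^ j * σ (k′ ∸ j)) q′ (p ^ j))
    e₂ : p * b ≡ θ (suc j) τ
    e₂ = trans (rearrange′ p τ _ (p ^ j)) (cong (λ z → τ * z + p * p ^ j) (Θ-p {j}))

  T-E : ∀ {j l} → j ≤ k′ → l < q → T (E j) l ≡ E (suc j) l + 2 * h * p
  T-E {j} {l} j≤ l<q = begin
    T (E j) l                                             ≡⟨ T-+ (λ m → p * ind (m <? h * Θ j)) (crossed j) l ⟩
    T (λ m → p * ind (m <? h * Θ j)) l + T (crossed j) l
      ≡⟨ cong₂ _+_ (trans (T-* p (λ m → ind (m <? h * Θ j)) l) (cong (p *_) (T-ind j≤ l<q))) swapped ⟩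
    p * (h + i) + (h * p + c)                             ≡⟨ rearrange p h i c ⟩
    p * i + c + 2 * h * p                                 ∎
    where
    open ≡-Reasoning
    i = ind (l <? h * Θ (suc j))
    c = crossed (suc j) l
    v = λ τ → T (λ m → ind (θ j τ ≤? m)) l
    rearrange : ∀ p h i c → p * (h + i) + (h * p + c) ≡ p * i + c + 2 * h * p
    rearrange = solve-∀
    rearrange′ : ∀ h p c → 2 * h * p + c ≡ h * p + (h * p + c)
    rearrange′ = solve-∀
    ∑-suc-id : ∑ (2 * h) suc ≡ h * p
    ∑-suc-id = trans (sym (∑-suc (2 * h) (λ t → t))) (trans (cong (λ z → ∑ z (λ t → t)) (sym p≡)) triangle)
    -- Each `τ` contributes the constant p - (τ + 1). Over the 2h values of `τ` this sums to 2hp -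
    -- hp = hp.
    swapped : T (crossed j) l ≡ h * p + c
    swapped = trans (∑-swap p (2 * h) _) (+-cancelˡ-≡ (h * p) _ _ (begin
      h * p + ∑ (2 * h) v                                ≡⟨ cong (_+ ∑ (2 * h) v) (sym ∑-suc-id) ⟩
      ∑ (2 * h) suc + ∑ (2 * h) v                        ≡⟨ sym (∑-+ (2 * h) suc v) ⟩
      ∑ (2 * h) (λ τ → suc τ + v τ)                      ≡⟨ ∑-cong (2 * h) (λ τ → T-θ τ j≤ l<q) ⟩
      ∑ (2 * h) (λ τ → p + ind (θ (suc j) τ ≤? l))       ≡⟨ ∑-+ (2 * h) (λ _ → p) _ ⟩
      ∑ (2 * h) (λ _ → p) + c                            ≡⟨ cong (_+ c) (∑-const (2 * h) p) ⟩
      2 * h * p + c                                      ≡⟨ rearrange′ h p c ⟩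
      h * p + (h * p + c)                                ∎))

  Θ-k : Θ k ≡ 0
  Θ-k = trans (cong (λ z → q * σ z) (n∸n≡0 k)) (*-zeroʳ q)

  l≮hΘk : ∀ l → ind (l <? h * Θ k) ≡ 0
  l≮hΘk l = ind-false λ lt → n≮0 (subst (l <_) (trans (cong (h *_) Θ-k) (*-zeroʳ h)) lt)

  -- At `j` = `k` the sum `Θ k` is empty: the first threshold is 0, and all the others equal `q`,
  -- which `l` never reaches.
  E-k : ∀ {l} → l < q → E k l ≡ 0
  E-k {l} l<q = cong₂ _+_ (trans (cong (p *_) (l≮hΘk l)) (*-zeroʳ p))
    (trans (∑-cong (2 * h) λ τ _ → ind-false λ le → <⇒≱ l<q (≤-trans (m≤n+m q (τ * Θ k)) le))
           (trans (∑-const (2 * h) 0) (*-zeroʳ (2 * h))))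

  E-0 : ∀ l → p * ind (l <? h * σ k) + ∑ (2 * h) (λ t → ind (t * σ k <? l)) ≡ E 0 l
  E-0 l = cong₂ _+_ (cong (λ z → p * ind (l <? h * z)) (sym (*-identityˡ (σ k))))
    (∑-cong (2 * h) λ τ _ → ind-cong (λ lt → ≤-trans (≤-reflexive (e τ)) lt) (λ le → ≤-trans (≤-reflexive (sym (e τ))) le))
    where
    e : ∀ τ → θ 0 τ ≡ suc (τ * σ k)
    e τ = trans (+-comm (τ * Θ 0) 1) (cong (λ z → suc (τ * z)) (*-identityˡ (σ k)))

  -- Horner sums

  horner : (ℕ → ℕ) → ℕ → ℕ
  horner a zero    = 0
  horner a (suc e) = p * horner a e + a e

  -- Peels off the oldest term instead of the newest. In the recursion for `X` the earlier terms are
  -- shifted from `j` to `j + 1` by `T`, and the fresh `E 0` arrives with weight p^e.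
  horner-suc : ∀ a e → horner a (suc e) ≡ p ^ e * a 0 + horner (a ∘ suc) e
  horner-suc a zero    = trans (cong (_+ a 0) (*-zeroʳ p)) (rearrange (a 0))
    where
    rearrange : ∀ x → x ≡ x + 0 + 0
    rearrange = solve-∀
  horner-suc a (suc e) = trans (cong (λ z → p * z + a (suc e)) (horner-suc a e))
    (rearrange p (p ^ e) (a 0) (horner (a ∘ suc) e) (a (suc e)))
    where
    rearrange : ∀ p b x y z → p * (b * x + y) + z ≡ p * b * x + (p * y + z)
    rearrange = solve-∀

  -- For fixed `l`, the sequence `E j l` takes at most two values in each of the cases (a)-(e), the
  -- first for `j` < `i`. The excess `c` is weighted by p^n + ... + p^(i+n-1).
  horner-two : ∀ a c d i n → (∀ j → j < i → a j ≡ c + d) → (∀ j → i ≤ j → j < i + n → a j ≡ d) →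
               horner a (i + n) ≡ c * (p ^ n * σ i) + d * σ (i + n)
  horner-two a c d zero zero lo hi = sym (cong₂ _+_ (*-zeroʳ c) (*-zeroʳ d))
  horner-two a c d (suc i) zero lo hi = begin
    p * horner a (i + 0) + a (i + 0)
      ≡⟨ cong₂ (λ x y → p * x + y) (horner-two a c d i zero (λ j j<i → lo j (m<n⇒m<1+n j<i))
           (λ j i≤j j<i → ⊥-elim (<⇒≱ j<i (≤-trans (≤-reflexive (+-identityʳ i)) i≤j)))) (lo (i + 0) (s≤s (≤-reflexive (+-identityʳ i)))) ⟩
    p * (c * (1 * σ i) + d * σ (i + 0)) + (c + d)     ≡⟨ cong (λ z → p * (c * (1 * σ i) + d * σ z) + (c + d)) (+-identityʳ i) ⟩
    p * (c * (1 * σ i) + d * σ i) + (c + d)           ≡⟨ rearrange p c d (σ i) ⟩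
    c * (1 * suc (p * σ i)) + d * suc (p * σ i)       ≡⟨ cong₂ (λ x y → c * (1 * x) + d * y) (sym (σ-suc i))
                                                           (trans (sym (σ-suc i)) (cong σ (sym (+-identityʳ (suc i))))) ⟩
    c * (1 * σ (suc i)) + d * σ (suc i + 0)           ∎
    where
    open ≡-Reasoning
    rearrange : ∀ p c d s → p * (c * (1 * s) + d * s) + (c + d) ≡ c * (1 * suc (p * s)) + d * suc (p * s)
    rearrange = solve-∀
  horner-two a c d i (suc n) lo hi = begin
    horner a (i + suc n)                              ≡⟨ cong (horner a) (+-suc i n) ⟩
    p * horner a (i + n) + a (i + n)
      ≡⟨ cong₂ (λ x y → p * x + y) (horner-two a c d i n lo (λ j i≤j j< → hi j i≤j (<-trans j< last<)))
               (hi (i + n) (m≤m+n i n) last<) ⟩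
    p * (c * (p ^ n * σ i) + d * σ (i + n)) + d       ≡⟨ rearrange p c d (p ^ n) (σ i) (σ (i + n)) ⟩
    c * (p * p ^ n * σ i) + d * suc (p * σ (i + n))   ≡⟨ cong (λ z → c * (p * p ^ n * σ i) + d * z)
                                                           (trans (sym (σ-suc (i + n))) (cong σ (sym (+-suc i n)))) ⟩
    c * (p * p ^ n * σ i) + d * σ (i + suc n)         ∎
    where
    open ≡-Reasoning
    last< : i + n < i + suc n
    last< = ≤-reflexive (sym (+-suc i n))
    rearrange : ∀ p c d b s s′ → p * (c * (b * s) + d * s′) + d ≡ c * (p * b * s) + d * suc (p * s′)
    rearrange = solve-∀

  Φ : ℕ → ℕ → ℕ
  Φ e l = horner (λ j → E j l) e

  T-Φ : ∀ {e l} → e ≤ k → l < q → T (Φ e) l ≡ horner (λ j → E (suc j) l) e + 2 * h * p * σ e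
  T-Φ {zero}  {l} e≤ l<q = trans (∑-const p 0) (trans (*-zeroʳ p) (sym (*-zeroʳ (2 * h * p))))
  T-Φ {suc e} {l} e≤ l<q = begin
    T (Φ (suc e)) l                                     ≡⟨ T-+ (λ m → p * Φ e m) (E e) l ⟩
    T (λ m → p * Φ e m) l + T (E e) l
      ≡⟨ cong₂ _+_ (trans (T-* p (Φ e) l) (cong (p *_) (T-Φ (≤-trans (n≤1+n e) e≤) l<q))) (T-E (s≤s⁻¹ e≤) l<q) ⟩
    p * (Φ′ + 2 * h * p * σ e) + (E (suc e) l + 2 * h * p)   ≡⟨ rearrange p h Φ′ (σ e) (E (suc e) l) ⟩
    p * Φ′ + E (suc e) l + 2 * h * p * suc (p * σ e)    ≡⟨ cong (λ z → p * Φ′ + E (suc e) l + 2 * h * p * z) (sym (σ-suc e)) ⟩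
    p * Φ′ + E (suc e) l + 2 * h * p * σ (suc e)        ∎
    where
    open ≡-Reasoning
    Φ′ = horner (λ j → E (suc j) l) e
    rearrange : ∀ p h x s y → p * (x + 2 * h * p * s) + (y + 2 * h * p) ≡ p * x + y + 2 * h * p * suc (p * s)
    rearrange = solve-∀

  X-suc : ∀ e l → X (suc e) l ≡ T (X e) l + 4 * h * p ^ suc e + 2 * p ^ e * E 0 l
  X-suc e l = cong (λ z → T (X e) l + 4 * h * p ^ suc e + 2 * p ^ e * z) (E-0 l)

  private
    -- Here a = p^e, s = σ e, i is an indicator, and Y and x stand for T (X e) l and E 0 l.
    step₁-arith : ∀ {p a} h s e i Y Φ′ x → p ≡ suc (2 * h) → a ≡ suc (2 * h * s) →
      Y + p * (1 + 2 * p * s) ≡ 2 * suc e * (p * (p * a)) + 2 * (h + i) + 2 * (Φ′ + 2 * h * p * s) →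
      Y + 4 * h * (p * a) + 2 * a * x + (1 + 2 * p * suc (p * s)) ≡
      2 * suc (suc e) * (p * (p * a)) + 2 * i + 2 * (a * x + Φ′)
    -- Matching on both equations replaces `p` and `a` by polynomials in `h` and `s`; the relation
    -- between a power of `p` and a geometric sum is thereby available to the ring solver.
    step₁-arith h s e i Y Φ′ x refl refl eq =
      trans (lhs h s Y x) (trans (cong (_+ (4 * h * (suc (2 * h) * suc (2 * h * s)) + 2 * suc (2 * h * s) * x + suc (suc (2 * h)))) eq)
        (rhs h s e i Φ′ x))
      where
      lhs : ∀ h s Y x → Y + 4 * h * (suc (2 * h) * suc (2 * h * s)) + 2 * suc (2 * h * s) * x + (1 + 2 * suc (2 * h) * suc (suc (2 * h) * s)) ≡
            Y + suc (2 * h) * (1 + 2 * suc (2 * h) * s) + (4 * h * (suc (2 * h) * suc (2 * h * s)) + 2 * suc (2 * h * s) * x + suc (suc (2 * h)))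
      lhs = solve-∀
      rhs : ∀ h s e i Φ′ x →
            2 * suc e * (suc (2 * h) * (suc (2 * h) * suc (2 * h * s))) + 2 * (h + i) + 2 * (Φ′ + 2 * h * suc (2 * h) * s)
              + (4 * h * (suc (2 * h) * suc (2 * h * s)) + 2 * suc (2 * h * s) * x + suc (suc (2 * h))) ≡
            2 * suc (suc e) * (suc (2 * h) * (suc (2 * h) * suc (2 * h * s))) + 2 * i + 2 * (suc (2 * h * s) * x + Φ′)
      rhs = solve-∀

    -- Here a = p^k, s = σ k and b = p^f.
    step₂-arith : ∀ {p a} h s b k f Y Φ′ x → p ≡ suc (2 * h) → a ≡ suc (2 * h * s) →
      Y + p * (b * (2 * f + 1 + 2 * p * s)) ≡ b * (2 * suc (k + f) * (p * (p * a)) + 2 * (Φ′ + 2 * h * p * s)) →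
      Y + 4 * h * (p * (b * a)) + 2 * (b * a) * x + p * b * (2 * suc f + 1 + 2 * p * s) ≡
      b * (2 * suc (k + suc f) * (p * (p * a)) + 2 * (a * x + Φ′))
    step₂-arith h s b k f Y Φ′ x refl refl eq =
      trans (lhs h s b f Y x) (trans (cong (_+ (4 * h * (suc (2 * h) * (b * suc (2 * h * s))) + 2 * (b * suc (2 * h * s)) * x + 2 * (suc (2 * h) * b))) eq)
        (rhs h s b k f Φ′ x))
      where
      lhs : ∀ h s b f Y x → Y + 4 * h * (suc (2 * h) * (b * suc (2 * h * s))) + 2 * (b * suc (2 * h * s)) * x + suc (2 * h) * b * (2 * suc f + 1 + 2 * suc (2 * h) * s) ≡
            Y + suc (2 * h) * (b * (2 * f + 1 + 2 * suc (2 * h) * s)) + (4 * h * (suc (2 * h) * (b * suc (2 * h * s))) + 2 * (b * suc (2 * h * s)) * x + 2 * (suc (2 * h) * b))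
      lhs = solve-∀
      rhs : ∀ h s b k f Φ′ x →
            b * (2 * suc (k + f) * (suc (2 * h) * (suc (2 * h) * suc (2 * h * s))) + 2 * (Φ′ + 2 * h * suc (2 * h) * s))
              + (4 * h * (suc (2 * h) * (b * suc (2 * h * s))) + 2 * (b * suc (2 * h * s)) * x + 2 * (suc (2 * h) * b)) ≡
            b * (2 * suc (k + suc f) * (suc (2 * h) * (suc (2 * h) * suc (2 * h * s))) + 2 * (suc (2 * h * s) * x + Φ′))
      rhs = solve-∀

  -- In this range the indicator from the base case is still alive: each `T` moves its threshold
  -- from `Θ e` to `Θ (suc e)`.
  X-low : ∀ e {l} → e ≤ k → l < q →
          X e l + (1 + 2 * p * σ e) ≡ 2 * suc e * p ^ suc e + 2 * ind (l <? h * Θ e) + 2 * Φ e l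
  X-low zero {l} _ _ = trans (cong (λ i → p + 2 * h + 2 * ind (l <? h * i) + (1 + 2 * p * 0)) (sym (*-identityˡ (σ k))))
    (base p h (ind (l <? h * Θ 0)) p≡)
    where
    e₀ : ∀ h i → suc (2 * h) + 2 * h + 2 * i + (1 + 2 * suc (2 * h) * 0) ≡ 2 * 1 * (suc (2 * h) * 1) + 2 * i + 2 * 0
    e₀ = solve-∀
    base : ∀ p h i → p ≡ suc (2 * h) → p + 2 * h + 2 * i + (1 + 2 * p * 0) ≡ 2 * 1 * (p * 1) + 2 * i + 2 * 0
    base p h i refl = e₀ h i
  X-low (suc e) {l} e<k l<q = begin
    X (suc e) l + (1 + 2 * p * σ (suc e))
      ≡⟨ cong₂ (λ x s → x + (1 + 2 * p * s)) (X-suc e l) (σ-suc e) ⟩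
    T (X e) l + 4 * h * p ^ suc e + 2 * p ^ e * E 0 l + (1 + 2 * p * suc (p * σ e))
      ≡⟨ step₁-arith h (σ e) e i (T (X e) l) Φ′ (E 0 l) p≡ (p^≡ e) T-eq ⟩
    2 * suc (suc e) * p ^ suc (suc e) + 2 * i + 2 * (p ^ e * E 0 l + Φ′)
      ≡⟨ cong (λ z → 2 * suc (suc e) * p ^ suc (suc e) + 2 * i + 2 * z) (sym (horner-suc (λ j → E j l) e)) ⟩
    2 * suc (suc e) * p ^ suc (suc e) + 2 * i + 2 * Φ (suc e) l ∎
    where
    open ≡-Reasoning
    i = ind (l <? h * Θ (suc e))
    Φ′ = horner (λ j → E (suc j) l) e
    e≤k = ≤-trans (n≤1+n e) e<k
    T-eq : T (X e) l + p * (1 + 2 * p * σ e) ≡ 2 * suc e * (p * p ^ suc e) + 2 * (h + i) + 2 * (Φ′ + 2 * h * p * σ e)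
    T-eq = begin
      T (X e) l + p * (1 + 2 * p * σ e)
        ≡⟨ trans (cong (T (X e) l +_) (sym (∑-const p _))) (sym (T-+ (X e) (λ _ → 1 + 2 * p * σ e) l)) ⟩
      T (λ m → X e m + (1 + 2 * p * σ e)) l
        ≡⟨ T-cong l l<q (λ m m<q → X-low e e≤k m<q) ⟩
      T (λ m → 2 * suc e * p ^ suc e + 2 * ind (m <? h * Θ e) + 2 * Φ e m) l
        ≡⟨ trans (T-+ (λ m → 2 * suc e * p ^ suc e + 2 * ind (m <? h * Θ e)) (λ m → 2 * Φ e m) l)
             (cong₂ _+_ (T-+ (λ _ → 2 * suc e * p ^ suc e) (λ m → 2 * ind (m <? h * Θ e)) l) (T-* 2 (Φ e) l)) ⟩
      T (λ m → 2 * suc e * p ^ suc e) l + T (λ m → 2 * ind (m <? h * Θ e)) l + 2 * T (Φ e) l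
        ≡⟨ cong₂ _+_ (cong₂ _+_ (trans (∑-const p _) (swap p (2 * suc e) (p ^ suc e)))
                                (trans (T-* 2 (λ m → ind (m <? h * Θ e)) l) (cong (2 *_) (T-ind (s≤s⁻¹ e<k) l<q))))
                     (cong (2 *_) (T-Φ e≤k l<q)) ⟩
      2 * suc e * (p * p ^ suc e) + 2 * (h + i) + 2 * (Φ′ + 2 * h * p * σ e) ∎
      where
      swap : ∀ a b c → a * (b * c) ≡ b * (a * c)
      swap = solve-∀

  X-high : ∀ f {l} → l < q →
           X (f + k) l + p ^ f * (2 * f + 1 + 2 * p * σ k) ≡ p ^ f * (2 * suc (k + f) * p ^ suc k + 2 * Φ k l)
  X-high zero {l} l<q = begin
    X k l + (1 + 2 * p * σ k + 0)                                     ≡⟨ cong (X k l +_) (+-identityʳ _) ⟩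
    X k l + (1 + 2 * p * σ k)                                         ≡⟨ X-low k ≤-refl l<q ⟩
    2 * suc k * p ^ suc k + 2 * ind (l <? h * Θ k) + 2 * Φ k l        ≡⟨ cong (λ z → 2 * suc k * p ^ suc k + 2 * z + 2 * Φ k l) (l≮hΘk l) ⟩
    2 * suc k * p ^ suc k + 0 + 2 * Φ k l                             ≡⟨ cong (_+ 2 * Φ k l) (+-identityʳ (2 * suc k * p ^ suc k)) ⟩
    2 * suc k * p ^ suc k + 2 * Φ k l                                 ≡⟨ cong (λ z → 2 * suc z * p ^ suc k + 2 * Φ k l) (sym (+-identityʳ k)) ⟩
    2 * suc (k + 0) * p ^ suc k + 2 * Φ k l                           ≡⟨ sym (*-identityˡ _) ⟩
    1 * (2 * suc (k + 0) * p ^ suc k + 2 * Φ k l)                     ∎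
    where open ≡-Reasoning
  X-high (suc f) {l} l<q = begin
    X (suc f + k) l + p ^ suc f * (2 * suc f + 1 + 2 * p * σ k)
      ≡⟨ cong (_+ p ^ suc f * (2 * suc f + 1 + 2 * p * σ k)) (trans (X-suc (f + k) l)
           (cong (λ z → T (X (f + k)) l + 4 * h * (p * z) + 2 * z * E 0 l) (^-distribˡ-+-* p f k))) ⟩
    T (X (f + k)) l + 4 * h * (p * (p ^ f * p ^ k)) + 2 * (p ^ f * p ^ k) * E 0 l + p ^ suc f * (2 * suc f + 1 + 2 * p * σ k)
      ≡⟨ step₂-arith h (σ k) (p ^ f) k f (T (X (f + k)) l) Φ′ (E 0 l) p≡ (p^≡ k) T-eq ⟩
    p ^ f * (2 * suc (k + suc f) * (p * (p * p ^ k)) + 2 * (p ^ k * E 0 l + Φ′))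
      -- Read backwards, `horner-suc` gives `Φ (suc k)`. Its newest term `E k` vanishes, so only
      -- `p * Φ k` is left: the dependence on `l` is just rescaled.
      ≡⟨ cong (λ z → p ^ f * (2 * suc (k + suc f) * (p * (p * p ^ k)) + 2 * z)) (trans (sym (horner-suc (λ j → E j l) k))
           (trans (cong (p * Φ k l +_) (E-k l<q)) (+-identityʳ _))) ⟩
    p ^ f * (2 * suc (k + suc f) * (p * (p * p ^ k)) + 2 * (p * Φ k l))
      ≡⟨ factor p (p ^ f) (suc (k + suc f)) (p * p ^ k) (Φ k l) ⟩
    p ^ suc f * (2 * suc (k + suc f) * p ^ suc k + 2 * Φ k l) ∎
    where
    open ≡-Reasoning
    Φ′ = horner (λ j → E (suc j) l) k
    factor : ∀ p b n a x → b * (2 * n * (p * a) + 2 * (p * x)) ≡ p * b * (2 * n * a + 2 * x)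
    factor = solve-∀
    factor′ : ∀ p b n a t → b * (p * (n * a) + t) ≡ b * (n * (p * a) + t)
    factor′ = solve-∀
    T-eq : T (X (f + k)) l + p * (p ^ f * (2 * f + 1 + 2 * p * σ k)) ≡
           p ^ f * (2 * suc (k + f) * (p * (p * p ^ k)) + 2 * (Φ′ + 2 * h * p * σ k))
    T-eq = begin
      T (X (f + k)) l + p * c
        ≡⟨ trans (cong (T (X (f + k)) l +_) (sym (∑-const p c))) (sym (T-+ (X (f + k)) (λ _ → c) l)) ⟩
      T (λ m → X (f + k) m + c) l
        ≡⟨ T-cong l l<q (λ m m<q → X-high f m<q) ⟩
      T (λ m → p ^ f * (2 * suc (k + f) * p ^ suc k + 2 * Φ k m)) l
        ≡⟨ trans (T-* (p ^ f) (λ m → 2 * suc (k + f) * p ^ suc k + 2 * Φ k m) l) (cong (p ^ f *_) (trans (T-+ (λ _ → 2 * suc (k + f) * p ^ suc k) (λ m → 2 * Φ k m) l)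
             (cong₂ _+_ (∑-const p _) (trans (T-* 2 (Φ k) l) (cong (2 *_) (T-Φ ≤-refl l<q)))))) ⟩
      p ^ f * (p * (2 * suc (k + f) * p ^ suc k) + 2 * (Φ′ + 2 * h * p * σ k))
        ≡⟨ factor′ p (p ^ f) (2 * suc (k + f)) (p ^ suc k) _ ⟩
      p ^ f * (2 * suc (k + f) * (p * p ^ suc k) + 2 * (Φ′ + 2 * h * p * σ k)) ∎
      where c = p ^ f * (2 * f + 1 + 2 * p * σ k)

odd≡1+2* : ∀ {p} → 2 ∤ p → p ≡ suc (2 * (p / 2))
odd≡1+2* {p} odd = trans (m≡m%n+[m/n]*n p 2) (cong₂ _+_ (remainder (p % 2) (m%n<n p 2) (odd ∘ m%n≡0⇒n∣m p 2)) (*-comm (p / 2) 2))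
  where
  remainder : ∀ r → r < 2 → r ≢ 0 → r ≡ 1
  remainder 0 _ r≢0 = ⊥-elim (r≢0 refl)
  remainder 1 _ _   = refl
  remainder (suc (suc _)) (s≤s (s≤s ())) _

sum-applyUpTo : ∀ f n → sum (applyUpTo f n) ≡ ∑ n f
sum-applyUpTo f zero    = refl
sum-applyUpTo f (suc n) = trans (cong (λ z → f 0 + z) (sum-applyUpTo (f ∘ suc) n)) (sym (∑-suc n f))

≤∸1⇒< : ∀ {l m} → 0 < m → l ≤ m ∸ 1 → l < m
≤∸1⇒< {m = suc _} _ l≤ = s≤s l≤

steps : ∀ {R : ℕ → ℕ → Set} → (∀ x → R x x) → (∀ {x y z} → R x y → R y z → R x z) →
        ∀ (f : ℕ → ℕ) n → (∀ j → j < n → R (f j) (f (suc j))) → ∀ {i j} → i ≤ j → j ≤ n → R (f i) (f j)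
steps R-refl R-trans f n step {zero}  {zero}  _   _   = R-refl _
steps R-refl R-trans f n step {i}     {suc j} i≤j j≤n with m≤n⇒m<n∨m≡n i≤j
... | inj₁ (s≤s i≤j′) = R-trans (steps R-refl R-trans f n step i≤j′ (<⇒≤ j≤n)) (step j j≤n)
... | inj₂ refl       = R-refl _

-- The Horner sum on the intervals between consecutive thresholds

module Values (h p k′ : ℕ) (p≡ : p ≡ suc (2 * h)) (p-prime : Prime p) (p-odd : 2 ∤ p) where

  open ClosedForm h p k′ p≡ p-prime p-odd public

  powerSum-∑ : ∀ a b → powerSum p a b ≡ p ^ a * σ (suc b ∸ a)
  powerSum-∑ a b = trans (sum-applyUpTo (λ j → p ^ (a + j)) (suc b ∸ a))
    (trans (∑-cong (suc b ∸ a) (λ j _ → ^-distribˡ-+-* p a j)) (∑-* (suc b ∸ a) (p ^ a) (p ^_)))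

  powerSum-σ : ∀ b → powerSum p 0 b ≡ σ (suc b)
  powerSum-σ b = trans (powerSum-∑ 0 b) (*-identityˡ (σ (suc b)))

  σ-+ : ∀ i n → p ^ n * σ i + σ n ≡ σ (i + n)
  σ-+ i n = trans (+-comm _ (σ n)) (trans (cong (σ n +_)
    (trans (sym (∑-* i (p ^ n) (p ^_))) (∑-cong i λ j _ → sym (^-distribˡ-+-* p n j))))
    (trans (sym (∑-++ n i (p ^_))) (cong σ (+-comm n i))))

  Θ-suc : ∀ {j} → j ≤ k′ → Θ j ≡ Θ (suc j) + p ^ j
  Θ-suc {j} j≤ = trans (cong (λ z → p ^ j * z) (trans (cong σ (k∸ j≤)) (σ-suc (k′ ∸ j)))) (e p (p ^ j) (σ (k′ ∸ j)))
    where
    e : ∀ p a s → a * suc (p * s) ≡ p * a * s + a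
    e = solve-∀

  Θ-anti : ∀ {i j} → i ≤ j → j ≤ k → Θ j ≤ Θ i
  Θ-anti = steps {R = _≥_} (λ _ → ≤-refl) (λ x≥y y≥z → ≤-trans y≥z x≥y) Θ k
    (λ j j<k → ≤-trans (m≤m+n _ (p ^ j)) (≤-reflexive (sym (Θ-suc (s≤s⁻¹ j<k)))))

  q′≤Θ : ∀ {j} → j ≤ k′ → q′ ≤ Θ j
  q′≤Θ j≤ = ≤-trans (m≤n+m q′ _) (≤-reflexive (sym (Θ-q′ j≤)))

  -- Although `Θ` decreases, `θ` increases with `j`: one step replaces τ + 1 copies of p^j by `p`
  -- copies.
  θ-mono : ∀ {i j τ} → τ < p → i ≤ j → j ≤ k → θ i τ ≤ θ j τ
  θ-mono {τ = τ} τ<p = steps {R = _≤_} (λ _ → ≤-refl) ≤-trans (λ j → θ j τ) k λ j j<k → begin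
    τ * Θ j + p ^ j                      ≡⟨ cong (λ z → τ * z + p ^ j) (Θ-suc (s≤s⁻¹ j<k)) ⟩
    τ * (Θ (suc j) + p ^ j) + p ^ j      ≡⟨ e τ (Θ (suc j)) (p ^ j) ⟩
    τ * Θ (suc j) + suc τ * p ^ j        ≤⟨ +-monoʳ-≤ (τ * Θ (suc j)) (*-monoˡ-≤ (p ^ j) τ<p) ⟩
    τ * Θ (suc j) + p * p ^ j            ∎
    where
    open ≤-Reasoning
    e : ∀ τ a b → τ * (a + b) + b ≡ τ * a + suc τ * b
    e = solve-∀

  θ-monoʳ : ∀ j {τ τ′} → τ ≤ τ′ → θ j τ ≤ θ j τ′
  θ-monoʳ j τ≤ = +-monoˡ-≤ (p ^ j) (*-monoˡ-≤ (Θ j) τ≤)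

  -- Together with `*q′<θ` this locates all thresholds with index `τ` and `j` ≤ `k′` above `τ * q′`
  -- and not above `suc τ * q′`. So thresholds of different `τ` do not interleave.
  θ≤ : ∀ {j τ} → τ < p → j ≤ k′ → θ j τ ≤ suc τ * q′
  θ≤ {j} {τ} τ<p j≤ = ≤-trans (θ-mono τ<p j≤ (n≤1+n k′)) (≤-reflexive (trans (cong (λ z → τ * z + q′) Θ-k′) (+-comm _ q′)))
    where
    Θ-k′ : Θ k′ ≡ q′
    Θ-k′ = trans (cong (λ z → q′ * σ z) (trans (k∸ (≤-refl {k′})) (cong suc (n∸n≡0 k′)))) (*-identityʳ q′)

  *q′<θ : ∀ {j} τ → j ≤ k′ → τ * q′ < θ j τ
  *q′<θ {j} τ j≤ = ≤-<-trans (*-monoʳ-≤ τ (q′≤Θ j≤)) (m<m+n (τ * Θ j) (0<p^ j))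

  count : ∀ j {c l} → c ≤ 2 * h → (∀ τ → τ < c → θ j τ ≤ l) → l < θ j c → crossed j l ≡ c
  count j {c} c≤ lo hi = ∑-initial (2 * h) c _ c≤ (λ τ τ<c → ind-true (lo τ τ<c))
    (λ τ c≤τ _ → ind-false (<⇒≱ (<-≤-trans hi (θ-monoʳ j c≤τ))))

  E-below : ∀ j {l c} → l < h * Θ j → crossed j l ≡ c → E j l ≡ p + c
  E-below j l< eq = cong₂ _+_ (trans (cong (p *_) (ind-true l<)) (*-identityʳ p)) eq

  E-above : ∀ j {l c} → h * Θ j ≤ l → crossed j l ≡ c → E j l ≡ c
  E-above j ≤l eq = cong₂ _+_ (trans (cong (p *_) (ind-false (≤⇒≯ ≤l))) (*-zeroʳ p)) eq

  τ<p : ∀ {τ c} → τ < c → c ≤ 2 * h → τ < p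
  τ<p τ<c c≤ = <-trans (<-≤-trans τ<c c≤) 2h<p

  -- In this range of l the number of crossed thresholds does not depend on j.
  count-full : ∀ {j t l} → j ≤ k′ → t ≤ 2 * h → t * q′ ≤ l → l ≤ t * Θ 0 → crossed j l ≡ t
  count-full {j} {t} j≤ t≤ ≤l l≤ = count j t≤
    (λ τ τ<t → ≤-trans (θ≤ (τ<p τ<t t≤) j≤) (≤-trans (*-monoˡ-≤ q′ τ<t) ≤l))
    (<-≤-trans (≤-<-trans l≤ (m<m+n _ (0<p^ 0))) (θ-mono (≤-<-trans t≤ 2h<p) z≤n (m≤n⇒m≤1+n j≤)))

  hΘ≤ : ∀ {j t l} → j ≤ k′ → h < t → t * q′ ≤ l → h * Θ j ≤ l
  hΘ≤ {j} j≤ h<t ≤l = ≤-trans (*-monoʳ-≤ h (Θ-anti z≤n (m≤n⇒m≤1+n j≤))) (≤-trans (m≤m+n _ (p ^ 0))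
    (≤-trans (θ≤ h<p z≤n) (≤-trans (*-monoˡ-≤ q′ h<t) ≤l)))

  Φ-const : ∀ {l c} → (∀ j → j ≤ k′ → E j l ≡ c) → Φ k l ≡ c * σ k
  Φ-const {l} {c} eq = horner-two (λ j → E j l) 0 c 0 k (λ _ ()) (λ j _ j<k → eq j (s≤s⁻¹ j<k))

  0<hΘ : ∀ {j} → j ≤ k′ → 0 < h * Θ j
  0<hΘ j≤ = *-mono-≤ 0<h (≤-trans 0<q′ (q′≤Θ j≤))

  -- No `θ` is crossed and `l` lies below every `h * Θ j` with `j` < `k`. This value is the
  -- reference point: it corresponds to c_s A_s without correction.
  Φ-a : Φ k 0 ≡ p * σ k
  Φ-a = Φ-const λ j j≤ → trans (E-below j (0<hΘ j≤) (count j z≤n (λ _ ()) (0<p^ j))) (+-identityʳ p)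

  module CaseB {l i d : ℕ} (d<2h : d < 2 * h) (i<k′ : i < k′) (≤l : θ i d ≤ l) (l< : l < θ (suc i) d) where

    d<p : d < p
    d<p = <-trans d<2h 2h<p

    l<′ : l < suc d * q′
    l<′ = <-≤-trans l< (θ≤ d<p i<k′)

    count-low : ∀ {j} → j < suc i → crossed j l ≡ suc d
    count-low {j} (s≤s j≤i) = count j d<2h
      (λ τ τ<d → ≤-trans (θ-monoʳ j (s≤s⁻¹ τ<d)) (≤-trans (θ-mono d<p j≤i (≤-trans (<⇒≤ i<k′) (n≤1+n k′))) ≤l))
      (<-trans l<′ (*q′<θ {j} (suc d) (≤-trans j≤i (<⇒≤ i<k′))))

    count-high : ∀ {j} → suc i ≤ j → j ≤ k′ → crossed j l ≡ d
    count-high {j} i<j j≤ = count j (<⇒≤ d<2h)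
      (λ τ τ<d → ≤-trans (θ≤ (<-trans τ<d d<p) j≤) (≤-trans (*-monoˡ-≤ q′ τ<d)
        (≤-trans (<⇒≤ (*q′<θ d (<⇒≤ i<k′))) ≤l)))
      (<-≤-trans l< (θ-mono d<p i<j (m≤n⇒m≤1+n j≤)))

    -- Here `d` is t - 1, and `l` lies between the `d`-th thresholds for `i` and `i + 1`: it crosses
    -- d + 1 thresholds for `j` ≤ `i` and only `d` for larger `j`. The missing units have total
    -- weight `σ (k′ ∸ i)`. The parameter `a` is `p` or 0, according to the side of `h * Θ j`.
    Φ-b : ∀ a → (∀ j {c} → j ≤ k′ → crossed j l ≡ c → E j l ≡ a + c) →
          Φ k l + σ (k′ ∸ i) ≡ a * σ k + suc d * σ k
    Φ-b a eq = begin
      Φ k l + σ n                                                  ≡⟨ cong (λ z → Φ z l + σ n) (sym k≡) ⟩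
      Φ (suc i + n) l + σ n                                        ≡⟨ cong (_+ σ n) (horner-two (λ j → E j l) 1 (a + d) (suc i) n
                                                                        (λ j j<i → trans (eq j (≤-trans (s≤s⁻¹ j<i) (<⇒≤ i<k′)) (count-low j<i)) (+-suc a d))
                                                                        (λ j i<j j<k → let j≤ = s≤s⁻¹ (subst (j <_) k≡ j<k) in eq j j≤ (count-high i<j j≤))) ⟩
      1 * (p ^ n * σ (suc i)) + (a + d) * σ (suc i + n) + σ n      ≡⟨ e (p ^ n * σ (suc i)) (σ n) a d (σ (suc i + n)) ⟩
      (p ^ n * σ (suc i) + σ n) + (a * σ (suc i + n) + d * σ (suc i + n))
        ≡⟨ cong₂ _+_ (σ-+ (suc i) n) refl ⟩
      σ (suc i + n) + (a * σ (suc i + n) + d * σ (suc i + n))      ≡⟨ cong (λ z → σ z + (a * σ z + d * σ z)) k≡ ⟩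
      σ k + (a * σ k + d * σ k)                                    ≡⟨ e′ (σ k) a d ⟩
      a * σ k + suc d * σ k                                        ∎
      where
      open ≡-Reasoning
      n = k′ ∸ i
      k≡ : suc i + n ≡ k
      k≡ = cong suc (m+[n∸m]≡n (<⇒≤ i<k′))
      e : ∀ x y a d s → 1 * x + (a + d) * s + y ≡ (x + y) + (a * s + d * s)
      e = solve-∀
      e′ : ∀ s a d → s + (a * s + d * s) ≡ a * s + suc d * s
      e′ = solve-∀

    Φ-b₁ : suc d ≤ h → Φ k l + σ (k′ ∸ i) ≡ p * σ k + suc d * σ k
    Φ-b₁ d<h = Φ-b p λ j j≤ → E-below j (<-≤-trans l<′ (*-mono-≤ d<h (q′≤Θ j≤)))

    Φ-b₂ : h ≤ d → Φ k l + σ (k′ ∸ i) ≡ suc d * σ k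
    Φ-b₂ h≤d = Φ-b 0 λ j j≤ → E-above j (≤-trans (*-mono-≤ h≤d (Θ-anti z≤n (m≤n⇒m≤1+n j≤)))
      (≤-trans (m≤m+n _ (p ^ 0)) (≤-trans (θ-mono d<p z≤n (≤-trans (<⇒≤ i<k′) (n≤1+n k′))) ≤l)))

  Φ-c₁ : ∀ {l t} → suc t ≤ h → t * q′ ≤ l → l ≤ t * Θ 0 → Φ k l ≡ p * σ k + t * σ k
  Φ-c₁ {l} {t} t<h ≤l l≤ = trans (Φ-const λ j j≤ → E-below j (l<hΘ j≤) (count-full {j} j≤ t≤ ≤l l≤)) (*-distribʳ-+ (σ k) p t)
    where
    t≤ : t ≤ 2 * h
    t≤ = ≤-trans (<⇒≤ t<h) (m≤n*m h 2)
    l<hΘ : ∀ {j} → j ≤ k′ → l < h * Θ j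
    l<hΘ j≤ = <-≤-trans (≤-<-trans l≤ (m<m+n _ (0<p^ 0))) (≤-trans (θ≤ (≤-<-trans t≤ 2h<p) z≤n) (*-mono-≤ t<h (q′≤Θ j≤)))

  Φ-c₂ : ∀ {l t} → h < t → t ≤ 2 * h → t * q′ ≤ l → l ≤ t * Θ 0 → Φ k l ≡ t * σ k
  Φ-c₂ h<t t≤ ≤l l≤ = Φ-const λ j j≤ → E-above j (hΘ≤ {j} j≤ h<t ≤l) (count-full {j} j≤ t≤ ≤l l≤)

  -- In this range `h` thresholds are crossed for every `j`, but `h * Θ j` decreases through `l`:
  -- the indicator worth `p` is on for `j` ≤ `i` and off afterwards. This is the value t = (p - 1)/2
  -- left out in (c).
  Φ-d : ∀ {l i} → suc i ≤ k′ → h * Θ (suc i) ≤ l → l < h * Θ i → Φ k l ≡ p * (p ^ (k′ ∸ i) * σ (suc i)) + h * σ k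
  Φ-d {l} {i} i<k′ ≤l l< = begin
    Φ k l                                                         ≡⟨ cong (λ z → Φ z l) (sym k≡) ⟩
    Φ (suc i + n) l                                               ≡⟨ horner-two (λ j → E j l) p h (suc i) n
      (λ j j<i → E-below j (<-≤-trans l< (*-monoʳ-≤ h (Θ-anti (s≤s⁻¹ j<i) (m≤n⇒m≤1+n (<⇒≤ i<k′))))) (full (≤-trans (<⇒≤ j<i) i<k′)))
      (λ j i<j j<k → let j<k′ = subst (j <_) k≡ j<k in E-above j (≤-trans (*-monoʳ-≤ h (Θ-anti i<j (<⇒≤ j<k′))) ≤l) (full (s≤s⁻¹ j<k′))) ⟩
    p * (p ^ n * σ (suc i)) + h * σ (suc i + n)                   ≡⟨ cong (λ z → p * (p ^ n * σ (suc i)) + h * σ z) k≡ ⟩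
    p * (p ^ n * σ (suc i)) + h * σ k                             ∎
    where
    open ≡-Reasoning
    n = k′ ∸ i
    k≡ : suc i + n ≡ k
    k≡ = cong suc (m+[n∸m]≡n (<⇒≤ i<k′))
    full : ∀ {j} → j ≤ k′ → crossed j l ≡ h
    full {j} j≤ = count-full {j} j≤ (m≤n*m h 2) (≤-trans (*-monoʳ-≤ h (q′≤Θ i<k′)) ≤l)
      (≤-trans (<⇒≤ l<) (*-monoʳ-≤ h (Θ-anti z≤n (m≤n⇒m≤1+n (<⇒≤ i<k′)))))

  Φ-e : Φ k (h * Θ 0) ≡ h * σ k
  Φ-e = Φ-const λ j j≤ → E-above j (*-monoʳ-≤ h (Θ-anti z≤n (m≤n⇒m≤1+n j≤)))
    (count-full {j} j≤ (m≤n*m h 2) (*-monoʳ-≤ h (q′≤Θ z≤n)) ≤-refl)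

-- Passage to the integers and to the constants c_s and A_s

open import Data.Integer as ℤ using (ℤ; +_)
import Data.Integer.Properties as ℤᴾ
import Data.Integer.Tactic.RingSolver as ℤ-Solver

-- With P = p^f and Q = p^(k+1).
from-ℕ : ∀ (X P f p s Φ k Q D : ℤ) →
  X ℤ.+ P ℤ.* (+ 2 ℤ.* f ℤ.+ + 1 ℤ.+ + 2 ℤ.* p ℤ.* s) ≡ P ℤ.* (+ 2 ℤ.* (+ 1 ℤ.+ (k ℤ.+ f)) ℤ.* Q ℤ.+ + 2 ℤ.* Φ) →
  + 2 ℤ.* Φ ≡ D ℤ.+ + 2 ℤ.* (p ℤ.* s) →
  X ≡ P ℤ.* (+ 2 ℤ.* ((+ 2 ℤ.+ (f ℤ.+ k)) ℤ.- + 1) ℤ.* Q ℤ.- + 2 ℤ.* ((+ 2 ℤ.+ (f ℤ.+ k)) ℤ.- k) ℤ.+ + 3 ℤ.+ D)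
from-ℕ X P f p s Φ k Q D eq 2Φ = begin
  X                                                              ≡⟨ e₁ X (P ℤ.* Y) ⟩
  (X ℤ.+ P ℤ.* Y) ℤ.- P ℤ.* Y                                            ≡⟨ cong (ℤ._- P ℤ.* Y) eq ⟩
  P ℤ.* (+ 2 ℤ.* (+ 1 ℤ.+ (k ℤ.+ f)) ℤ.* Q ℤ.+ + 2 ℤ.* Φ) ℤ.- P ℤ.* Y              ≡⟨ cong (λ z → P ℤ.* (+ 2 ℤ.* (+ 1 ℤ.+ (k ℤ.+ f)) ℤ.* Q ℤ.+ z) ℤ.- P ℤ.* Y) 2Φ ⟩
  P ℤ.* (+ 2 ℤ.* (+ 1 ℤ.+ (k ℤ.+ f)) ℤ.* Q ℤ.+ (D ℤ.+ + 2 ℤ.* (p ℤ.* s))) ℤ.- P ℤ.* Y  ≡⟨ e₂ P f p s k Q D ⟩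
  P ℤ.* (+ 2 ℤ.* ((+ 2 ℤ.+ (f ℤ.+ k)) ℤ.- + 1) ℤ.* Q ℤ.- + 2 ℤ.* ((+ 2 ℤ.+ (f ℤ.+ k)) ℤ.- k) ℤ.+ + 3 ℤ.+ D) ∎
  where
  open ≡-Reasoning
  Y = + 2 ℤ.* f ℤ.+ + 1 ℤ.+ + 2 ℤ.* p ℤ.* s
  e₁ : ∀ X Y → X ≡ (X ℤ.+ Y) ℤ.- Y
  e₁ = ℤ-Solver.solve-∀
  e₂ : ∀ P f p s k Q D →
       P ℤ.* (+ 2 ℤ.* (+ 1 ℤ.+ (k ℤ.+ f)) ℤ.* Q ℤ.+ (D ℤ.+ + 2 ℤ.* (p ℤ.* s))) ℤ.- P ℤ.* (+ 2 ℤ.* f ℤ.+ + 1 ℤ.+ + 2 ℤ.* p ℤ.* s) ≡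
       P ℤ.* (+ 2 ℤ.* ((+ 2 ℤ.+ (f ℤ.+ k)) ℤ.- + 1) ℤ.* Q ℤ.- + 2 ℤ.* ((+ 2 ℤ.+ (f ℤ.+ k)) ℤ.- k) ℤ.+ + 3 ℤ.+ D)
  e₂ = ℤ-Solver.solve-∀

module Main (h p k′ : ℕ) (p≡ : p ≡ suc (2 * h)) (p-prime : Prime p) (p-odd : 2 ∤ p)
            (f s : ℕ) .(1≤s : 1 ≤ s) (s≡ : s ≡ suc (suc (f + suc k′))) (l : Fin (p ^ suc k′)) where

  open Values h p k′ p≡ p-prime p-odd

  M A c : ℤ
  M = + 𝓜 (V s 1≤s l)
  A = A[ p , k , s ]
  c = c[ p , k , s ]

  -- The vertex V_s belongs to `X` at s - 2 = f + k. The variable `s` is quantified anew so that the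
  -- equation can be matched with `refl`.
  𝓜≡ : ∀ s .(1≤s : 1 ≤ s) → s ≡ suc (suc (f + k)) → 𝓜 (V s 1≤s l) ≡ h * X (f + k) (toℕ l)
  𝓜≡ _ _ refl = 𝓜V≡X (f + k) l

  c≡ : c ≡ + (h * p ^ f)
  c≡ = cong (λ z → + z) (trans (cong (_/ 2) (trans (cong₂ (λ e r → p ^ e * r) exponent p∸1) (e (p ^ f) h))) (m*n/n≡m (h * p ^ f) 2))
    where
    exponent : s ∸ 2 ∸ k ≡ f
    exponent = trans (cong (λ z → z ∸ 2 ∸ k) s≡) (m+n∸n≡m f k)
    e : ∀ a h → a * (2 * h) ≡ h * a * 2
    e = solve-∀

  A≡ : ∀ s → s ≡ suc (suc (f + k)) → A[ p , k , s ] ≡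
       + 2 ℤ.* ((+ 2 ℤ.+ (+ f ℤ.+ + k)) ℤ.- + 1) ℤ.* + (p ^ suc k) ℤ.- + 2 ℤ.* ((+ 2 ℤ.+ (+ f ℤ.+ + k)) ℤ.- + k) ℤ.+ + 3
  A≡ _ refl = cong (λ e → + 2 ℤ.* ((+ 2 ℤ.+ (+ f ℤ.+ + k)) ℤ.- + 1) ℤ.* + (p ^ e) ℤ.- + 2 ℤ.* ((+ 2 ℤ.+ (+ f ℤ.+ + k)) ℤ.- + k) ℤ.+ + 3) (+-comm k 1)

  X-ℤ : + X (f + k) (toℕ l) ℤ.+ + (p ^ f) ℤ.* (+ 2 ℤ.* + f ℤ.+ + 1 ℤ.+ + 2 ℤ.* + p ℤ.* + σ k) ≡
        + (p ^ f) ℤ.* (+ 2 ℤ.* (+ 1 ℤ.+ (+ k ℤ.+ + f)) ℤ.* + (p ^ suc k) ℤ.+ + 2 ℤ.* + Φ k (toℕ l))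
  X-ℤ = trans (cong (λ z → + X (f + k) (toℕ l) ℤ.+ z) (sym left)) (trans (cong (λ z → + z) (X-high f (toℕ<n l))) right)
    where
    left : + (p ^ f * (2 * f + 1 + 2 * p * σ k)) ≡ + (p ^ f) ℤ.* (+ 2 ℤ.* + f ℤ.+ + 1 ℤ.+ + 2 ℤ.* + p ℤ.* + σ k)
    left = trans (ℤᴾ.pos-* (p ^ f) _) (cong (λ z → + (p ^ f) ℤ.* z) (cong₂ ℤ._+_ (cong (ℤ._+ + 1) (ℤᴾ.pos-* 2 f))
      (trans (ℤᴾ.pos-* (2 * p) (σ k)) (cong (ℤ._* + σ k) (ℤᴾ.pos-* 2 p)))))
    right : + (p ^ f * (2 * suc (k + f) * p ^ suc k + 2 * Φ k (toℕ l))) ≡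
            + (p ^ f) ℤ.* (+ 2 ℤ.* (+ 1 ℤ.+ (+ k ℤ.+ + f)) ℤ.* + (p ^ suc k) ℤ.+ + 2 ℤ.* + Φ k (toℕ l))
    right = trans (ℤᴾ.pos-* (p ^ f) _) (cong (λ z → + (p ^ f) ℤ.* z) (cong₂ ℤ._+_
      (trans (ℤᴾ.pos-* (2 * suc (k + f)) (p ^ suc k)) (cong (ℤ._* + (p ^ suc k)) (ℤᴾ.pos-* 2 (suc (k + f)))))
      (ℤᴾ.pos-* 2 (Φ k (toℕ l)))))

  -- The correction `D` measures how far 2Φ departs from its value 2pσ at `l` = 0.
  M≡ : ∀ D → + 2 ℤ.* + Φ k (toℕ l) ≡ D ℤ.+ + 2 ℤ.* (+ p ℤ.* + σ k) → M ≡ c ℤ.* (A ℤ.+ D)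
  M≡ D 2Φ = begin
    M                                            ≡⟨ cong (λ z → + z) (𝓜≡ s 1≤s s≡) ⟩
    + (h * X (f + k) (toℕ l))                    ≡⟨ ℤᴾ.pos-* h _ ⟩
    + h ℤ.* + X (f + k) (toℕ l)                  ≡⟨ cong (λ z → + h ℤ.* z) (trans (from-ℕ (+ X (f + k) (toℕ l)) (+ (p ^ f)) (+ f) (+ p) (+ σ k) (+ Φ k (toℕ l)) (+ k) (+ (p ^ suc k)) D X-ℤ 2Φ)
                                                      (cong (λ z → + (p ^ f) ℤ.* (z ℤ.+ D)) (sym (A≡ s s≡)))) ⟩
    + h ℤ.* (+ (p ^ f) ℤ.* (A ℤ.+ D))            ≡⟨ sym (ℤᴾ.*-assoc (+ h) (+ (p ^ f)) (A ℤ.+ D)) ⟩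
    + h ℤ.* + (p ^ f) ℤ.* (A ℤ.+ D)              ≡⟨ cong (ℤ._* (A ℤ.+ D)) (trans (sym (ℤᴾ.pos-* h (p ^ f))) (sym c≡)) ⟩
    c ℤ.* (A ℤ.+ D)                              ∎
    where open ≡-Reasoning

  value-a : Φ k (toℕ l) ≡ p * σ k → M ≡ c ℤ.* A
  value-a eq = trans (M≡ (+ 0) (trans (cong (λ z → + 2 ℤ.* + z) eq) (trans (cong (λ z → + 2 ℤ.* z) (ℤᴾ.pos-* p (σ k))) (sym (ℤᴾ.+-identityˡ _)))))
    (cong (λ z → c ℤ.* z) (ℤᴾ.+-identityʳ A))

  value : ∀ x y D → Φ k (toℕ l) + x ≡ y → + 2 ℤ.* + y ≡ D ℤ.+ + 2 ℤ.* (+ p ℤ.* + σ k) ℤ.+ + 2 ℤ.* + x → M ≡ c ℤ.* (A ℤ.+ D)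
  value x y D eq 2y = M≡ D (begin
    + 2 ℤ.* + Φ k (toℕ l)                                      ≡⟨ e₁ (+ Φ k (toℕ l)) (+ x) ⟩
    + 2 ℤ.* (+ Φ k (toℕ l) ℤ.+ + x) ℤ.- + 2 ℤ.* + x                  ≡⟨ cong (λ z → + 2 ℤ.* + z ℤ.- + 2 ℤ.* + x) eq ⟩
    + 2 ℤ.* + y ℤ.- + 2 ℤ.* + x                                    ≡⟨ cong (ℤ._- + 2 ℤ.* + x) 2y ⟩
    D ℤ.+ + 2 ℤ.* (+ p ℤ.* + σ k) ℤ.+ + 2 ℤ.* + x ℤ.- + 2 ℤ.* + x          ≡⟨ e₂ (D ℤ.+ + 2 ℤ.* (+ p ℤ.* + σ k)) (+ x) ⟩
    D ℤ.+ + 2 ℤ.* (+ p ℤ.* + σ k)                                  ∎)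
    where
    open ≡-Reasoning
    e₁ : ∀ a b → + 2 ℤ.* a ≡ + 2 ℤ.* (a ℤ.+ b) ℤ.- + 2 ℤ.* b
    e₁ = ℤ-Solver.solve-∀
    e₂ : ∀ a b → a ℤ.+ + 2 ℤ.* b ℤ.- + 2 ℤ.* b ≡ a
    e₂ = ℤ-Solver.solve-∀

  value-1 : ∀ t S x → S ≡ σ k → Φ k (toℕ l) + x ≡ p * σ k + t * σ k →
            M ≡ c ℤ.* (A ℤ.+ + 2 ℤ.* + t ℤ.* + S ℤ.- + 2 ℤ.* + x)
  value-1 t _ x refl eq = trans
    (value x _ (+ 2 ℤ.* + t ℤ.* + σ k ℤ.- + 2 ℤ.* + x) eq
      (trans (cong (λ z → + 2 ℤ.* z) (cong₂ ℤ._+_ (ℤᴾ.pos-* p (σ k)) (ℤᴾ.pos-* t (σ k)))) (e (+ p) (+ t) (+ σ k) (+ x))))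
    (cong (λ z → c ℤ.* z) (sym (ℤᴾ.+-assoc A (+ 2 ℤ.* + t ℤ.* + σ k) (ℤ.- (+ 2 ℤ.* + x)))))
    where
    e : ∀ p t s x → + 2 ℤ.* (p ℤ.* s ℤ.+ t ℤ.* s) ≡ + 2 ℤ.* t ℤ.* s ℤ.- + 2 ℤ.* x ℤ.+ + 2 ℤ.* (p ℤ.* s) ℤ.+ + 2 ℤ.* x
    e = ℤ-Solver.solve-∀

  value-2 : ∀ t S x → S ≡ σ k → Φ k (toℕ l) + x ≡ t * σ k →
            M ≡ c ℤ.* (A ℤ.+ (+ 2 ℤ.* + t ℤ.- + 2 ℤ.* + p) ℤ.* + S ℤ.- + 2 ℤ.* + x)
  value-2 t _ x refl eq = trans
    (value x _ ((+ 2 ℤ.* + t ℤ.- + 2 ℤ.* + p) ℤ.* + σ k ℤ.- + 2 ℤ.* + x) eq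
      (trans (cong (λ z → + 2 ℤ.* z) (ℤᴾ.pos-* t (σ k))) (e (+ p) (+ t) (+ σ k) (+ x))))
    (cong (λ z → c ℤ.* z) (sym (ℤᴾ.+-assoc A ((+ 2 ℤ.* + t ℤ.- + 2 ℤ.* + p) ℤ.* + σ k) (ℤ.- (+ 2 ℤ.* + x)))))
    where
    e : ∀ p t s x → + 2 ℤ.* (t ℤ.* s) ≡ (+ 2 ℤ.* t ℤ.- + 2 ℤ.* p) ℤ.* s ℤ.- + 2 ℤ.* x ℤ.+ + 2 ℤ.* (p ℤ.* s) ℤ.+ + 2 ℤ.* x
    e = ℤ-Solver.solve-∀

  -- The geometric sum gives 2hσ = p^k - 1, and pσ = S₁ + p^k. Hence 2(y + hσ) - 2pσ is 2y - p^k -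
  -- 2S₁ - 1.
  value-d : ∀ S₁ y → S₁ ≡ p ^ 1 * σ k′ → Φ k (toℕ l) ≡ y + h * σ k →
            M ≡ c ℤ.* (A ℤ.- + (p ^ k) ℤ.- + 2 ℤ.* + S₁ ℤ.+ + 2 ℤ.* + y ℤ.- + 1)
  value-d _ y refl eq = trans
    (value 0 (y + h * σ k) (+ 2 ℤ.* + y ℤ.- + 1 ℤ.- + (p ^ k) ℤ.- + 2 ℤ.* + (p ^ 1 * σ k′)) (trans (+-identityʳ _) eq)
      (begin
        + 2 ℤ.* (+ y ℤ.+ + (h * σ k))                            ≡⟨ e₁ (+ y) (+ (h * σ k)) ⟩
        + 2 ℤ.* + y ℤ.+ + 2 ℤ.* + (h * σ k)                        ≡⟨ cong (λ z → + 2 ℤ.* + y ℤ.+ z) hσ ⟩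
        + 2 ℤ.* + y ℤ.+ (+ (p ^ k) ℤ.- + 1)                         ≡⟨ e₂ (+ y) (+ (p ^ k)) (+ (p ^ 1 * σ k′)) ⟩
        D ℤ.+ + 2 ℤ.* (+ (p ^ 1 * σ k′) ℤ.+ + (p ^ k)) ℤ.+ + 2 ℤ.* + 0 ≡⟨ cong (λ z → D ℤ.+ + 2 ℤ.* z ℤ.+ + 2 ℤ.* + 0) pσ ⟩
        D ℤ.+ + 2 ℤ.* (+ p ℤ.* + σ k) ℤ.+ + 2 ℤ.* + 0                   ∎))
    (cong (λ z → c ℤ.* z) (e₃ A (+ (p ^ k)) (+ (p ^ 1 * σ k′)) (+ y)))
    where
    open ≡-Reasoning
    D = + 2 ℤ.* + y ℤ.- + 1 ℤ.- + (p ^ k) ℤ.- + 2 ℤ.* + (p ^ 1 * σ k′)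
    e₀ : ∀ a → a ≡ (+ 1 ℤ.+ a) ℤ.- + 1
    e₀ = ℤ-Solver.solve-∀
    e₁ : ∀ y a → + 2 ℤ.* (y ℤ.+ a) ≡ + 2 ℤ.* y ℤ.+ + 2 ℤ.* a
    e₁ = ℤ-Solver.solve-∀
    e₂ : ∀ y Q S → + 2 ℤ.* y ℤ.+ (Q ℤ.- + 1) ≡ + 2 ℤ.* y ℤ.- + 1 ℤ.- Q ℤ.- + 2 ℤ.* S ℤ.+ + 2 ℤ.* (S ℤ.+ Q) ℤ.+ + 2 ℤ.* + 0
    e₂ = ℤ-Solver.solve-∀
    e₃ : ∀ A Q S y → A ℤ.+ (+ 2 ℤ.* y ℤ.- + 1 ℤ.- Q ℤ.- + 2 ℤ.* S) ≡ A ℤ.- Q ℤ.- + 2 ℤ.* S ℤ.+ + 2 ℤ.* y ℤ.- + 1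
    e₃ = ℤ-Solver.solve-∀
    hσ : + 2 ℤ.* + (h * σ k) ≡ + (p ^ k) ℤ.- + 1
    hσ = trans (sym (ℤᴾ.pos-* 2 (h * σ k))) (trans (e₀ (+ (2 * (h * σ k))))
      (cong (λ z → + z ℤ.- + 1) (trans (cong suc (sym (*-assoc 2 h (σ k)))) (sym (p^≡ k)))))
    pσ : + (p ^ 1 * σ k′) ℤ.+ + (p ^ k) ≡ + p ℤ.* + σ k
    pσ = trans (cong (λ z → + z) (trans (cong (λ z → z * σ k′ + p * q′) (*-identityʳ p)) (sym (*-distribˡ-+ p (σ k′) q′)))) (ℤᴾ.pos-* p (σ k))

mainTheorem8 :
  (p k s : ℕ) (p-prime : Prime p) (p-odd : 2 ∤ p) → 2 ≤ k → (s>k+2 : s > k + 2) →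
  (l : Fin (p ^ k)) →
  let M  = + Column.𝓜 p k p-prime p-odd (Column.V s (m<n⇒0<n s>k+2) l)
      Σp = powerSum p
      S  = Σp 0 (k ∸ 1)
      A  = A[ p , k , s ]
      c  = c[ p , k , s ]
  in
    -- (a)
    (toℕ l ≡ 0 → M ≡ c ℤ.* A)
    -- (b)
  × ((i t : ℕ) → i ≤ k ∸ 2 → 1 ≤ t → t ≤ p ∸ 1 →
       (t ∸ 1) * Σp i (k ∸ 1) + p ^ i ≤ toℕ l →
       toℕ l ≤ (t ∸ 1) * Σp (i + 1) (k ∸ 1) + p ^ (i + 1) ∸ 1 →
       (t ≤ (p ∸ 1) / 2 →
          M ≡ c ℤ.* (A ℤ.+ + 2 ℤ.* + t ℤ.* + S ℤ.- + 2 ℤ.* + Σp 0 (k ∸ i ∸ 2)))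
     × ((p + 1) / 2 ≤ t →
          M ≡ c ℤ.* (A ℤ.+ (+ 2 ℤ.* + t ℤ.- + 2 ℤ.* + p) ℤ.* + S ℤ.- + 2 ℤ.* + Σp 0 (k ∸ i ∸ 2))))
    -- (c)
  × ((t : ℕ) → 1 ≤ t → t ≤ p ∸ 1 → t ≢ (p ∸ 1) / 2 →
       t * p ^ (k ∸ 1) ≤ toℕ l → toℕ l ≤ t * S →
       (t ≤ (p ∸ 3) / 2 → M ≡ c ℤ.* (A ℤ.+ + 2 ℤ.* + t ℤ.* + S))
     × ((p + 1) / 2 ≤ t → M ≡ c ℤ.* (A ℤ.+ (+ 2 ℤ.* + t ℤ.- + 2 ℤ.* + p) ℤ.* + S)))
    -- (d)
  × ((i′ : ℕ) → 1 ≤ i′ → i′ ≤ k ∸ 1 →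
       (p ∸ 1) / 2 * Σp i′ (k ∸ 1) ≤ toℕ l →
       toℕ l ≤ (p ∸ 1) / 2 * Σp (i′ ∸ 1) (k ∸ 1) ∸ 1 →
       M ≡ c ℤ.* (A ℤ.- + (p ^ k) ℤ.- + 2 ℤ.* + Σp 1 (k ∸ 1) ℤ.+ + 2 ℤ.* + Σp (k ∸ i′ + 1) k ℤ.- + 1))
    -- (e)
  × (toℕ l ≡ (p ∸ 1) / 2 * S →
       M ≡ c ℤ.* (A ℤ.- + (p ^ k) ℤ.- + 2 ℤ.* + Σp 1 (k ∸ 1) ℤ.- + 1))
mainTheorem8 p (suc k′) s p-prime p-odd 2≤k s>k+2 l = case-a , case-b , case-c , case-d , case-e
  where
  h f k : ℕ
  h = p / 2
  f = s ∸ 2 ∸ k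
  k = suc k′

  k+2≤s : k + 2 ≤ s
  k+2≤s = <⇒≤ s>k+2

  s≡ : s ≡ suc (suc (f + k))
  s≡ = sym (trans (cong (λ z → suc (suc z)) (m∸n+n≡m (≤-trans (≤-reflexive (sym (m+n∸n≡m k 2))) (∸-monoˡ-≤ 2 k+2≤s))))
                  (m+[n∸m]≡n (≤-trans (m≤n+m 2 k) k+2≤s)))

  open Values h p k′ (odd≡1+2* p-odd) p-prime p-odd using (Θ; θ; σ; Φ; q; p∸1; [p∸1]/2; 0<h; 0<p^; 0<hΘ; powerSum-∑; powerSum-σ; Φ-a; module CaseB; Φ-c₁; Φ-c₂; Φ-d; Φ-e)
  open Main h p k′ (odd≡1+2* p-odd) p-prime p-odd f s (m<n⇒0<n s>k+2) s≡ l

  S : ℕ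
  S = powerSum p 0 (k ∸ 1)

  S≡ : S ≡ σ k
  S≡ = powerSum-σ k′

  powerSum-Θ : ∀ j → powerSum p j k′ ≡ Θ j
  powerSum-Θ j = powerSum-∑ j k′

  [p+1]/2 : (p + 1) / 2 ≡ suc h
  [p+1]/2 = trans (cong (_/ 2) (trans (cong (λ z → z + 1) (odd≡1+2* p-odd)) (double h))) (m*n/n≡m (suc h) 2)
    where
    double : ∀ h → suc (2 * h) + 1 ≡ suc h * 2
    double = solve-∀

  [p∸3]/2 : (p ∸ 3) / 2 ≡ h ∸ 1
  [p∸3]/2 = trans (cong (_/ 2) (trans (cong (λ z → z ∸ 3) (odd≡1+2* p-odd)) (trans (cong (λ z → z ∸ 2) (*-comm 2 h)) (sym (*-distribʳ-∸ 2 h 1)))))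
    (m*n/n≡m (h ∸ 1) 2)

  case-a : toℕ l ≡ 0 → M ≡ c ℤ.* A
  case-a l≡0 = value-a (trans (cong (Φ k) l≡0) Φ-a)

  case-b : (i t : ℕ) → i ≤ k ∸ 2 → 1 ≤ t → t ≤ p ∸ 1 →
           (t ∸ 1) * powerSum p i (k ∸ 1) + p ^ i ≤ toℕ l →
           toℕ l ≤ (t ∸ 1) * powerSum p (i + 1) (k ∸ 1) + p ^ (i + 1) ∸ 1 →
           (t ≤ (p ∸ 1) / 2 →
              M ≡ c ℤ.* (A ℤ.+ + 2 ℤ.* + t ℤ.* + S ℤ.- + 2 ℤ.* + powerSum p 0 (k ∸ i ∸ 2)))
         × ((p + 1) / 2 ≤ t →
              M ≡ c ℤ.* (A ℤ.+ (+ 2 ℤ.* + t ℤ.- + 2 ℤ.* + p) ℤ.* + S ℤ.- + 2 ℤ.* + powerSum p 0 (k ∸ i ∸ 2)))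
  case-b i (suc d) i≤ _ t≤ ≤l l≤ =
      (λ t≤h → value-1 (suc d) S x S≡ (trans (cong (λ z → Φ k (toℕ l) + z) x≡) (Φ-b₁ (≤-trans t≤h (≤-reflexive [p∸1]/2)))))
    , (λ h<t → value-2 (suc d) S x S≡ (trans (cong (λ z → Φ k (toℕ l) + z) x≡) (Φ-b₂ (s≤s⁻¹ (≤-trans (≤-reflexive (sym [p+1]/2)) h<t)))))
    where
    i<k′ : i < k′
    i<k′ = ≤∸1⇒< (s≤s⁻¹ 2≤k) i≤
    θ≤l : θ i d ≤ toℕ l
    θ≤l = subst (λ z → d * z + p ^ i ≤ toℕ l) (powerSum-Θ i) ≤l
    -- The truncated `∸ 1` in the bound is a genuine subtraction, because p^(i+1) is positive; so
    -- the interval is half open, ending at the next threshold.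
    l<θ : toℕ l < θ (suc i) d
    l<θ = ≤∸1⇒< (<-≤-trans (0<p^ (suc i)) (m≤n+m _ (d * Θ (suc i))))
      (subst₂ (λ j z → toℕ l ≤ d * z + p ^ j ∸ 1) (+-comm i 1) (trans (cong (λ j → powerSum p j k′) (+-comm i 1)) (powerSum-Θ (suc i))) l≤)
    x : ℕ
    x = powerSum p 0 (k ∸ i ∸ 2)
    -- The exponents 0, ..., k - i - 2 are k - i - 1 in number; `i < k′` prevents truncation.
    x≡ : x ≡ σ (k′ ∸ i)
    x≡ = trans (powerSum-σ (k ∸ i ∸ 2)) (cong σ (trans (cong (λ z → suc (z ∸ 2)) (+-∸-assoc 1 (<⇒≤ i<k′))) (m+[n∸m]≡n (m<n⇒0<n∸m i<k′))))
    open CaseB {toℕ l} {i} {d} (≤-trans t≤ (≤-reflexive p∸1)) i<k′ θ≤l l<θ using (Φ-b₁; Φ-b₂)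

  case-c : (t : ℕ) → 1 ≤ t → t ≤ p ∸ 1 → t ≢ (p ∸ 1) / 2 → t * p ^ (k ∸ 1) ≤ toℕ l → toℕ l ≤ t * S →
           (t ≤ (p ∸ 3) / 2 → M ≡ c ℤ.* (A ℤ.+ + 2 ℤ.* + t ℤ.* + S))
         × ((p + 1) / 2 ≤ t → M ≡ c ℤ.* (A ℤ.+ (+ 2 ℤ.* + t ℤ.- + 2 ℤ.* + p) ℤ.* + S))
  case-c t _ t≤ _ ≤l l≤ =
      (λ t<h → trans (value-1 t S 0 S≡ (trans (+-identityʳ _) (Φ-c₁ (≤∸1⇒< 0<h (≤-trans t<h (≤-reflexive [p∸3]/2))) ≤l l≤′)))
                     (cong (λ z → c ℤ.* z) (ℤᴾ.+-identityʳ (A ℤ.+ + 2 ℤ.* + t ℤ.* + S))))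
    , (λ h<t → trans (value-2 t S 0 S≡ (trans (+-identityʳ _) (Φ-c₂ (≤-trans (≤-reflexive (sym [p+1]/2)) h<t) (≤-trans t≤ (≤-reflexive p∸1)) ≤l l≤′)))
                     (cong (λ z → c ℤ.* z) (ℤᴾ.+-identityʳ (A ℤ.+ (+ 2 ℤ.* + t ℤ.- + 2 ℤ.* + p) ℤ.* + S))))
    where
    l≤′ : toℕ l ≤ t * Θ 0
    l≤′ = subst (λ z → toℕ l ≤ t * z) (powerSum-Θ 0) l≤

  case-d : (i′ : ℕ) → 1 ≤ i′ → i′ ≤ k ∸ 1 → (p ∸ 1) / 2 * powerSum p i′ (k ∸ 1) ≤ toℕ l →
           toℕ l ≤ (p ∸ 1) / 2 * powerSum p (i′ ∸ 1) (k ∸ 1) ∸ 1 →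
           M ≡ c ℤ.* (A ℤ.- + (p ^ k) ℤ.- + 2 ℤ.* + powerSum p 1 (k ∸ 1) ℤ.+ + 2 ℤ.* + powerSum p (k ∸ i′ + 1) k ℤ.- + 1)
  case-d (suc i) _ i<k′ ≤l l≤ = value-d (powerSum p 1 k′) y (powerSum-∑ 1 k′) (trans (Φ-d i<k′ ≤l′ l<) (cong (λ z → z + h * σ k) (sym y≡)))
    where
    i≤k′ : i ≤ k′
    i≤k′ = <⇒≤ i<k′
    y : ℕ
    y = powerSum p (k′ ∸ i + 1) k
    -- With `i′` = `suc i`, the exponents run from k - i′ + 1 to k and are `suc i` in number.
    y≡ : y ≡ p * (p ^ (k′ ∸ i) * σ (suc i))
    y≡ = trans (cong (λ j → powerSum p j k) (+-comm (k′ ∸ i) 1)) (trans (powerSum-∑ (suc (k′ ∸ i)) k)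
      (trans (cong (λ z → p ^ suc (k′ ∸ i) * σ z) (trans (+-∸-assoc 1 (m∸n≤m k′ i)) (cong suc (m∸[m∸n]≡n i≤k′))))
             (*-assoc p (p ^ (k′ ∸ i)) (σ (suc i)))))
    ≤l′ : h * Θ (suc i) ≤ toℕ l
    ≤l′ = subst₂ (λ a b → a * b ≤ toℕ l) [p∸1]/2 (powerSum-Θ (suc i)) ≤l
    l< : toℕ l < h * Θ i
    l< = ≤∸1⇒< (0<hΘ i≤k′) (subst₂ (λ a b → toℕ l ≤ a * b ∸ 1) [p∸1]/2 (powerSum-Θ i) l≤)

  case-e : toℕ l ≡ (p ∸ 1) / 2 * S → M ≡ c ℤ.* (A ℤ.- + (p ^ k) ℤ.- + 2 ℤ.* + powerSum p 1 (k ∸ 1) ℤ.- + 1)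
  case-e l≡ = trans
    -- At the upper end of the ranges of (d) the indicator is off for every `j`, so the extra sum
    -- `y` is empty.
    (value-d (powerSum p 1 k′) 0 (powerSum-∑ 1 k′) (trans (cong (Φ k) (trans l≡ (cong₂ (λ a b → a * b) [p∸1]/2 (powerSum-Θ 0)))) Φ-e))
    (cong (λ z → c ℤ.* (z ℤ.- + 1)) (ℤᴾ.+-identityʳ (A ℤ.- + (p ^ k) ℤ.- + 2 ℤ.* + powerSum p 1 (k ∸ 1))))
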